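{- Let $\alpha$ and $\beta$ be weak compositions of length $n$. Then \[\mathfrak{F}_\alpha\cdot\tilde{\mathcal{A}}_\beta=\sum_{D\in\operatorname{qSSet}(\alpha,\beta)}\tilde{\mathcal{A}}_{\operatorname{Des}(D)}.\]
   Context: Weak composition of length $n$: $\alpha\in\mathbb{Z}_{\ge0}^n$; $x^\alpha=\prod x_i^{\alpha_i}$. $\operatorname{flat}(\alpha)$: move all zeros of $\alpha$ to the right end, keeping order of nonzero entries (as a strong composition, drop the zeros). Dominance: $\gamma\trianglelefteq\delta$ iff $\gamma_1+\cdots+\gamma_j\le\delta_1+\cdots+\delta_j$ for all $j$. Refinement: for strong compositions $\mu,\nu$, $\mu\succcurlyeq\nu$ iff each part of $\nu$ is a sum of consecutive parts of $\mu$ (in order, using all parts of $\mu$). Operators: $S_n$ acts on length-$n$ vectors with $s_i$ swapping positions $i,i+1$; $w_\alpha$ is a minimal length permutation with $w_\alpha(\alpha)=\operatorname{flat}(\alpha)$. $\tilde{s}_i(\gamma)$ swaps positions $i,i+1$ if $\gamma_i=0$ or $\gamma_{i+1}=0$ and fixes $\gamma$ otherwise. $\tilde{\pi}_i(x^\gamma)=\dfrac{x_ix^\gamma-x_{i+1}x^{\tilde{s}_i(\gamma)}}{x_i-x_{i+1}}$ (extended linearly), $\tilde{\theta}_i=\tilde{\pi}_i-1$; for reduced $w=s_{i_1}\cdots s_{i_k}$, $\tilde{\pi}_w=\tilde{\pi}_{i_1}\cdots\tilde{\pi}_{i_k}$ and $\tilde{\theta}_w=\tilde{\theta}_{i_1}\cdots\tilde{\theta}_{i_k}$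 (independent of reduced word). Fundamental slide polynomial $\mathfrak{F}_\alpha=\tilde{\pi}_{w_\alpha^{ -1}}x^{\operatorname{flat}(\alpha)}$; fundamental Demazure atom $\tilde{\mathcal{A}}_\alpha=\tilde{\theta}_{w_\alpha^{ -1}}x^{\operatorname{flat}(\alpha)}$. Fundamental shift: for $v\in\mathbb{Z}_{\ge0}^n$ with nonzero positions $S=\{i_1<\cdots<i_k\}$, $\operatorname{qshift}(v)=(w_1,\ldots,w_n)$ with: (1) for $j\in S$, $w_j=v_j$ if $j=1$ or $j-1\in S$, else $w_j=1$; (2) if $i_j\in S$, $j<k$, $i_j+1\notin S$, then $w_{i_j+1}=v_{i_{j+1}}-1$; (3) if $1\notin S\neq\emptyset$, $w_1=v_{i_1}-1$; (4) other $w_j=0$. Words: let $A=(2n-1)^{\alpha_1}(2n-3)^{\alpha_2}\cdots 3^{\alpha_{n-1}}1^{\alpha_n}$ and $B=(2n)^{\beta_1}(2n-2)^{\beta_2}\cdots4^{\beta_{n-1}}2^{\beta_n}$ (exponents denote repetition). For a word $D$ in positive integers and the symbol $*$, its runs are: each occurrence of $*$ is a run containing no letters, and the remaining maximal factors of consecutive integer letters are cut at every strict descent (a letter strictly larger than the next) into weakly increasing runs. $\operatorname{Des}(D)$ is the vector of numbers of letters in the runs (in order), $\operatorname{Des}_A(D)$ (resp. $\operatorname{Des}_B(D)$) the vector counting odd (resp. even) letters in each run. $\operatorname{qSSet}(\alpha,\beta)$ is the set of words $D$ such that: $D$ is a shuffle of $A$, $B$ and $k$ copies of $*$, with $k$ such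 that $D$ has exactly $n$ runs; whenever $D$ has a consecutive factor $c*\cdots*d$ ($c,d$ integers, at least one $*$) then $c>d$; $\operatorname{flat}(\operatorname{Des}_A(D))\succcurlyeq\operatorname{flat}(\alpha)$ and $\operatorname{Des}_A(D)\trianglerighteq\alpha$; and $\operatorname{qshift}(\beta)\trianglerighteq\operatorname{Des}_B(D)\trianglerighteq\beta$. -}

module Defs where

open import Data.Nat using (ℕ; zero; suc; _+_; _*_; _∸_; _≡ᵇ_; _≤ᵇ_; _<ᵇ_)
open import Data.Integer using (ℤ; +_; -_)
import Data.Integer as Z
open import Data.Bool using (Bool; true; false; _∧_; _∨_; not; if_then_else_)
open import Data.Maybe using (Maybe; just; nothing)
open import Data.Product using (_×_; _,_)
open import Data.List using (List; []; _∷_; _++_; map; concatMap; foldr; foldl;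
  replicate; length; reverse; zip; upTo)
open import Relation.Binary.PropositionalEquality using (_≡_)

-- Weak compositions are lists of naturals; positions are 1-based.

-- entry at 1-based position j (0 when out of range)
get : List ℕ → ℕ → ℕ
get []       _             = 0
get (x ∷ xs) 0             = 0
get (x ∷ xs) 1             = x
get (x ∷ xs) (suc (suc j)) = get xs (suc j)

setAt : List ℕ → ℕ → ℕ → List ℕ
setAt []       _             v = []
setAt (x ∷ xs) 0             v = x ∷ xs
setAt (x ∷ xs) 1             v = v ∷ xs
setAt (x ∷ xs) (suc (suc j)) v = x ∷ setAt xs (suc j) v

isZero : ℕ → Bool
isZero zero    = true
isZero (suc _) = false

nz : ℕ → Bool
nz n = not (isZero n)

filterB : {A : Set} → (A → Bool) → List A → List A
filterB p []       = []
filterB p (x ∷ xs) = if p x then x ∷ filterB p xs else filterB p xs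

eqL : List ℕ → List ℕ → Bool
eqL []       []       = true
eqL (x ∷ xs) (y ∷ ys) = (x ≡ᵇ y) ∧ eqL xs ys
eqL _        _        = false

flatW : List ℕ → List ℕ
flatW α = filterB nz α ++ filterB isZero α

flatS : List ℕ → List ℕ
flatS α = filterB nz α

-- Dominance γ ⊴ δ : γ₁+…+γⱼ ≤ δ₁+…+δⱼ for all j (missing entries read as 0)

domGo : ℕ → ℕ → List ℕ → List ℕ → Bool
domGo sg sd []       []       = true
domGo sg sd (g ∷ gs) []       = ((sg + g) ≤ᵇ sd) ∧ domGo (sg + g) sd gs []
domGo sg sd []       (d ∷ ds) = (sg ≤ᵇ (sd + d)) ∧ domGo sg (sd + d) [] ds
domGo sg sd (g ∷ gs) (d ∷ ds) = ((sg + g) ≤ᵇ (sd + d)) ∧ domGo (sg + g) (sd + d) gs ds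

_⊴_ : List ℕ → List ℕ → Bool
γ ⊴ δ = domGo 0 0 γ δ

-- Refinement of strong compositions: μ ≽ ν iff each part of ν is a sum of
-- consecutive parts of μ (in order, using all parts of μ).
_≽_ : List ℕ → List ℕ → Bool
[]      ≽ []            = true
(m ∷ μ) ≽ (zero ∷ ν)    = false
(m ∷ μ) ≽ (suc v ∷ ν)   =
  if m ≡ᵇ suc v then μ ≽ ν
  else if (m <ᵇ suc v) ∧ nz m then μ ≽ ((suc v ∸ m) ∷ ν)
  else false
_       ≽ _             = false

nextNZ : List ℕ → ℕ → Maybe ℕ
nextNZ v j = go (length v ∸ j) (suc j)
  where
  go : ℕ → ℕ → Maybe ℕ
  go zero    p = nothing
  go (suc k) p = if nz (get v p) then just p else go k (suc p)

inS : List ℕ → ℕ → Bool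
inS v j = nz (get v j)

qshiftEntry : List ℕ → ℕ → ℕ
qshiftEntry v j =
  if inS v j then
    (if (j ≡ᵇ 1) ∨ inS v (j ∸ 1) then get v j else 1)
  else if j ≡ᵇ 1 then
    fromM (nextNZ v 0)
  else if inS v (j ∸ 1) then
    fromM (nextNZ v (j ∸ 1))
  else 0
  where
  fromM : Maybe ℕ → ℕ
  fromM (just p) = get v p ∸ 1
  fromM nothing  = 0

qshift : List ℕ → List ℕ
qshift v = map (λ i → qshiftEntry v (suc i)) (upTo (length v))

-- Polynomials in x₁,…,xₙ with integer coefficients: finite lists of
-- (coefficient, exponent vector) terms, compared coefficientwise.

Poly : Set
Poly = List (ℤ × List ℕ)

mono : List ℕ → Poly
mono e = (+ 1 , e) ∷ []

coeff : Poly → List ℕ → ℤ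
coeff []             m = + 0
coeff ((c , e) ∷ p) m = if eqL e m then c Z.+ coeff p m else coeff p m

_≈P_ : Poly → Poly → Set
p ≈P q = (m : List ℕ) → coeff p m ≡ coeff q m

addExp : List ℕ → List ℕ → List ℕ
addExp []       ys       = ys
addExp xs       []       = xs
addExp (x ∷ xs) (y ∷ ys) = (x + y) ∷ addExp xs ys

scale : ℤ → Poly → Poly
scale c = map (λ { (d , e) → (c Z.* d , e) })

negP : Poly → Poly
negP = scale (- (+ 1))

_*P_ : Poly → Poly → Poly
p *P q = concatMap (λ { (c , e) → map (λ { (d , f) → (c Z.* d , addExp e f) }) q }) p

sumP : List Poly → Poly
sumP = foldr _++_ []

linExt : (List ℕ → Poly) → Poly → Poly
linExt f = concatMap (λ { (c , e) → scale c (f e) })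

-- Divided difference on a monomial, written out as the exact quotient:
--   (xᵢ x^γ − xᵢ₊₁ x^{sᵢγ}) / (xᵢ − xᵢ₊₁),  with a = γᵢ, b = γᵢ₊₁:
--   b ≤ a :   Σ_{k=0}^{a−b} x^{γ[i↦a−k, i+1↦b+k]}
--   a < b : − Σ_{k=0}^{b−a−2} x^{γ[i↦b−1−k, i+1↦a+1+k]}
divDiff : ℕ → List ℕ → Poly
divDiff i γ =
  if b ≤ᵇ a
  then map (λ k → (+ 1 , setAt (setAt γ i (a ∸ k)) (suc i) (b + k))) (upTo (suc (a ∸ b)))
  else map (λ k → (- (+ 1) , setAt (setAt γ i (b ∸ 1 ∸ k)) (suc i) (a + 1 + k))) (upTo (b ∸ a ∸ 1))
  where
  a = get γ i
  b = get γ (suc i)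

-- π̃ᵢ(x^γ): s̃ᵢ fixes γ when γᵢ,γᵢ₊₁ are both nonzero, giving x^γ;
-- otherwise s̃ᵢ = sᵢ and π̃ᵢ is the divided difference above.
πMono : ℕ → List ℕ → Poly
πMono i γ = if nz (get γ i) ∧ nz (get γ (suc i)) then mono γ else divDiff i γ

π̃ : ℕ → Poly → Poly
π̃ i = linExt (πMono i)

θ̃ : ℕ → Poly → Poly
θ̃ i p = π̃ i p ++ negP p

-- A reduced word for w_α⁻¹, listed in order of application to flat(α):
-- with nonzero positions p₁<…<pₘ of α, for j = m down to 1 apply
-- s_j, s_{j+1}, …, s_{p_j − 1} (moving the j-th nonzero entry to p_j).

nzPositions : List ℕ → List ℕ
nzPositions α = filterB (λ p → nz (get α p)) (map suc (upTo (length α)))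

wordInv : List ℕ → List ℕ
wordInv α =
  concatMap (λ { (j , p) → map (λ t → j + t) (upTo (p ∸ j)) })
            (reverse (zip (map suc (upTo (length (nzPositions α)))) (nzPositions α)))

slide : List ℕ → Poly
slide α = foldl (λ p i → π̃ i p) (mono (flatW α)) (wordInv α)

atom : List ℕ → Poly
atom α = foldl (λ p i → θ̃ i p) (mono (flatW α)) (wordInv α)

-- Words: letters are `just k` (positive integer k) or `nothing` (the symbol *).

Word : Set
Word = List (Maybe ℕ)

-- A = (2n−1)^{α₁}(2n−3)^{α₂}…1^{αₙ},  B = (2n)^{β₁}(2n−2)^{β₂}…2^{βₙ}
wordA : List ℕ → Word
wordA []       = []
wordA (a ∷ as) = replicate a (just (2 * length as + 1)) ++ wordA as

wordB : List ℕ → Word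
wordB []       = []
wordB (b ∷ bs) = replicate b (just (2 * length bs + 2)) ++ wordB bs

shuffle : Word → Word → List Word
shuffle []       ys       = ys ∷ []
shuffle (x ∷ xs) []       = (x ∷ xs) ∷ []
shuffle (x ∷ xs) (y ∷ ys) =
  map (x ∷_) (shuffle xs (y ∷ ys)) ++ map (y ∷_) (shuffle (x ∷ xs) ys)

-- runs: each * is an empty run; integer factors are cut at strict descents
attach : ℕ → Word → List (List ℕ) → List (List ℕ)
attach x (just y ∷ _) (r ∷ rs) = if x ≤ᵇ y then (x ∷ r) ∷ rs else (x ∷ []) ∷ r ∷ rs
attach x _            rs       = (x ∷ []) ∷ rs

runs : Word → List (List ℕ)
runs []             = []
runs (nothing ∷ d)  = [] ∷ runs d
runs (just x ∷ d)   = attach x d (runs d)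

isOdd : ℕ → Bool
isOdd zero          = false
isOdd (suc zero)    = true
isOdd (suc (suc k)) = isOdd k

count : (ℕ → Bool) → List ℕ → ℕ
count p r = length (filterB p r)

Des : Word → List ℕ
Des D = map length (runs D)

DesA : Word → List ℕ
DesA D = map (count isOdd) (runs D)

DesB : Word → List ℕ
DesB D = map (count (λ k → not (isOdd k))) (runs D)

-- every factor c * ⋯ * d (at least one *) has c > d
afterStars : ℕ → Word → Bool
afterStars c []            = true
afterStars c (nothing ∷ r) = afterStars c r
afterStars c (just d ∷ r)  = d <ᵇ c

starOK : Word → Bool
starOK []                      = true
starOK (just c ∷ nothing ∷ r)  = afterStars c r ∧ starOK (nothing ∷ r)
starOK (just c ∷ just d ∷ r)   = starOK (just d ∷ r)
starOK (just c ∷ [])           = true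
starOK (nothing ∷ r)           = starOK r

-- candidates: shuffles of A, B and k copies of * (k ≤ n suffices, since
-- each * is a run and D must have exactly n runs)
candidates : ℕ → List ℕ → List ℕ → List Word
candidates n α β =
  concatMap (λ k → concatMap (λ w → shuffle w (replicate k nothing))
                             (shuffle (wordA α) (wordB β)))
            (upTo (suc n))

inQSSet : ℕ → List ℕ → List ℕ → Word → Bool
inQSSet n α β D =
  (length (runs D) ≡ᵇ n) ∧ starOK D
  ∧ (flatS (DesA D) ≽ flatS α) ∧ (α ⊴ DesA D)
  ∧ (DesB D ⊴ qshift β) ∧ (β ⊴ DesB D)

qSSet : ℕ → List ℕ → List ℕ → List Word
qSSet n α β = filterB (inQSSet n α β) (candidates n α β)

{-# OPTIONS --safe #-}
-- On coefficient functions the operators act by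
--   (π̃ᵢ f)(…,u,v,…) = f(…,u+v,0,…) + [u,v > 0] (f(…,u,v,…) − f(…,0,u+v,…)),
-- which shows that every slide and every atom is a sum of distinct monomials.
-- A monomial x^c of slide α is the word A cut into blocks of sizes c, where the
-- letters of α_i stay within the first i positions; a monomial x^d of atom β is B
-- cut likewise, where moreover the last letter of β_j is at position j exactly.
-- Sorting the letters within each position merges such a pair into a shuffle W of
-- A and B cut by m = c + d into weakly increasing blocks. So the coefficient of
-- x^m in the product counts the W which m cuts in an allowed way. Given W and m,
-- moving each run of W to the last position that it meets gives the unique
-- D in qSSet for which x^m is a monomial of atom (Des D): allowed letters stay
-- allowed, because a later letter in the same run is at least as large and hence
-- may stay at most as far right.

module Submission where

open import Defs
open import Data.Nat using (ℕ; zero; suc; _+_; _*_; _∸_; _≡ᵇ_; _≤ᵇ_; _<ᵇ_; _≤_; _<_; _≤?_; z≤n; s≤s; ⌈_/2⌉)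
open import Data.Nat.Properties
open import Data.Integer using (ℤ; 0ℤ; 1ℤ; -1ℤ)
import Data.Integer as Z
import Data.Integer.Properties as ℤ
open import Data.Bool using (Bool; true; false; _∧_; _∨_; not; if_then_else_; T)
open import Data.Bool.Properties using (∧-comm; ∧-assoc; ∧-zeroʳ; ∧-identityʳ; ∨-identityʳ; ∨-assoc)
open import Data.Maybe using (Maybe; just; nothing)
open import Data.Product using (_×_; _,_; proj₁; proj₂; ∃)
open import Data.Unit using (⊤; tt)
open import Data.Empty using (⊥; ⊥-elim)
open import Data.List using (List; []; _∷_; _++_; map; concat; concatMap; foldl; replicate; length; reverse; zip; upTo; applyUpTo)
open import Data.List.Properties using (map-++; map-∘; map-cong; length-map; length-replicate; map-replicate; ++-assoc; ++-identityʳ; foldl-++; map-upTo; upTo-∷ʳ; length-++; length-upTo; reverse-++; concatMap-cong)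
open import Data.List.Relation.Unary.All using (All; []; _∷_)
import Data.List.Relation.Unary.All as All
import Data.List.Relation.Unary.All.Properties as All
open import Data.Vec using (Vec; toList)
open import Data.Vec.Properties using (length-toList)
open import Data.List.Reverse using (Reverse; []; _∶_∶ʳ_; reverseView)
open import Function using (_∘_; id; flip)
open import Relation.Binary.Definitions using (Tri; tri<; tri≈; tri>)
open import Relation.Nullary using (¬_; yes; no)
open import Relation.Binary.PropositionalEquality

-- Boolean comparisons

-- Every claim is an equation between integer sums of indicators, so no bijection is ever built:
-- that a pair of monomials merges into one word, and that D exists and is unique, are identities of
-- such sums. The bridge to `qSSet` is that its conditions on `DesA D` and `DesB D` say exactly that
-- these vectors are monomials of the slide and of the atom; the recursive predicates `slideB` and
-- `atomB` are the common form in which both the operators and the dominance conditions can be read.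
-- On words everything becomes the single predicate `fits`, in which whether a letter is allowed
-- depends on the later letters only through the recurrence of an even letter. As the letters of A
-- are odd and those of B even, none of A ties with one of B, so merging is unambiguous and `fits`
-- splits by parity. The delicate point is an induction along a word whose runs may extend over
-- several blocks of m: taking letters one at a time leaves a run already begun, so the statement
-- has to separate a run lying in the first position from one lying further right.

bool-ext : ∀ {a b} → (a ≡ true → b ≡ true) → (b ≡ true → a ≡ true) → a ≡ b
bool-ext {true}  {b}     f g = sym (f refl)
bool-ext {false} {true}  f g = g refl
bool-ext {false} {false} f g = refl

∧-elim : ∀ {a b} → a ∧ b ≡ true → a ≡ true × b ≡ true
∧-elim {true} {true} _ = refl , refl

∧-cong-under : ∀ a {b c} → (a ≡ true → b ≡ c) → a ∧ b ≡ a ∧ c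
∧-cong-under true  e = e refl
∧-cong-under false e = refl

∧-swap : ∀ a b c → a ∧ b ∧ c ≡ b ∧ a ∧ c
∧-swap true  b c = refl
∧-swap false b c = sym (∧-zeroʳ b)

T⇒≡ : ∀ {b} → T b → b ≡ true
T⇒≡ {true} _ = refl

≡⇒T : ∀ {b} → b ≡ true → T b
≡⇒T refl = tt

≤ᵇ-sound : ∀ {m n} → (m ≤ᵇ n) ≡ true → m ≤ n
≤ᵇ-sound {m} {n} e = ≤ᵇ⇒≤ m n (≡⇒T e)

≤ᵇ-true : ∀ {m n} → m ≤ n → (m ≤ᵇ n) ≡ true
≤ᵇ-true le = T⇒≡ (≤⇒≤ᵇ le)

≤ᵇ-false : ∀ {m n} → n < m → (m ≤ᵇ n) ≡ false
≤ᵇ-false {m} {n} lt with m ≤ᵇ n in e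
... | true  = ⊥-elim (<⇒≱ lt (≤ᵇ-sound e))
... | false = refl

<ᵇ-true : ∀ {m n} → m < n → (m <ᵇ n) ≡ true
<ᵇ-true lt = T⇒≡ (<⇒<ᵇ lt)

<ᵇ-sound : ∀ {m n} → (m <ᵇ n) ≡ true → m < n
<ᵇ-sound {m} {n} e = <ᵇ⇒< m n (≡⇒T e)

<ᵇ-false : ∀ {m n} → n ≤ m → (m <ᵇ n) ≡ false
<ᵇ-false {m} {n} le with m <ᵇ n in e
... | true  = ⊥-elim (≤⇒≯ le (<ᵇ-sound e))
... | false = refl

≡ᵇ-sound : ∀ {m n} → (m ≡ᵇ n) ≡ true → m ≡ n
≡ᵇ-sound {m} {n} e = ≡ᵇ⇒≡ m n (≡⇒T e)

≡ᵇ-refl : ∀ n → (n ≡ᵇ n) ≡ true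
≡ᵇ-refl n = T⇒≡ (≡⇒≡ᵇ n n refl)

≡ᵇ-true : ∀ {m n} → m ≡ n → (m ≡ᵇ n) ≡ true
≡ᵇ-true {m} refl = ≡ᵇ-refl m

≡ᵇ-false : ∀ {m n} → ¬ m ≡ n → (m ≡ᵇ n) ≡ false
≡ᵇ-false {m} {n} ne with m ≡ᵇ n in e
... | true  = ⊥-elim (ne (≡ᵇ-sound e))
... | false = refl

≤ᵇ-cong : ∀ {m n k l} → (m ≤ n → k ≤ l) → (k ≤ l → m ≤ n) → (m ≤ᵇ n) ≡ (k ≤ᵇ l)
≤ᵇ-cong f g = bool-ext (λ e → ≤ᵇ-true (f (≤ᵇ-sound e))) (λ e → ≤ᵇ-true (g (≤ᵇ-sound e)))

eqL-sound : ∀ xs ys → eqL xs ys ≡ true → xs ≡ ys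
eqL-sound []       []       _ = refl
eqL-sound (x ∷ xs) (y ∷ ys) e =
  cong₂ _∷_ (≡ᵇ-sound (proj₁ (∧-elim e))) (eqL-sound xs ys (proj₂ (∧-elim e)))

eqL-length : ∀ xs ys → ¬ length xs ≡ length ys → eqL xs ys ≡ false
eqL-length xs ys ne with eqL xs ys in e
... | true  = ⊥-elim (ne (cong length (eqL-sound xs ys e)))
... | false = refl

-- Opaque copies of the integer operations: the library ones unfold on open
-- terms, which defeats unification.

infixl 6 _+ℤ_
infixl 7 _*ℤ_

opaque
  _+ℤ_ : ℤ → ℤ → ℤ
  _+ℤ_ = Z._+_

  _*ℤ_ : ℤ → ℤ → ℤ
  _*ℤ_ = Z._*_

  -ℤ_ : ℤ → ℤ
  -ℤ_ = Z.-_

opaque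
  unfolding _+ℤ_

  +ℤ-def : ∀ a b → a Z.+ b ≡ a +ℤ b
  +ℤ-def a b = refl

  *ℤ-def : ∀ a b → a Z.* b ≡ a *ℤ b
  *ℤ-def a b = refl

  -ℤ-def : ∀ a → Z.- a ≡ -ℤ a
  -ℤ-def a = refl

  +-idˡ : ∀ a → 0ℤ +ℤ a ≡ a
  +-idˡ = ℤ.+-identityˡ

  +-idʳ : ∀ a → a +ℤ 0ℤ ≡ a
  +-idʳ = ℤ.+-identityʳ

  +ℤ-comm : ∀ a b → a +ℤ b ≡ b +ℤ a
  +ℤ-comm = ℤ.+-comm

  +ℤ-assoc : ∀ a b c → (a +ℤ b) +ℤ c ≡ a +ℤ (b +ℤ c)
  +ℤ-assoc = ℤ.+-assoc

  *-idˡ : ∀ a → 1ℤ *ℤ a ≡ a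
  *-idˡ = ℤ.*-identityˡ

  *-idʳ : ∀ a → a *ℤ 1ℤ ≡ a
  *-idʳ = ℤ.*-identityʳ

  *-0ˡ : ∀ a → 0ℤ *ℤ a ≡ 0ℤ
  *-0ˡ = ℤ.*-zeroˡ

  *-0ʳ : ∀ a → a *ℤ 0ℤ ≡ 0ℤ
  *-0ʳ = ℤ.*-zeroʳ

  *ℤ-comm : ∀ a b → a *ℤ b ≡ b *ℤ a
  *ℤ-comm = ℤ.*-comm

  *ℤ-assoc : ∀ a b c → (a *ℤ b) *ℤ c ≡ a *ℤ (b *ℤ c)
  *ℤ-assoc = ℤ.*-assoc

  *-distribˡ : ∀ a b c → a *ℤ (b +ℤ c) ≡ a *ℤ b +ℤ a *ℤ c
  *-distribˡ = ℤ.*-distribˡ-+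

  +-inverseʳ : ∀ a → a +ℤ -ℤ a ≡ 0ℤ
  +-inverseʳ = ℤ.+-inverseʳ

  -ℤ-*ˡ : ∀ a b → (-ℤ a) *ℤ b ≡ -ℤ (a *ℤ b)
  -ℤ-*ˡ a b = sym (ℤ.neg-distribˡ-* a b)

  -ℤ-0 : -ℤ 0ℤ ≡ 0ℤ
  -ℤ-0 = refl

  -ℤ-+ : ∀ a b → -ℤ (a +ℤ b) ≡ -ℤ a +ℤ -ℤ b
  -ℤ-+ = ℤ.neg-distrib-+

-ℤ-*ʳ : ∀ a b → a *ℤ (-ℤ b) ≡ -ℤ (a *ℤ b)
-ℤ-*ʳ a b = trans (*ℤ-comm a _) (trans (-ℤ-*ˡ b a) (cong -ℤ_ (*ℤ-comm b a)))

+ℤ-interchange : ∀ a b c d → (a +ℤ b) +ℤ (c +ℤ d) ≡ (a +ℤ c) +ℤ (b +ℤ d)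
+ℤ-interchange a b c d =
  trans (+ℤ-assoc a b _) (trans (cong (a +ℤ_)
    (trans (sym (+ℤ-assoc b c d)) (trans (cong (_+ℤ d) (+ℤ-comm b c)) (+ℤ-assoc c b d))))
    (sym (+ℤ-assoc a c _)))

*ℤ-interchange : ∀ a b c d → (a *ℤ b) *ℤ (c *ℤ d) ≡ (a *ℤ c) *ℤ (b *ℤ d)
*ℤ-interchange a b c d =
  trans (*ℤ-assoc a b _) (trans (cong (a *ℤ_)
    (trans (sym (*ℤ-assoc b c d)) (trans (cong (_*ℤ d) (*ℤ-comm b c)) (*ℤ-assoc c b d))))
    (sym (*ℤ-assoc a c _)))

-- Indicators and finite sums

⟦_⟧ : Bool → ℤ
⟦ true  ⟧ = 1ℤ
⟦ false ⟧ = 0ℤ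

⟦∧⟧ : ∀ a b → ⟦ a ∧ b ⟧ ≡ ⟦ a ⟧ *ℤ ⟦ b ⟧
⟦∧⟧ true  b = sym (*-idˡ ⟦ b ⟧)
⟦∧⟧ false b = sym (*-0ˡ ⟦ b ⟧)

∑ : {A : Set} → List A → (A → ℤ) → ℤ
∑ []       f = 0ℤ
∑ (x ∷ xs) f = f x +ℤ ∑ xs f

∑-++ : ∀ {A : Set} xs ys {f : A → ℤ} → ∑ (xs ++ ys) f ≡ ∑ xs f +ℤ ∑ ys f
∑-++ []       ys {f} = sym (+-idˡ _)
∑-++ (x ∷ xs) ys {f} = trans (cong (f x +ℤ_) (∑-++ xs ys)) (sym (+ℤ-assoc (f x) _ _))

∑-map : ∀ {A B : Set} (g : A → B) xs {f : B → ℤ} → ∑ (map g xs) f ≡ ∑ xs (f ∘ g)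
∑-map g []       = refl
∑-map g (x ∷ xs) = cong (_ +ℤ_) (∑-map g xs)

∑-concatMap : ∀ {A B : Set} (g : A → List B) xs {f : B → ℤ} →
  ∑ (concatMap g xs) f ≡ ∑ xs (λ x → ∑ (g x) f)
∑-concatMap g []           = refl
∑-concatMap g (x ∷ xs) {f} = trans (∑-++ (g x) (concatMap g xs)) (cong (_ +ℤ_) (∑-concatMap g xs))

∑-cong : ∀ {A : Set} xs {f g : A → ℤ} → (∀ x → f x ≡ g x) → ∑ xs f ≡ ∑ xs g
∑-cong []       e = refl
∑-cong (x ∷ xs) e = cong₂ _+ℤ_ (e x) (∑-cong xs e)

∑-cong-All : ∀ {A : Set} {P : A → Set} {xs} {f g : A → ℤ} → All P xs → (∀ x → P x → f x ≡ g x) → ∑ xs f ≡ ∑ xs g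
∑-cong-All []       e = refl
∑-cong-All (p ∷ ps) e = cong₂ _+ℤ_ (e _ p) (∑-cong-All ps e)

∑-zero : ∀ {A : Set} (xs : List A) → ∑ xs (λ _ → 0ℤ) ≡ 0ℤ
∑-zero []       = refl
∑-zero (x ∷ xs) = trans (+-idˡ _) (∑-zero xs)

∑-vanish : ∀ {A : Set} xs {f : A → ℤ} → (∀ x → f x ≡ 0ℤ) → ∑ xs f ≡ 0ℤ
∑-vanish xs e = trans (∑-cong xs e) (∑-zero xs)

∑-*ˡ : ∀ {A : Set} c (xs : List A) {f : A → ℤ} → ∑ xs (λ x → c *ℤ f x) ≡ c *ℤ ∑ xs f
∑-*ˡ c []       = sym (*-0ʳ c)
∑-*ˡ c (x ∷ xs) = trans (cong (_ +ℤ_) (∑-*ˡ c xs)) (sym (*-distribˡ c _ _))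

∑-+ : ∀ {A : Set} (xs : List A) {f g : A → ℤ} → ∑ xs (λ x → f x +ℤ g x) ≡ ∑ xs f +ℤ ∑ xs g
∑-+ []       = sym (+-idˡ 0ℤ)
∑-+ (x ∷ xs) {f} {g} = trans (cong ((f x +ℤ g x) +ℤ_) (∑-+ xs)) (+ℤ-interchange (f x) (g x) _ _)

∑-swap : ∀ {A B : Set} (xs : List A) (ys : List B) {f : A → B → ℤ} →
  ∑ xs (λ x → ∑ ys (f x)) ≡ ∑ ys (λ y → ∑ xs (λ x → f x y))
∑-swap []       ys = sym (∑-zero ys)
∑-swap (x ∷ xs) ys = trans (cong (_ +ℤ_) (∑-swap xs ys)) (sym (∑-+ ys))

∑-filterB : ∀ {A : Set} p (xs : List A) {f : A → ℤ} → ∑ (filterB p xs) f ≡ ∑ xs (λ x → ⟦ p x ⟧ *ℤ f x)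
∑-filterB p []       = refl
∑-filterB p (x ∷ xs) with p x
... | true  = cong₂ _+ℤ_ (sym (*-idˡ _)) (∑-filterB p xs)
... | false = trans (∑-filterB p xs) (trans (sym (+-idˡ _)) (cong (_+ℤ _) (sym (*-0ˡ _))))

∑-applyUpTo : ∀ (g : ℕ → ℕ) n {f : ℕ → ℤ} → ∑ (applyUpTo g n) f ≡ ∑ (upTo n) (f ∘ g)
∑-applyUpTo g n {f} = trans (cong (λ l → ∑ l f) (sym (map-upTo g n))) (∑-map g (upTo n))

∑-upTo-suc : ∀ n {f : ℕ → ℤ} → ∑ (upTo (suc n)) f ≡ f 0 +ℤ ∑ (upTo n) (f ∘ suc)
∑-upTo-suc n {f} = cong (f 0 +ℤ_) (∑-applyUpTo suc n)

∑-upTo-point : ∀ N v {g : ℕ → ℤ} → ∑ (upTo N) (λ k → ⟦ k ≡ᵇ v ⟧ *ℤ g k) ≡ ⟦ v <ᵇ N ⟧ *ℤ g v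
∑-upTo-point zero    v       {g} = sym (*-0ˡ (g v))
∑-upTo-point (suc N) zero    {g} =
  trans (∑-upTo-suc N) (trans (cong (_ +ℤ_) (∑-vanish (upTo N) (λ k → *-0ˡ (g (suc k))))) (+-idʳ _))
∑-upTo-point (suc N) (suc v) {g} =
  trans (∑-upTo-suc N) (trans (cong₂ _+ℤ_ (*-0ˡ (g 0)) (∑-upTo-point N v)) (+-idˡ _))

-- Linear functionals on polynomials

-- Terms of a `Poly` may repeat or cancel, so a polynomial is only accessed through linear
-- functionals; `coeff` at m is the one given by `δ m`.
eval : (List ℕ → ℤ) → Poly → ℤ
eval φ p = ∑ p (λ t → proj₁ t *ℤ φ (proj₂ t))

δ : List ℕ → List ℕ → ℤ
δ m e = ⟦ eqL e m ⟧

coeff-eval : ∀ p m → coeff p m ≡ eval (δ m) p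
coeff-eval []            m = refl
coeff-eval ((c , e) ∷ p) m with eqL e m
... | true  = trans (+ℤ-def c _) (cong₂ _+ℤ_ (sym (*-idʳ c)) (coeff-eval p m))
... | false = trans (coeff-eval p m) (trans (sym (+-idˡ _)) (cong (_+ℤ eval (δ m) p) (sym (*-0ʳ c))))

eval-++ : ∀ φ p q → eval φ (p ++ q) ≡ eval φ p +ℤ eval φ q
eval-++ φ p q = ∑-++ p q

eval-cong : ∀ {φ ψ} p → (∀ e → φ e ≡ ψ e) → eval φ p ≡ eval ψ p
eval-cong p h = ∑-cong p (λ t → cong (proj₁ t *ℤ_) (h (proj₂ t)))

eval-scale : ∀ φ c p → eval φ (scale c p) ≡ c *ℤ eval φ p
eval-scale φ c p = begin
  eval φ (scale c p)                                ≡⟨ ∑-map _ p ⟩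
  ∑ p (λ t → (c Z.* proj₁ t) *ℤ φ (proj₂ t))        ≡⟨ ∑-cong p (λ t → trans (cong (_*ℤ _) (*ℤ-def c _)) (*ℤ-assoc c _ _)) ⟩
  ∑ p (λ t → c *ℤ (proj₁ t *ℤ φ (proj₂ t)))         ≡⟨ ∑-*ˡ c p ⟩
  c *ℤ eval φ p                                     ∎
  where open ≡-Reasoning

eval-negP : ∀ φ p → eval φ (negP p) ≡ -ℤ eval φ p
eval-negP φ p = trans (eval-scale φ (-1ℤ) p)
  (trans (cong (_*ℤ eval φ p) (-ℤ-def 1ℤ)) (trans (-ℤ-*ˡ 1ℤ _) (cong -ℤ_ (*-idˡ _))))

eval-linExt : ∀ φ f p → eval φ (linExt f p) ≡ eval (λ e → eval φ (f e)) p
eval-linExt φ f p = trans (∑-concatMap _ p) (∑-cong p (λ t → eval-scale φ (proj₁ t) (f (proj₂ t))))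

eval-*P : ∀ φ p q → eval φ (p *P q) ≡ eval (λ e → eval (λ f → φ (addExp e f)) q) p
eval-*P φ p q = trans (∑-concatMap _ p) (∑-cong p (λ t →
  trans (∑-map _ q) (trans (∑-cong q (λ s → trans (cong (_*ℤ φ (addExp (proj₂ t) (proj₂ s))) (*ℤ-def (proj₁ t) (proj₁ s))) (*ℤ-assoc (proj₁ t) (proj₁ s) _)))
    (∑-*ˡ (proj₁ t) q))))

-- This concerns the number of variables, not the degree: `addExp`, `conv` and `Π` are only
-- meaningful on exponent vectors of one length.
Homogeneous : ℕ → Poly → Set
Homogeneous n = All (λ t → length (proj₂ t) ≡ n)

eval-cong-Homogeneous : ∀ {n φ ψ p} → Homogeneous n p → (∀ e → length e ≡ n → φ e ≡ ψ e) → eval φ p ≡ eval ψ p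
eval-cong-Homogeneous hp h = ∑-cong-All hp (λ t l → cong (proj₁ t *ℤ_) (h (proj₂ t) l))

coeff-Homogeneous : ∀ {n p} m → Homogeneous n p → ¬ length m ≡ n → coeff p m ≡ 0ℤ
coeff-Homogeneous {n} {p} m hp ne = trans (coeff-eval p m)
  (trans (eval-cong-Homogeneous hp (λ e l → cong ⟦_⟧ (eqL-length e m (λ q → ne (trans (sym q) l)))))
         (∑-vanish p (λ t → *-0ʳ (proj₁ t))))

-- Convolution of functions on exponent vectors

-- A sum over all i + k = j. The recursion splits off the term with i = 0, which is the case
-- distinction needed when two sorted blocks are merged.
conv₁ : ℕ → (ℕ → ℕ → ℤ) → ℤ
conv₁ zero    F = F 0 0
conv₁ (suc j) F = F 0 (suc j) +ℤ conv₁ j (λ i k → F (suc i) k)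

conv : List ℕ → (List ℕ → List ℕ → ℤ) → ℤ
conv []      F = F [] []
conv (x ∷ m) F = conv₁ x (λ i k → conv m (λ c d → F (i ∷ c) (k ∷ d)))

conv₁-cong : ∀ j {F G} → (∀ i k → F i k ≡ G i k) → conv₁ j F ≡ conv₁ j G
conv₁-cong zero    e = e 0 0
conv₁-cong (suc j) e = cong₂ _+ℤ_ (e 0 (suc j)) (conv₁-cong j (λ i k → e (suc i) k))

conv-cong : ∀ m {F G} → (∀ c d → length c ≡ length m → length d ≡ length m → F c d ≡ G c d) → conv m F ≡ conv m G
conv-cong []      e = e [] [] refl refl
conv-cong (x ∷ m) e = conv₁-cong x (λ i k → conv-cong m (λ c d lc ld → e (i ∷ c) (k ∷ d) (cong suc lc) (cong suc ld)))

conv₁-zero : ∀ j → conv₁ j (λ _ _ → 0ℤ) ≡ 0ℤ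
conv₁-zero zero    = refl
conv₁-zero (suc j) = trans (+-idˡ _) (conv₁-zero j)

conv-zero : ∀ m → conv m (λ _ _ → 0ℤ) ≡ 0ℤ
conv-zero []      = refl
conv-zero (x ∷ m) = trans (conv₁-cong x (λ _ _ → conv-zero m)) (conv₁-zero x)

conv₁-+ : ∀ j {F G} → conv₁ j (λ i k → F i k +ℤ G i k) ≡ conv₁ j F +ℤ conv₁ j G
conv₁-+ zero    = refl
conv₁-+ (suc j) {F} {G} = trans (cong ((F 0 (suc j) +ℤ G 0 (suc j)) +ℤ_) (conv₁-+ j)) (+ℤ-interchange (F 0 (suc j)) (G 0 (suc j)) _ _)

conv-+ : ∀ m {F G} → conv m (λ c d → F c d +ℤ G c d) ≡ conv m F +ℤ conv m G
conv-+ []      = refl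
conv-+ (x ∷ m) = trans (conv₁-cong x (λ _ _ → conv-+ m)) (conv₁-+ x)

conv₁-*ˡ : ∀ j a {F} → conv₁ j (λ i k → a *ℤ F i k) ≡ a *ℤ conv₁ j F
conv₁-*ˡ zero    a = refl
conv₁-*ˡ (suc j) a {F} = trans (cong (a *ℤ F 0 (suc j) +ℤ_) (conv₁-*ˡ j a)) (sym (*-distribˡ a (F 0 (suc j)) _))

conv-*ˡ : ∀ m a {F} → conv m (λ c d → a *ℤ F c d) ≡ a *ℤ conv m F
conv-*ˡ []      a = refl
conv-*ˡ (x ∷ m) a = trans (conv₁-cong x (λ _ _ → conv-*ˡ m a)) (conv₁-*ˡ x a)

conv₁-last : ∀ j {F} → conv₁ (suc j) F ≡ F (suc j) 0 +ℤ conv₁ j (λ i k → F i (suc k))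
conv₁-last zero    {F} = +ℤ-comm (F 0 1) (F 1 0)
conv₁-last (suc j) {F} = begin
  F 0 (2 + j) +ℤ conv₁ (suc j) (λ i k → F (suc i) k)
    ≡⟨ cong (F 0 (2 + j) +ℤ_) (conv₁-last j {λ i k → F (suc i) k}) ⟩
  F 0 (2 + j) +ℤ (F (2 + j) 0 +ℤ conv₁ j (λ i k → F (suc i) (suc k)))
    ≡⟨ +ℤ-assoc (F 0 (2 + j)) (F (2 + j) 0) _ ⟨
  (F 0 (2 + j) +ℤ F (2 + j) 0) +ℤ conv₁ j (λ i k → F (suc i) (suc k))
    ≡⟨ cong (_+ℤ conv₁ j (λ i k → F (suc i) (suc k))) (+ℤ-comm (F 0 (2 + j)) (F (2 + j) 0)) ⟩
  (F (2 + j) 0 +ℤ F 0 (2 + j)) +ℤ conv₁ j (λ i k → F (suc i) (suc k))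
    ≡⟨ +ℤ-assoc (F (2 + j) 0) (F 0 (2 + j)) _ ⟩
  F (2 + j) 0 +ℤ conv₁ (suc j) (λ i k → F i (suc k)) ∎
  where open ≡-Reasoning

conv₁-flip : ∀ j {F} → conv₁ j F ≡ conv₁ j (flip F)
conv₁-flip zero    = refl
conv₁-flip (suc j) {F} = trans (cong (F 0 (suc j) +ℤ_) (conv₁-flip j)) (sym (conv₁-last j {flip F}))

conv-flip : ∀ m {F} → conv m F ≡ conv m (flip F)
conv-flip []      = refl
conv-flip (x ∷ m) = trans (conv₁-flip x) (conv₁-cong x (λ _ _ → conv-flip m))

eval-conv : ∀ m {g : List ℕ → List ℕ → List ℕ → ℤ} p →
  eval (λ e → conv m (λ c d → g c d e)) p ≡ conv m (λ c d → eval (g c d) p)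
eval-conv m []      = sym (conv-zero m)
eval-conv m ((a , e) ∷ p) =
  trans (cong₂ _+ℤ_ (sym (conv-*ˡ m a)) (eval-conv m p)) (sym (conv-+ m))

conv₁-δ : ∀ x a b → conv₁ x (λ i k → ⟦ a ≡ᵇ i ⟧ *ℤ ⟦ b ≡ᵇ k ⟧) ≡ ⟦ a + b ≡ᵇ x ⟧
conv₁-δ zero    zero    b = *-idˡ ⟦ b ≡ᵇ 0 ⟧
conv₁-δ zero    (suc a) b = *-0ˡ ⟦ b ≡ᵇ 0 ⟧
conv₁-δ (suc x) zero    b =
  trans (cong₂ _+ℤ_ (*-idˡ ⟦ b ≡ᵇ suc x ⟧) (trans (conv₁-cong x (λ i k → *-0ˡ ⟦ b ≡ᵇ k ⟧)) (conv₁-zero x))) (+-idʳ _)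
conv₁-δ (suc x) (suc a) b =
  trans (cong₂ _+ℤ_ (*-0ˡ ⟦ b ≡ᵇ suc x ⟧) (conv₁-δ x a b)) (+-idˡ _)

conv-δ : ∀ m e f → length e ≡ length m → length f ≡ length m →
  conv m (λ c d → δ c e *ℤ δ d f) ≡ δ m (addExp e f)
conv-δ []      []      []      _  _  = *-idˡ 1ℤ
conv-δ (x ∷ m) (a ∷ e) (b ∷ f) le lf = begin
  conv₁ x (λ i k → conv m (λ c d → ⟦ (a ≡ᵇ i) ∧ eqL e c ⟧ *ℤ ⟦ (b ≡ᵇ k) ∧ eqL f d ⟧))
    ≡⟨ conv₁-cong x (λ i k → trans (conv-cong m (λ c d _ _ →
         trans (cong₂ _*ℤ_ (⟦∧⟧ (a ≡ᵇ i) _) (⟦∧⟧ (b ≡ᵇ k) _)) (*ℤ-interchange ⟦ a ≡ᵇ i ⟧ (δ c e) ⟦ b ≡ᵇ k ⟧ (δ d f)))) (conv-*ˡ m _)) ⟩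
  conv₁ x (λ i k → ⟦ a ≡ᵇ i ⟧ *ℤ ⟦ b ≡ᵇ k ⟧ *ℤ conv m (λ c d → δ c e *ℤ δ d f))
    ≡⟨ conv₁-cong x (λ i k → *ℤ-comm (⟦ a ≡ᵇ i ⟧ *ℤ ⟦ b ≡ᵇ k ⟧) _) ⟩
  conv₁ x (λ i k → conv m (λ c d → δ c e *ℤ δ d f) *ℤ (⟦ a ≡ᵇ i ⟧ *ℤ ⟦ b ≡ᵇ k ⟧))
    ≡⟨ conv₁-*ˡ x _ ⟩
  conv m (λ c d → δ c e *ℤ δ d f) *ℤ conv₁ x (λ i k → ⟦ a ≡ᵇ i ⟧ *ℤ ⟦ b ≡ᵇ k ⟧)
    ≡⟨ cong₂ _*ℤ_ (conv-δ m e f (suc-injective le) (suc-injective lf)) (conv₁-δ x a b) ⟩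
  δ m (addExp e f) *ℤ ⟦ a + b ≡ᵇ x ⟧
    ≡⟨ *ℤ-comm (δ m (addExp e f)) _ ⟩
  ⟦ a + b ≡ᵇ x ⟧ *ℤ δ m (addExp e f)
    ≡⟨ ⟦∧⟧ (a + b ≡ᵇ x) _ ⟨
  ⟦ (a + b ≡ᵇ x) ∧ eqL (addExp e f) m ⟧ ∎
  where open ≡-Reasoning

-- By `conv-δ` the point mass at a sum of exponents is a convolution of point masses, and
-- convolution commutes with both evaluations.
coeff-*P : ∀ {n} p q m → Homogeneous n p → Homogeneous n q → length m ≡ n →
  coeff (p *P q) m ≡ conv m (λ c d → coeff p c *ℤ coeff q d)
coeff-*P {n} p q m hp hq lm = begin
  coeff (p *P q) m
    ≡⟨ coeff-eval (p *P q) m ⟩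
  eval (δ m) (p *P q)
    ≡⟨ eval-*P (δ m) p q ⟩
  eval (λ e → eval (λ f → δ m (addExp e f)) q) p
    ≡⟨ eval-cong-Homogeneous hp (λ e le → eval-cong-Homogeneous hq (λ f lf →
         sym (conv-δ m e f (trans le (sym lm)) (trans lf (sym lm))))) ⟩
  eval (λ e → eval (λ f → conv m (λ c d → δ c e *ℤ δ d f)) q) p
    ≡⟨ eval-cong p (λ e → eval-conv m q) ⟩
  eval (λ e → conv m (λ c d → eval (λ f → δ c e *ℤ δ d f) q)) p
    ≡⟨ eval-conv m p ⟩
  conv m (λ c d → eval (λ e → eval (λ f → δ c e *ℤ δ d f) q) p)
    ≡⟨ conv-cong m (λ c d _ _ → trans (eval-cong p (λ e → eval-*ˡ (δ c e) (δ d) q)) (eval-*ʳ (eval (δ d) q) (δ c) p)) ⟩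
  conv m (λ c d → eval (δ c) p *ℤ eval (δ d) q)
    ≡⟨ conv-cong m (λ c d _ _ → sym (cong₂ _*ℤ_ (coeff-eval p c) (coeff-eval q d))) ⟩
  conv m (λ c d → coeff p c *ℤ coeff q d) ∎
  where
  open ≡-Reasoning
  eval-*ˡ : ∀ a φ p → eval (λ e → a *ℤ φ e) p ≡ a *ℤ eval φ p
  eval-*ˡ a φ p = trans (∑-cong p (λ t →
    trans (sym (*ℤ-assoc (proj₁ t) a _)) (trans (cong (_*ℤ φ (proj₂ t)) (*ℤ-comm (proj₁ t) a)) (*ℤ-assoc a _ _)))) (∑-*ˡ a p)
  eval-*ʳ : ∀ a φ p → eval (λ e → φ e *ℤ a) p ≡ eval φ p *ℤ a
  eval-*ʳ a φ p = trans (eval-cong p (λ e → *ℤ-comm (φ e) a)) (trans (eval-*ˡ a φ p) (*ℤ-comm a _))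

-- The operators on coefficient functions

-- Positions are counted from 0 here, so `Π i` belongs to `π̃ (suc i)`. The value 0 on vectors too
-- short for the swap is a default; `eval-πMono` assumes room for both entries.
Π : ℕ → (List ℕ → ℤ) → List ℕ → ℤ
Π zero    f (u ∷ v ∷ m) = f (u + v ∷ 0 ∷ m) +ℤ ⟦ nz u ∧ nz v ⟧ *ℤ (f (u ∷ v ∷ m) +ℤ -ℤ f (0 ∷ u + v ∷ m))
Π (suc i) f (x ∷ m)     = Π i (λ m' → f (x ∷ m')) m
Π _       f _           = 0ℤ

Π-cong : ∀ i {f g} m → (∀ m' → length m' ≡ length m → f m' ≡ g m') → Π i f m ≡ Π i g m
Π-cong zero    []          e = refl
Π-cong zero    (u ∷ [])    e = refl
Π-cong zero    (u ∷ v ∷ m) e =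
  cong₂ _+ℤ_ (e _ refl) (cong (⟦ nz u ∧ nz v ⟧ *ℤ_) (cong₂ (λ x y → x +ℤ -ℤ y) (e _ refl) (e _ refl)))
Π-cong (suc i) []          e = refl
Π-cong (suc i) (x ∷ m)     e = Π-cong i m (λ m' l → e (x ∷ m') (cong suc l))

Π-zero : ∀ i m → Π i (λ _ → 0ℤ) m ≡ 0ℤ
Π-zero zero    []          = refl
Π-zero zero    (u ∷ [])    = refl
Π-zero zero    (u ∷ v ∷ m) = trans (+-idˡ _) (trans (cong (⟦ nz u ∧ nz v ⟧ *ℤ_) (+-inverseʳ 0ℤ)) (*-0ʳ ⟦ nz u ∧ nz v ⟧))
Π-zero (suc i) []          = refl
Π-zero (suc i) (x ∷ m)     = Π-zero i m

Π-+ : ∀ i {f g} m → Π i (λ m' → f m' +ℤ g m') m ≡ Π i f m +ℤ Π i g m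
Π-+ zero    []          = sym (+-idˡ 0ℤ)
Π-+ zero    (u ∷ [])    = sym (+-idˡ 0ℤ)
Π-+ zero {f} {g} (u ∷ v ∷ m) = trans (cong (f₁ +ℤ g₁ +ℤ_) (trans (cong (s *ℤ_)
    (trans (cong (f₂ +ℤ g₂ +ℤ_) (-ℤ-+ f₃ g₃)) (+ℤ-interchange f₂ g₂ _ _))) (*-distribˡ s _ _)))
    (+ℤ-interchange f₁ g₁ _ _)
  where
  s = ⟦ nz u ∧ nz v ⟧
  f₁ = f (u + v ∷ 0 ∷ m)
  g₁ = g (u + v ∷ 0 ∷ m)
  f₂ = f (u ∷ v ∷ m)
  g₂ = g (u ∷ v ∷ m)
  f₃ = f (0 ∷ u + v ∷ m)
  g₃ = g (0 ∷ u + v ∷ m)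
Π-+ (suc i) []          = sym (+-idˡ 0ℤ)
Π-+ (suc i) (x ∷ m)     = Π-+ i m

Π-*ˡ : ∀ i c {f} m → Π i (λ m' → c *ℤ f m') m ≡ c *ℤ Π i f m
Π-*ˡ zero    c []          = sym (*-0ʳ c)
Π-*ˡ zero    c (u ∷ [])    = sym (*-0ʳ c)
Π-*ˡ zero    c {f} (u ∷ v ∷ m) =
  trans (cong (c *ℤ f₁ +ℤ_) (trans (cong (s *ℤ_) (trans (cong (c *ℤ f₂ +ℤ_) (sym (-ℤ-*ʳ c f₃))) (sym (*-distribˡ c f₂ _))))
    (trans (sym (*ℤ-assoc s c _)) (trans (cong (_*ℤ (f₂ +ℤ -ℤ f₃)) (*ℤ-comm s c)) (*ℤ-assoc c s _)))))
    (sym (*-distribˡ c f₁ _))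
  where
  s = ⟦ nz u ∧ nz v ⟧
  f₁ = f (u + v ∷ 0 ∷ m)
  f₂ = f (u ∷ v ∷ m)
  f₃ = f (0 ∷ u + v ∷ m)
Π-*ˡ (suc i) c []          = sym (*-0ʳ c)
Π-*ˡ (suc i) c (x ∷ m)     = Π-*ˡ i c m

eval-Π : ∀ i (g : List ℕ → List ℕ → ℤ) m p → eval (λ e → Π i (λ m' → g m' e) m) p ≡ Π i (λ m' → eval (g m') p) m
eval-Π i g m []            = sym (Π-zero i m)
eval-Π i g m ((c , e) ∷ p) = trans (cong₂ _+ℤ_ (sym (Π-*ˡ i c m)) (eval-Π i g m p)) (sym (Π-+ i m))

-- Divided differences of monomials in terms of `Π`

divDiff-∷ : ∀ i x e → divDiff (2 + i) (x ∷ e) ≡ map (λ t → proj₁ t , x ∷ proj₂ t) (divDiff (suc i) e)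
divDiff-∷ i x e with get e (2 + i) ≤ᵇ get e (suc i)
... | true  = map-∘ (upTo (suc (get e (suc i) ∸ get e (2 + i))))
... | false = map-∘ (upTo (get e (2 + i) ∸ get e (suc i) ∸ 1))

πMono-∷ : ∀ i x e → πMono (2 + i) (x ∷ e) ≡ map (λ t → proj₁ t , x ∷ proj₂ t) (πMono (suc i) e)
πMono-∷ i x e with nz (get e (suc i)) ∧ nz (get e (2 + i))
... | true  = refl
... | false = divDiff-∷ i x e

-- For b = 0 < a the divided difference is h_a(xᵢ, xᵢ₊₁).
eval-divDiff-a0 : ∀ a u v t →
  ∑ (upTo (suc a)) (λ k → 1ℤ *ℤ ⟦ (a ∸ k ≡ᵇ u) ∧ (k ≡ᵇ v) ∧ t ⟧) ≡ ⟦ (a ≡ᵇ u + v) ∧ t ⟧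
eval-divDiff-a0 a u v t = begin
  ∑ (upTo (suc a)) (λ k → 1ℤ *ℤ ⟦ (a ∸ k ≡ᵇ u) ∧ (k ≡ᵇ v) ∧ t ⟧)
    ≡⟨ ∑-cong (upTo (suc a)) (λ k → trans (*-idˡ _) (trans (cong ⟦_⟧ (∧-swap (a ∸ k ≡ᵇ u) (k ≡ᵇ v) t)) (⟦∧⟧ (k ≡ᵇ v) _))) ⟩
  ∑ (upTo (suc a)) (λ k → ⟦ k ≡ᵇ v ⟧ *ℤ ⟦ (a ∸ k ≡ᵇ u) ∧ t ⟧)
    ≡⟨ ∑-upTo-point (suc a) v ⟩
  ⟦ v <ᵇ suc a ⟧ *ℤ ⟦ (a ∸ v ≡ᵇ u) ∧ t ⟧
    ≡⟨ ⟦∧⟧ (v <ᵇ suc a) _ ⟨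
  ⟦ (v <ᵇ suc a) ∧ (a ∸ v ≡ᵇ u) ∧ t ⟧
    ≡⟨ cong ⟦_⟧ (trans (sym (∧-assoc (v <ᵇ suc a) (a ∸ v ≡ᵇ u) t)) (cong (_∧ t) total)) ⟩
  ⟦ (a ≡ᵇ u + v) ∧ t ⟧ ∎
  where
  open ≡-Reasoning
  total : (v <ᵇ suc a) ∧ (a ∸ v ≡ᵇ u) ≡ (a ≡ᵇ u + v)
  total = bool-ext
    (λ e → ≡ᵇ-true (trans (sym (m∸n+n≡m (≤-pred (<ᵇ-sound {v} (proj₁ (∧-elim e)))))) (cong (_+ v) (≡ᵇ-sound {a ∸ v} (proj₂ (∧-elim {v <ᵇ suc a} e))))))
    (λ e → cong₂ _∧_ (<ᵇ-true (s≤s (subst (v ≤_) (sym (≡ᵇ-sound e)) (m≤n+m v u))))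
                     (≡ᵇ-true (trans (cong (_∸ v) (≡ᵇ-sound {a} e)) (m+n∸n≡m u v))))

-- Here the exponents are 0 and b + 1. Since (x y^(b+1) - y x^(b+1)) / (x - y) = - x y h_(b-1)(x,
-- y), the two monomials with a zero exponent are missing, hence the factor `nz u ∧ nz v`.
eval-divDiff-0b : ∀ b u v t →
  ∑ (upTo b) (λ k → -1ℤ *ℤ ⟦ (b ∸ k ≡ᵇ u) ∧ (suc k ≡ᵇ v) ∧ t ⟧) ≡ -ℤ (⟦ nz u ∧ nz v ⟧ *ℤ ⟦ (suc b ≡ᵇ u + v) ∧ t ⟧)
eval-divDiff-0b b u v t = trans (∑-cong (upTo b) (λ k → trans (cong (_*ℤ ⟦ (b ∸ k ≡ᵇ u) ∧ (suc k ≡ᵇ v) ∧ t ⟧) (-ℤ-def 1ℤ)) (-ℤ-*ˡ 1ℤ _)))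
    (trans (trans (∑-cong (upTo b) (λ k → trans (cong -ℤ_ (*-idˡ _)) (minus-one _))) (∑-*ˡ (-ℤ 1ℤ) (upTo b)))
    (trans (sym (minus-one _)) (cong -ℤ_ (positive v))))
  where
  minus-one : ∀ x → -ℤ x ≡ -ℤ 1ℤ *ℤ x
  minus-one x = sym (trans (-ℤ-*ˡ 1ℤ x) (cong -ℤ_ (*-idˡ x)))
  total : ∀ v u → (v <ᵇ b) ∧ (b ∸ v ≡ᵇ u) ≡ (nz u ∧ true) ∧ (suc b ≡ᵇ u + suc v)
  total v zero = bool-ext
    (λ e → ⊥-elim (<⇒≱ (<ᵇ-sound {v} (proj₁ (∧-elim e))) (m∸n≡0⇒m≤n (≡ᵇ-sound {b ∸ v} (proj₂ (∧-elim {v <ᵇ b} e))))))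
    (λ ())
  total v (suc u) = bool-ext
    (λ e → ≡ᵇ-true (trans (sym (m∸n+n≡m (<⇒≤ (<ᵇ-sound {v} (proj₁ (∧-elim e))))))
             (trans (cong (_+ v) (≡ᵇ-sound {b ∸ v} (proj₂ (∧-elim {v <ᵇ b} e)))) (sym (+-suc u v)))))
    (λ e → let b≡ = trans (≡ᵇ-sound {b} e) (+-suc u v) in
           cong₂ _∧_ (<ᵇ-true (subst (v <_) (sym b≡) (s≤s (m≤n+m v u))))
                     (≡ᵇ-true (trans (cong (_∸ v) b≡) (m+n∸n≡m (suc u) v))))
  open ≡-Reasoning
  positive : ∀ v → ∑ (upTo b) (λ k → ⟦ (b ∸ k ≡ᵇ u) ∧ (suc k ≡ᵇ v) ∧ t ⟧) ≡ ⟦ nz u ∧ nz v ⟧ *ℤ ⟦ (suc b ≡ᵇ u + v) ∧ t ⟧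
  positive zero = trans (∑-vanish (upTo b) (λ k → cong ⟦_⟧ (∧-zeroʳ (b ∸ k ≡ᵇ u))))
    (sym (trans (cong (λ x → ⟦ x ⟧ *ℤ ⟦ (suc b ≡ᵇ u + 0) ∧ t ⟧) (∧-zeroʳ (nz u))) (*-0ˡ _)))
  positive (suc v) = begin
    ∑ (upTo b) (λ k → ⟦ (b ∸ k ≡ᵇ u) ∧ (k ≡ᵇ v) ∧ t ⟧)
      ≡⟨ ∑-cong (upTo b) (λ k → trans (cong ⟦_⟧ (∧-swap (b ∸ k ≡ᵇ u) (k ≡ᵇ v) t)) (⟦∧⟧ (k ≡ᵇ v) _)) ⟩
    ∑ (upTo b) (λ k → ⟦ k ≡ᵇ v ⟧ *ℤ ⟦ (b ∸ k ≡ᵇ u) ∧ t ⟧)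
      ≡⟨ ∑-upTo-point b v ⟩
    ⟦ v <ᵇ b ⟧ *ℤ ⟦ (b ∸ v ≡ᵇ u) ∧ t ⟧
      ≡⟨ ⟦∧⟧ (v <ᵇ b) _ ⟨
    ⟦ (v <ᵇ b) ∧ (b ∸ v ≡ᵇ u) ∧ t ⟧
      ≡⟨ cong ⟦_⟧ (trans (sym (∧-assoc (v <ᵇ b) (b ∸ v ≡ᵇ u) t)) (trans (cong (_∧ t) (total v u)) (∧-assoc (nz u ∧ true) _ t))) ⟩
    ⟦ (nz u ∧ true) ∧ (suc b ≡ᵇ u + suc v) ∧ t ⟧
      ≡⟨ ⟦∧⟧ (nz u ∧ true) _ ⟩
    ⟦ nz u ∧ true ⟧ *ℤ ⟦ (suc b ≡ᵇ u + suc v) ∧ t ⟧ ∎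

-- The pair (a, b) selects one term of `Π`: both positive the fixed one, b = 0 the first one, a = 0
-- < b the negative one. The other terms vanish, if need be thanks to the factor `nz u ∧ nz v`.
eval-πMono-head : ∀ a b e u v m →
  eval (δ (u ∷ v ∷ m)) (πMono 1 (a ∷ b ∷ e)) ≡ Π 0 (λ m' → δ m' (a ∷ b ∷ e)) (u ∷ v ∷ m)
eval-πMono-head (suc a) (suc b) e u v m =
  trans (+-idʳ _) (trans (*-idˡ _) (trans (sym (+-idˡ _)) (cong₂ _+ℤ_ (sym (cong ⟦_⟧ (∧-zeroʳ (suc a ≡ᵇ u + v)))) (tail u v))))
  where
  tail : ∀ u v → ⟦ (suc a ≡ᵇ u) ∧ (suc b ≡ᵇ v) ∧ eqL e m ⟧ ≡
    ⟦ nz u ∧ nz v ⟧ *ℤ (⟦ (suc a ≡ᵇ u) ∧ (suc b ≡ᵇ v) ∧ eqL e m ⟧ +ℤ -ℤ 0ℤ)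
  tail zero    v       = sym (*-0ˡ _)
  tail (suc u) zero    = trans (cong ⟦_⟧ (∧-zeroʳ (a ≡ᵇ u))) (sym (*-0ˡ _))
  tail (suc u) (suc v) = sym (trans (*-idˡ _) (trans (cong (⟦ (a ≡ᵇ u) ∧ (b ≡ᵇ v) ∧ eqL e m ⟧ +ℤ_) -ℤ-0) (+-idʳ _)))
eval-πMono-head zero (suc b) e u v m = begin
  ∑ (map _ (upTo b)) _
    ≡⟨ ∑-map _ (upTo b) ⟩
  _
    ≡⟨ eval-divDiff-0b b u v (eqL e m) ⟩
  -ℤ (⟦ nz u ∧ nz v ⟧ *ℤ ⟦ (suc b ≡ᵇ u + v) ∧ eqL e m ⟧)
    ≡⟨ rearrange u v ⟩
  _ ∎
  where
  open ≡-Reasoning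
  rearrange : ∀ u v → -ℤ (⟦ nz u ∧ nz v ⟧ *ℤ ⟦ (suc b ≡ᵇ u + v) ∧ eqL e m ⟧) ≡
    ⟦ (0 ≡ᵇ u + v) ∧ false ⟧ +ℤ ⟦ nz u ∧ nz v ⟧ *ℤ (⟦ (0 ≡ᵇ u) ∧ (suc b ≡ᵇ v) ∧ eqL e m ⟧ +ℤ -ℤ ⟦ (suc b ≡ᵇ u + v) ∧ eqL e m ⟧)
  rearrange zero v = trans (cong -ℤ_ (*-0ˡ _)) (trans -ℤ-0
    (sym (trans (cong₂ _+ℤ_ (cong ⟦_⟧ (∧-zeroʳ (0 ≡ᵇ v))) (*-0ˡ _)) (+-idˡ 0ℤ))))
  rearrange (suc u) v = sym (trans (+-idˡ _) (trans (cong (⟦ nz v ⟧ *ℤ_) (+-idˡ _)) (-ℤ-*ʳ ⟦ nz v ⟧ _)))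
eval-πMono-head zero zero e u v m = trans (eval-divDiff-a0 0 u v (eqL e m)) (sym (trans (cong (⟦ (0 ≡ᵇ u + v) ∧ eqL e m ⟧ +ℤ_) (tail u v)) (+-idʳ _)))
  where
  tail : ∀ u v → ⟦ nz u ∧ nz v ⟧ *ℤ (⟦ (0 ≡ᵇ u) ∧ (0 ≡ᵇ v) ∧ eqL e m ⟧ +ℤ -ℤ ⟦ (0 ≡ᵇ u + v) ∧ eqL e m ⟧) ≡ 0ℤ
  tail zero    v       = *-0ˡ _
  tail (suc u) zero    = *-0ˡ _
  tail (suc u) (suc v) = trans (*-idˡ _) (+-inverseʳ 0ℤ)
eval-πMono-head (suc a) zero e u v m = trans (trans (∑-map _ (upTo (2 + a))) (eval-divDiff-a0 (suc a) u v (eqL e m))) (sym (trans (cong (⟦ (suc a ≡ᵇ u + v) ∧ eqL e m ⟧ +ℤ_) (tail u v)) (+-idʳ _)))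
  where
  tail : ∀ u v → ⟦ nz u ∧ nz v ⟧ *ℤ (⟦ (suc a ≡ᵇ u) ∧ (0 ≡ᵇ v) ∧ eqL e m ⟧ +ℤ -ℤ 0ℤ) ≡ 0ℤ
  tail zero    v       = *-0ˡ _
  tail (suc u) zero    = *-0ˡ _
  tail (suc u) (suc v) = trans (*-idˡ _) (trans (cong₂ _+ℤ_ (cong ⟦_⟧ (∧-zeroʳ (a ≡ᵇ u))) -ℤ-0) (+-idˡ 0ℤ))

eval-πMono : ∀ i e m → length e ≡ length m → 2 + i ≤ length m → eval (δ m) (πMono (suc i) e) ≡ Π i (λ m' → δ m' e) m
eval-πMono zero    (a ∷ b ∷ e) (u ∷ v ∷ m) l le = eval-πMono-head a b e u v m
eval-πMono zero    e           (u ∷ []) l (s≤s ())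
eval-πMono (suc i) (a ∷ e)     (u ∷ m)     l (s≤s le) = begin
  eval (δ (u ∷ m)) (πMono (2 + i) (a ∷ e))
    ≡⟨ cong (eval (δ (u ∷ m))) (πMono-∷ i a e) ⟩
  eval (δ (u ∷ m)) (map (λ t → proj₁ t , a ∷ proj₂ t) (πMono (suc i) e))
    ≡⟨ ∑-map _ (πMono (suc i) e) ⟩
  ∑ (πMono (suc i) e) (λ t → proj₁ t *ℤ ⟦ (a ≡ᵇ u) ∧ eqL (proj₂ t) m ⟧)
    ≡⟨ ∑-cong (πMono (suc i) e) (λ t → trans (cong (proj₁ t *ℤ_) (⟦∧⟧ (a ≡ᵇ u) _))
         (trans (sym (*ℤ-assoc (proj₁ t) _ _)) (trans (cong (_*ℤ δ m (proj₂ t)) (*ℤ-comm (proj₁ t) _)) (*ℤ-assoc ⟦ a ≡ᵇ u ⟧ _ _)))) ⟩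
  ∑ (πMono (suc i) e) (λ t → ⟦ a ≡ᵇ u ⟧ *ℤ (proj₁ t *ℤ δ m (proj₂ t)))
    ≡⟨ ∑-*ˡ ⟦ a ≡ᵇ u ⟧ (πMono (suc i) e) ⟩
  ⟦ a ≡ᵇ u ⟧ *ℤ eval (δ m) (πMono (suc i) e)
    ≡⟨ cong (⟦ a ≡ᵇ u ⟧ *ℤ_) (eval-πMono i e m (suc-injective l) le) ⟩
  ⟦ a ≡ᵇ u ⟧ *ℤ Π i (λ m' → δ m' e) m
    ≡⟨ Π-*ˡ i ⟦ a ≡ᵇ u ⟧ m ⟨
  Π i (λ m' → ⟦ a ≡ᵇ u ⟧ *ℤ δ m' e) m
    ≡⟨ Π-cong i m (λ m' _ → sym (⟦∧⟧ (a ≡ᵇ u) _)) ⟩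
  Π i (λ m' → δ (u ∷ m') (a ∷ e)) m ∎
  where open ≡-Reasoning

coeff-π̃ : ∀ {n} i p m → Homogeneous n p → length m ≡ n → 2 + i ≤ n → coeff (π̃ (suc i) p) m ≡ Π i (coeff p) m
coeff-π̃ i p m hp refl le = begin
  coeff (π̃ (suc i) p) m                          ≡⟨ coeff-eval (π̃ (suc i) p) m ⟩
  eval (δ m) (π̃ (suc i) p)                       ≡⟨ eval-linExt (δ m) (πMono (suc i)) p ⟩
  eval (λ e → eval (δ m) (πMono (suc i) e)) p    ≡⟨ eval-cong-Homogeneous hp (λ e l → eval-πMono i e m l le) ⟩
  eval (λ e → Π i (λ m' → δ m' e) m) p           ≡⟨ eval-Π i δ m p ⟩
  Π i (λ m' → eval (δ m') p) m                   ≡⟨ Π-cong i m (λ m' _ → sym (coeff-eval p m')) ⟩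
  Π i (coeff p) m                                ∎
  where open ≡-Reasoning

coeff-++ : ∀ p q m → coeff (p ++ q) m ≡ coeff p m +ℤ coeff q m
coeff-++ p q m = trans (coeff-eval (p ++ q) m)
  (trans (eval-++ (δ m) p q) (sym (cong₂ _+ℤ_ (coeff-eval p m) (coeff-eval q m))))

coeff-θ̃ : ∀ {n} i p m → Homogeneous n p → length m ≡ n → 2 + i ≤ n → coeff (θ̃ (suc i) p) m ≡ Π i (coeff p) m +ℤ -ℤ coeff p m
coeff-θ̃ i p m hp lm le = trans (coeff-++ (π̃ (suc i) p) (negP p) m)
  (cong₂ _+ℤ_ (coeff-π̃ i p m hp lm le)
    (trans (coeff-eval (negP p) m) (trans (eval-negP (δ m) p) (cong -ℤ_ (sym (coeff-eval p m))))))

-- The operators preserve the number of variables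

length-setAt : ∀ xs i v → length (setAt xs i v) ≡ length xs
length-setAt []       i             v = refl
length-setAt (x ∷ xs) zero          v = refl
length-setAt (x ∷ xs) (suc zero)    v = refl
length-setAt (x ∷ xs) (suc (suc i)) v = cong suc (length-setAt xs (suc i) v)

Homogeneous-πMono : ∀ i e → Homogeneous (length e) (πMono i e)
Homogeneous-πMono i e with nz (get e i) ∧ nz (get e (suc i))
... | true  = refl ∷ []
... | false with get e (suc i) ≤ᵇ get e i
...   | true  = All.map⁺ (All.universal (λ k → trans (length-setAt (setAt e i _) (suc i) _) (length-setAt e i _)) _)
...   | false = All.map⁺ (All.universal (λ k → trans (length-setAt (setAt e i _) (suc i) _) (length-setAt e i _)) _)

Homogeneous-scale : ∀ {n} c p → Homogeneous n p → Homogeneous n (scale c p)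
Homogeneous-scale c p hp = All.map⁺ (All.map id hp)

Homogeneous-π̃ : ∀ {n} i p → Homogeneous n p → Homogeneous n (π̃ i p)
Homogeneous-π̃ i []            []        = []
Homogeneous-π̃ i ((c , e) ∷ p) (l ∷ hp)  =
  All.++⁺ (Homogeneous-scale c (πMono i e) (subst (λ n → Homogeneous n (πMono i e)) l (Homogeneous-πMono i e)))
          (Homogeneous-π̃ i p hp)

Homogeneous-θ̃ : ∀ {n} i p → Homogeneous n p → Homogeneous n (θ̃ i p)
Homogeneous-θ̃ i p hp = All.++⁺ (Homogeneous-π̃ i p hp) (Homogeneous-scale (-1ℤ) p hp)

-- Monomials of slides and atoms

first : List ℕ → ℕ
first []          = 0
first (zero  ∷ α) = first α
first (suc a ∷ α) = suc a

-- The first nonzero part loses c letters to an earlier position. If it loses all of them its entry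
-- becomes 0, and that position is then free to take letters of the next part.
dec : ℕ → List ℕ → List ℕ
dec c []          = []
dec c (zero  ∷ α) = 0 ∷ dec c α
dec c (suc a ∷ α) = suc a ∸ c ∷ α

-- slideB α m and atomB β m decide whether x^m occurs in slide α, atom β; a
-- position in front of the first nonzero part may take some letters from it
-- (all of them only for slides).

slideB : List ℕ → List ℕ → Bool
slideB []          []      = true
slideB []          (_ ∷ _) = false
slideB (_ ∷ _)     []      = false
slideB (zero  ∷ α) (c ∷ m) = (c ≤ᵇ first α) ∧ slideB (dec c α) m
slideB (suc a ∷ α) (c ∷ m) = (c ≡ᵇ suc a) ∧ slideB α m

atomB : List ℕ → List ℕ → Bool
atomB []          []      = true
atomB []          (_ ∷ _) = false
atomB (_ ∷ _)     []      = false
atomB (zero  ∷ β) (c ∷ m) = (c ≤ᵇ first β ∸ 1) ∧ atomB (dec c β) m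
atomB (suc b ∷ β) (c ∷ m) = (c ≡ᵇ suc b) ∧ atomB β m

dec-0 : ∀ α → dec 0 α ≡ α
dec-0 []          = refl
dec-0 (zero  ∷ α) = cong (0 ∷_) (dec-0 α)
dec-0 (suc a ∷ α) = refl

length-dec : ∀ c α → length (dec c α) ≡ length α
length-dec c []          = refl
length-dec c (zero  ∷ α) = cong suc (length-dec c α)
length-dec c (suc a ∷ α) = refl

first-move : ∀ pre f β → first (pre ++ f ∷ 0 ∷ β) ≡ first (pre ++ 0 ∷ f ∷ β)
first-move []            zero    β = refl
first-move []            (suc f) β = refl
first-move (zero  ∷ pre) f       β = first-move pre f β
first-move (suc a ∷ pre) f       β = refl

-- Taking c letters from the first part commutes with moving f one step to the right, whichever of
-- the prefix, f and the tail the letters come from. The prefix keeps its length, so the same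
-- operator index applies afterwards.
record DecMove (c : ℕ) (pre : List ℕ) (f : ℕ) (β : List ℕ) : Set where
  constructor decMove
  field
    pre' : List ℕ
    f'   : ℕ
    β'   : List ℕ
    len  : length pre' ≡ length pre
    from : dec c (pre ++ f ∷ 0 ∷ β) ≡ pre' ++ f' ∷ 0 ∷ β'
    to   : dec c (pre ++ 0 ∷ f ∷ β) ≡ pre' ++ 0 ∷ f' ∷ β'
    pos  : 1 ≤ f → c < first (pre ++ f ∷ 0 ∷ β) → 1 ≤ f'

dec-move : ∀ c pre f β → DecMove c pre f β
dec-move c []            zero    β = decMove [] 0 (dec c β) refl refl refl (λ ())
dec-move c []            (suc f) β = decMove [] (suc f ∸ c) β refl refl refl (λ _ lt → m<n⇒0<n∸m lt)
dec-move c (suc a ∷ pre) f       β = decMove (suc a ∸ c ∷ pre) f β refl refl refl (λ p _ → p)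
dec-move c (zero  ∷ pre) f       β = decMove (0 ∷ pre') f' β' (cong suc len) (cong (0 ∷_) from) (cong (0 ∷_) to) pos
  where open DecMove (dec-move c pre f β)

slideB-dec-[] : ∀ c x α → slideB (dec c (x ∷ α)) [] ≡ false
slideB-dec-[] c zero    α = refl
slideB-dec-[] c (suc x) α = refl

-- The case f = 0 is included because positions further left may already have used up the part that
-- is being moved.
Π-slide-head : ∀ f β u v m →
  Π 0 (λ m' → ⟦ slideB (f ∷ 0 ∷ β) m' ⟧) (u ∷ v ∷ m) ≡ ⟦ slideB (0 ∷ f ∷ β) (u ∷ v ∷ m) ⟧
Π-slide-head zero β u zero m = begin
  P (u + 0) 0 +ℤ ⟦ nz u ∧ false ⟧ *ℤ (P u 0 +ℤ -ℤ P 0 (u + 0))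
    ≡⟨ cong₂ _+ℤ_ (cong (λ w → P w 0) (+-identityʳ u)) (trans (cong (λ b → ⟦ b ⟧ *ℤ (P u 0 +ℤ -ℤ P 0 (u + 0))) (∧-zeroʳ (nz u))) (*-0ˡ _)) ⟩
  P u 0 +ℤ 0ℤ
    ≡⟨ +-idʳ _ ⟩
  P u 0 ∎
  where
  open ≡-Reasoning
  P : ℕ → ℕ → ℤ
  P u v = ⟦ slideB (0 ∷ 0 ∷ β) (u ∷ v ∷ m) ⟧
Π-slide-head zero β u (suc v) m = trans (cong (_+ℤ ⟦ nz u ∧ true ⟧ *ℤ (P u (suc v) +ℤ -ℤ P 0 (u + suc v))) (sides (u + suc v))) (rest u)
  where
  P : ℕ → ℕ → ℤ
  P u v = ⟦ slideB (0 ∷ 0 ∷ β) (u ∷ v ∷ m) ⟧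
  -- Two empty positions are interchangeable when one of them takes nothing. A function with this
  -- symmetry is fixed by `Π`, as its two extreme terms cancel.
  sides : ∀ s → P s 0 ≡ P 0 s
  sides s = cong ⟦_⟧ (cong₂ _∧_ (cong (λ γ → s ≤ᵇ first γ) (sym (dec-0 β)))
    (cong (λ γ → slideB γ m) (trans (dec-0 (dec s β)) (cong (dec s) (sym (dec-0 β))))))
  rest : ∀ u → P 0 (u + suc v) +ℤ ⟦ nz u ∧ true ⟧ *ℤ (P u (suc v) +ℤ -ℤ P 0 (u + suc v)) ≡ P u (suc v)
  rest zero    = trans (cong (P 0 (suc v) +ℤ_) (*-0ˡ _)) (+-idʳ _)
  rest (suc u) = trans (cong (P 0 (suc u + suc v) +ℤ_) (trans (*-idˡ _) (+ℤ-comm (P (suc u) (suc v)) _)))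
    (trans (sym (+ℤ-assoc (P 0 (suc u + suc v)) _ _)) (trans (cong (_+ℤ P (suc u) (suc v)) (+-inverseʳ _)) (+-idˡ _)))
-- The term at (0, u + v) vanishes, since a nonzero part in the first position must put all its
-- letters there. For u below the part only the term at (u + v, 0) can survive; for u equal to it,
-- that term covers v = 0 and the middle one v > 0.
Π-slide-head (suc f) β u v m =
  trans (cong (⟦ (u + v ≡ᵇ suc f) ∧ slideB (dec 0 β) m ⟧ +ℤ_) (cong (⟦ nz u ∧ nz v ⟧ *ℤ_) (trans (cong (R +ℤ_) -ℤ-0) (+-idʳ R))))
  (go (<-cmp u (suc f)))
  where
  R : ℤ
  R = ⟦ (u ≡ᵇ suc f) ∧ (v ≤ᵇ first β) ∧ slideB (dec v β) m ⟧
  go : Tri (u < suc f) (u ≡ suc f) (suc f < u) →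
    ⟦ (u + v ≡ᵇ suc f) ∧ slideB (dec 0 β) m ⟧ +ℤ ⟦ nz u ∧ nz v ⟧ *ℤ R ≡ ⟦ (u ≤ᵇ suc f) ∧ slideB (suc f ∸ u ∷ β) (v ∷ m) ⟧
  go (tri< lt ne _) rewrite ≡ᵇ-false ne | ≤ᵇ-true (<⇒≤ lt) | dec-0 β with suc f ∸ u in eq
  ... | zero  = ⊥-elim (<⇒≱ lt (m∸n≡0⇒m≤n eq))
  ... | suc w = trans (cong₂ _+ℤ_ (cong (λ b → ⟦ b ∧ slideB β m ⟧) (bool-ext
        (λ e → ≡ᵇ-true (trans (sym (m+n∸m≡n u v)) (trans (cong (_∸ u) (≡ᵇ-sound {u + v} e)) eq)))
        (λ e → ≡ᵇ-true (trans (cong (u +_) (trans (≡ᵇ-sound e) (sym eq))) (m+[n∸m]≡n (<⇒≤ lt))))))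
      (*-0ʳ ⟦ nz u ∧ nz v ⟧)) (+-idʳ _)
  go (tri≈ _ refl _) rewrite n∸n≡0 f | ≡ᵇ-refl f | <ᵇ-true (n<1+n f) = equal v
    where
    equal : ∀ v → ⟦ (f + v ≡ᵇ f) ∧ slideB (dec 0 β) m ⟧ +ℤ ⟦ nz v ⟧ *ℤ ⟦ (v ≤ᵇ first β) ∧ slideB (dec v β) m ⟧ ≡
      ⟦ (v ≤ᵇ first β) ∧ slideB (dec v β) m ⟧
    equal zero    rewrite +-identityʳ f | ≡ᵇ-refl f = trans (cong (⟦ slideB (dec 0 β) m ⟧ +ℤ_) (*-0ˡ _)) (+-idʳ _)
    equal (suc v) rewrite ≡ᵇ-false {f + suc v} {f} (λ e → m+1+n≢m f e) = trans (+-idˡ _) (*-idˡ _)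
  go (tri> _ ne gt) rewrite ≡ᵇ-false ne | ≤ᵇ-false gt
    | ≡ᵇ-false {u + v} {suc f} (λ e → <⇒≱ gt (subst (u ≤_) e (m≤m+n u v))) = trans (+-idˡ _) (*-0ʳ ⟦ nz u ∧ nz v ⟧)

Π-slide : ∀ pre f β m →
  Π (length pre) (λ m' → ⟦ slideB (pre ++ f ∷ 0 ∷ β) m' ⟧) m ≡ ⟦ slideB (pre ++ 0 ∷ f ∷ β) m ⟧
Π-slide []            f β []          = refl
Π-slide []            f β (u ∷ [])    = sym (cong ⟦_⟧ (trans (cong ((u ≤ᵇ first (f ∷ β)) ∧_) (slideB-dec-[] u f β)) (∧-zeroʳ (u ≤ᵇ first (f ∷ β)))))
Π-slide []            f β (u ∷ v ∷ m) = Π-slide-head f β u v m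
Π-slide (x ∷ pre)     f β []          = refl
Π-slide (suc a ∷ pre) f β (c ∷ m) = begin
  Π (length pre) (λ m' → ⟦ (c ≡ᵇ suc a) ∧ slideB (pre ++ f ∷ 0 ∷ β) m' ⟧) m
    ≡⟨ Π-cong (length pre) m (λ m' _ → ⟦∧⟧ (c ≡ᵇ suc a) _) ⟩
  Π (length pre) (λ m' → ⟦ c ≡ᵇ suc a ⟧ *ℤ ⟦ slideB (pre ++ f ∷ 0 ∷ β) m' ⟧) m
    ≡⟨ Π-*ˡ (length pre) ⟦ c ≡ᵇ suc a ⟧ m ⟩
  ⟦ c ≡ᵇ suc a ⟧ *ℤ Π (length pre) (λ m' → ⟦ slideB (pre ++ f ∷ 0 ∷ β) m' ⟧) m
    ≡⟨ cong (⟦ c ≡ᵇ suc a ⟧ *ℤ_) (Π-slide pre f β m) ⟩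
  ⟦ c ≡ᵇ suc a ⟧ *ℤ ⟦ slideB (pre ++ 0 ∷ f ∷ β) m ⟧
    ≡⟨ ⟦∧⟧ (c ≡ᵇ suc a) _ ⟨
  ⟦ (c ≡ᵇ suc a) ∧ slideB (pre ++ 0 ∷ f ∷ β) m ⟧ ∎
  where open ≡-Reasoning
Π-slide (zero ∷ pre) f β (c ∷ m) = begin
  Π (length pre) (λ m' → ⟦ t ∧ slideB (dec c (pre ++ f ∷ 0 ∷ β)) m' ⟧) m
    ≡⟨ Π-cong (length pre) m (λ m' _ → ⟦∧⟧ t _) ⟩
  Π (length pre) (λ m' → ⟦ t ⟧ *ℤ ⟦ slideB (dec c (pre ++ f ∷ 0 ∷ β)) m' ⟧) m
    ≡⟨ Π-*ˡ (length pre) ⟦ t ⟧ m ⟩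
  ⟦ t ⟧ *ℤ Π (length pre) (λ m' → ⟦ slideB (dec c (pre ++ f ∷ 0 ∷ β)) m' ⟧) m
    ≡⟨ cong₂ (λ l γ → ⟦ t ⟧ *ℤ Π l (λ m' → ⟦ slideB γ m' ⟧) m) (sym len) from ⟩
  ⟦ t ⟧ *ℤ Π (length pre') (λ m' → ⟦ slideB (pre' ++ f' ∷ 0 ∷ β') m' ⟧) m
    ≡⟨ cong (⟦ t ⟧ *ℤ_) (Π-slide pre' f' β' m) ⟩
  ⟦ t ⟧ *ℤ ⟦ slideB (pre' ++ 0 ∷ f' ∷ β') m ⟧
    ≡⟨ cong₂ (λ w γ → ⟦ c ≤ᵇ w ⟧ *ℤ ⟦ slideB γ m ⟧) (first-move pre f β) (sym to) ⟩
  ⟦ c ≤ᵇ first (pre ++ 0 ∷ f ∷ β) ⟧ *ℤ ⟦ slideB (dec c (pre ++ 0 ∷ f ∷ β)) m ⟧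
    ≡⟨ ⟦∧⟧ (c ≤ᵇ first (pre ++ 0 ∷ f ∷ β)) _ ⟨
  ⟦ (c ≤ᵇ first (pre ++ 0 ∷ f ∷ β)) ∧ slideB (dec c (pre ++ 0 ∷ f ∷ β)) m ⟧ ∎
  where
  open ≡-Reasoning
  open DecMove (dec-move c pre f β)
  t = c ≤ᵇ first (pre ++ f ∷ 0 ∷ β)

-- The operators of atoms on coefficient functions

Θ : ℕ → (List ℕ → ℤ) → List ℕ → ℤ
Θ i f m = Π i f m +ℤ -ℤ f m

Θ-*ˡ : ∀ i c {f} m → Θ i (λ m' → c *ℤ f m') m ≡ c *ℤ Θ i f m
Θ-*ˡ i c {f} m = trans (cong₂ _+ℤ_ (Π-*ˡ i c m) (sym (-ℤ-*ʳ c (f m)))) (sym (*-distribˡ c _ _))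

Θ-cong : ∀ i {f g} m → (∀ m' → length m' ≡ length m → f m' ≡ g m') → Θ i f m ≡ Θ i g m
Θ-cong i m e = cong₂ _+ℤ_ (Π-cong i m e) (cong -ℤ_ (e m refl))

0-0 : 0ℤ +ℤ -ℤ 0ℤ ≡ 0ℤ
0-0 = +-inverseʳ 0ℤ

-- For u, v > 0 the middle term of `Π` cancels against the subtracted function B, leaving A. For v =
-- 0 it is A that cancels against B, which removes the monomials in which the last letter of the
-- part has left its position. For u = 0 < v the function B vanishes.
Θ-atom-head : ∀ f β u v m →
  Θ 0 (λ m' → ⟦ atomB (suc f ∷ 0 ∷ β) m' ⟧) (u ∷ v ∷ m) ≡ ⟦ atomB (0 ∷ suc f ∷ β) (u ∷ v ∷ m) ⟧
Θ-atom-head f β u v m = trans (cong (λ z → A +ℤ ⟦ nz u ∧ nz v ⟧ *ℤ z +ℤ -ℤ B) (trans (cong (B +ℤ_) -ℤ-0) (+-idʳ B))) (go u v)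
  where
  A = ⟦ (u + v ≡ᵇ suc f) ∧ atomB (dec 0 β) m ⟧
  B = ⟦ (u ≡ᵇ suc f) ∧ (v ≤ᵇ first β ∸ 1) ∧ atomB (dec v β) m ⟧
  reassociate : ∀ a b → a +ℤ b +ℤ -ℤ b ≡ a
  reassociate a b = trans (+ℤ-assoc a b _) (trans (cong (a +ℤ_) (+-inverseʳ b)) (+-idʳ a))
  inner : ∀ u v → (u + suc v ≡ᵇ suc f) ∧ atomB (dec 0 β) m ≡ (u ≤ᵇ f) ∧ atomB (suc f ∸ u ∷ β) (suc v ∷ m)
  inner u v with u ≤? f
  ... | no  gt rewrite ≤ᵇ-false (≰⇒> gt)
      | ≡ᵇ-false {u + suc v} {suc f} (λ e → gt (≤-pred (subst (suc u ≤_) e (subst (suc u ≤_) (sym (+-suc u v)) (s≤s (m≤m+n u v)))))) = refl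
  ... | yes le rewrite ≤ᵇ-true le | +-∸-assoc 1 le | dec-0 β = cong (_∧ atomB β m) (bool-ext
      (λ e → ≡ᵇ-true (trans (sym (m+n∸m≡n u v)) (cong (_∸ u) (suc-injective (trans (sym (+-suc u v)) (≡ᵇ-sound {u + suc v} e))))))
      (λ e → ≡ᵇ-true (trans (+-suc u v) (cong suc (trans (cong (u +_) (≡ᵇ-sound {v} e)) (m+[n∸m]≡n le))))))
  go : ∀ u v → ⟦ (u + v ≡ᵇ suc f) ∧ atomB (dec 0 β) m ⟧ +ℤ
      ⟦ nz u ∧ nz v ⟧ *ℤ ⟦ (u ≡ᵇ suc f) ∧ (v ≤ᵇ first β ∸ 1) ∧ atomB (dec v β) m ⟧ +ℤ
      -ℤ ⟦ (u ≡ᵇ suc f) ∧ (v ≤ᵇ first β ∸ 1) ∧ atomB (dec v β) m ⟧ ≡ ⟦ (u ≤ᵇ f) ∧ atomB (suc f ∸ u ∷ β) (v ∷ m) ⟧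
  go u zero rewrite +-identityʳ u | ∧-zeroʳ (nz u) =
    trans (cong (λ z → C +ℤ z +ℤ -ℤ C) (*-0ˡ C)) (trans (cong (_+ℤ -ℤ C) (+-idʳ C)) (trans (+-inverseʳ C) (sym rhs)))
    where
    C = ⟦ (u ≡ᵇ suc f) ∧ atomB (dec 0 β) m ⟧
    rhs : ⟦ (u ≤ᵇ f) ∧ atomB (suc f ∸ u ∷ β) (0 ∷ m) ⟧ ≡ 0ℤ
    rhs with u ≤? f
    ... | no  gt rewrite ≤ᵇ-false (≰⇒> gt) = refl
    ... | yes le rewrite +-∸-assoc 1 le = cong ⟦_⟧ (∧-zeroʳ (u ≤ᵇ f))
  go zero    (suc v) = trans (cong₂ (λ a b → ⟦ (v ≡ᵇ f) ∧ atomB (dec 0 β) m ⟧ +ℤ a +ℤ b) (*-0ˡ 0ℤ) -ℤ-0)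
    (trans (+-idʳ _) (trans (+-idʳ _) (cong ⟦_⟧ (inner 0 v))))
  go (suc u) (suc v) = trans (cong (λ z → X +ℤ z +ℤ -ℤ Y) (*-idˡ _)) (trans (reassociate X Y) (cong ⟦_⟧ (inner (suc u) v)))
    where
    X = ⟦ (suc u + suc v ≡ᵇ suc f) ∧ atomB (dec 0 β) m ⟧
    Y = ⟦ (suc u ≡ᵇ suc f) ∧ (suc v ≤ᵇ first β ∸ 1) ∧ atomB (dec (suc v) β) m ⟧

first-positive : ∀ pre f β → 1 ≤ f → 1 ≤ first (pre ++ f ∷ β)
first-positive []            (suc f) β _ = s≤s z≤n
first-positive (zero  ∷ pre) f       β p = first-positive pre f β p
first-positive (suc a ∷ pre) f       β p = s≤s z≤n

-- For f = 0 the left side would be 0, as `Π` fixes the function. Positivity survives the prefix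
-- because an atom leaves at least one letter of each part in place; this is the field `pos`.
Θ-atom : ∀ pre f β m → 1 ≤ f →
  Θ (length pre) (λ m' → ⟦ atomB (pre ++ f ∷ 0 ∷ β) m' ⟧) m ≡ ⟦ atomB (pre ++ 0 ∷ f ∷ β) m ⟧
Θ-atom []            f       β []          _ = 0-0
Θ-atom []            (suc f) β (u ∷ [])    _ = trans (cong (λ b → 0ℤ +ℤ -ℤ ⟦ b ⟧) (∧-zeroʳ (u ≡ᵇ suc f)))
  (trans 0-0 (sym (cong ⟦_⟧ (∧-zeroʳ (u ≤ᵇ f)))))
Θ-atom []            (suc f) β (u ∷ v ∷ m) _ = Θ-atom-head f β u v m
Θ-atom (x ∷ pre)     f       β []          _ = 0-0
Θ-atom (suc a ∷ pre) f       β (c ∷ m)     p = begin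
  Θ (length pre) (λ m' → ⟦ (c ≡ᵇ suc a) ∧ atomB (pre ++ f ∷ 0 ∷ β) m' ⟧) m
    ≡⟨ Θ-cong (length pre) m (λ m' _ → ⟦∧⟧ (c ≡ᵇ suc a) _) ⟩
  Θ (length pre) (λ m' → ⟦ c ≡ᵇ suc a ⟧ *ℤ ⟦ atomB (pre ++ f ∷ 0 ∷ β) m' ⟧) m
    ≡⟨ Θ-*ˡ (length pre) ⟦ c ≡ᵇ suc a ⟧ m ⟩
  ⟦ c ≡ᵇ suc a ⟧ *ℤ Θ (length pre) (λ m' → ⟦ atomB (pre ++ f ∷ 0 ∷ β) m' ⟧) m
    ≡⟨ cong (⟦ c ≡ᵇ suc a ⟧ *ℤ_) (Θ-atom pre f β m p) ⟩
  ⟦ c ≡ᵇ suc a ⟧ *ℤ ⟦ atomB (pre ++ 0 ∷ f ∷ β) m ⟧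
    ≡⟨ ⟦∧⟧ (c ≡ᵇ suc a) _ ⟨
  ⟦ (c ≡ᵇ suc a) ∧ atomB (pre ++ 0 ∷ f ∷ β) m ⟧ ∎
  where open ≡-Reasoning
Θ-atom (zero ∷ pre) f β (c ∷ m) p = begin
  Θ (length pre) (λ m' → ⟦ t ∧ atomB (dec c (pre ++ f ∷ 0 ∷ β)) m' ⟧) m
    ≡⟨ Θ-cong (length pre) m (λ m' _ → ⟦∧⟧ t _) ⟩
  Θ (length pre) (λ m' → ⟦ t ⟧ *ℤ ⟦ atomB (dec c (pre ++ f ∷ 0 ∷ β)) m' ⟧) m
    ≡⟨ Θ-*ˡ (length pre) ⟦ t ⟧ m ⟩
  ⟦ t ⟧ *ℤ Θ (length pre) (λ m' → ⟦ atomB (dec c (pre ++ f ∷ 0 ∷ β)) m' ⟧) m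
    -- The strict bound required by `pos` is only known when the test `t` succeeds; otherwise both
    -- sides carry the factor 0.
    ≡⟨ under t refl ⟩
  ⟦ t ⟧ *ℤ ⟦ atomB (dec c (pre ++ 0 ∷ f ∷ β)) m ⟧
    ≡⟨ cong (λ w → ⟦ c ≤ᵇ w ∸ 1 ⟧ *ℤ ⟦ atomB (dec c (pre ++ 0 ∷ f ∷ β)) m ⟧) (first-move pre f β) ⟩
  ⟦ c ≤ᵇ first (pre ++ 0 ∷ f ∷ β) ∸ 1 ⟧ *ℤ ⟦ atomB (dec c (pre ++ 0 ∷ f ∷ β)) m ⟧
    ≡⟨ ⟦∧⟧ (c ≤ᵇ first (pre ++ 0 ∷ f ∷ β) ∸ 1) _ ⟨
  ⟦ (c ≤ᵇ first (pre ++ 0 ∷ f ∷ β) ∸ 1) ∧ atomB (dec c (pre ++ 0 ∷ f ∷ β)) m ⟧ ∎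
  where
  open ≡-Reasoning
  open DecMove (dec-move c pre f β)
  t = c ≤ᵇ first (pre ++ f ∷ 0 ∷ β) ∸ 1
  ≤pred⇒< : ∀ {a b} → 1 ≤ b → a ≤ b ∸ 1 → a < b
  ≤pred⇒< {b = suc b} _ le = s≤s le
  under : ∀ s → t ≡ s →
    ⟦ s ⟧ *ℤ Θ (length pre) (λ m' → ⟦ atomB (dec c (pre ++ f ∷ 0 ∷ β)) m' ⟧) m ≡ ⟦ s ⟧ *ℤ ⟦ atomB (dec c (pre ++ 0 ∷ f ∷ β)) m ⟧
  under false _ = trans (*-0ˡ _) (sym (*-0ˡ _))
  under true  e = cong (1ℤ *ℤ_) (begin
    Θ (length pre) (λ m' → ⟦ atomB (dec c (pre ++ f ∷ 0 ∷ β)) m' ⟧) m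
      ≡⟨ cong₂ (λ l γ → Θ l (λ m' → ⟦ atomB γ m' ⟧) m) (sym len) from ⟩
    Θ (length pre') (λ m' → ⟦ atomB (pre' ++ f' ∷ 0 ∷ β') m' ⟧) m
      ≡⟨ Θ-atom pre' f' β' m (pos p (≤pred⇒< (first-positive pre f (0 ∷ β) p) (≤ᵇ-sound e))) ⟩
    ⟦ atomB (pre' ++ 0 ∷ f' ∷ β') m ⟧
      ≡⟨ cong (λ γ → ⟦ atomB γ m ⟧) (sym to) ⟩
    ⟦ atomB (dec c (pre ++ 0 ∷ f ∷ β)) m ⟧ ∎)

-- From one operator to the words of w_α⁻¹

record Expands (S : List ℕ → List ℕ → Bool) (α : List ℕ) (p : Poly) : Set where
  constructor expands
  field
    homogeneous : Homogeneous (length α) p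
    coefficient : ∀ m → length m ≡ length α → coeff p m ≡ ⟦ S α m ⟧

Moves : (ℕ → Poly → Poly) → (List ℕ → List ℕ → Bool) → Set
Moves op S = ∀ pre f β p → Expands S (pre ++ suc f ∷ 0 ∷ β) p → Expands S (pre ++ 0 ∷ suc f ∷ β) (op (suc (length pre)) p)

length-move : ∀ (pre : List ℕ) a b c d β → length (pre ++ a ∷ b ∷ β) ≡ length (pre ++ c ∷ d ∷ β)
length-move pre a b c d β = trans (length-++ pre) (sym (length-++ pre))

length-move-≥ : ∀ (pre : List ℕ) a b β → 2 + length pre ≤ length (pre ++ a ∷ b ∷ β)
length-move-≥ pre a b β = subst (2 + length pre ≤_) (sym (length-++ pre))
  (subst (_≤ length pre + (2 + length β)) (+-comm (length pre) 2) (+-monoʳ-≤ (length pre) (s≤s (s≤s z≤n))))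

moves-slide : Moves π̃ slideB
moves-slide pre f β p (expands hp cf) = expands
  (subst (λ n → Homogeneous n (π̃ (suc (length pre)) p)) len (Homogeneous-π̃ (suc (length pre)) p hp))
  (λ m lm → trans (coeff-π̃ (length pre) p m hp (trans lm (sym len)) (length-move-≥ pre (suc f) 0 β))
    (trans (Π-cong (length pre) m (λ m' l → cf m' (trans l (trans lm (sym len))))) (Π-slide pre (suc f) β m)))
  where len = length-move pre (suc f) 0 0 (suc f) β

moves-atom : Moves θ̃ atomB
moves-atom pre f β p (expands hp cf) = expands
  (subst (λ n → Homogeneous n (θ̃ (suc (length pre)) p)) len (Homogeneous-θ̃ (suc (length pre)) p hp))
  (λ m lm → trans (coeff-θ̃ (length pre) p m hp (trans lm (sym len)) (length-move-≥ pre (suc f) 0 β))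
    (trans (Θ-cong (length pre) m (λ m' l → cf m' (trans l (trans lm (sym len))))) (Θ-atom pre (suc f) β m (s≤s z≤n))))
  where len = length-move pre (suc f) 0 0 (suc f) β

-- Moving the parts of a flat vector to their places

block : ℕ → ℕ → List ℕ
block j k = map (j +_) (upTo k)

block-suc : ∀ j k → block j (suc k) ≡ j ∷ block (suc j) k
block-suc j k = cong₂ _∷_ (+-identityʳ j) (trans (cong (map (j +_)) (sym (map-upTo suc k)))
  (trans (sym (map-∘ (upTo k))) (map-cong (λ i → +-suc j i) (upTo k))))

apply : (ℕ → Poly → Poly) → Poly → List ℕ → Poly
apply op = foldl (λ p i → op i p)

apply-block : ∀ {op S} → Moves op S → ∀ k pre f β p →
  Expands S (pre ++ suc f ∷ replicate k 0 ++ β) p →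
  Expands S (pre ++ replicate k 0 ++ suc f ∷ β) (apply op p (block (suc (length pre)) k))
apply-block                mv zero    pre f β p ex = ex
apply-block {op} {S} mv (suc k) pre f β p ex =
  subst (λ w → Expands S (pre ++ replicate (suc k) 0 ++ suc f ∷ β) (apply op p w)) (sym (block-suc (suc (length pre)) k)) (subst₂ (λ α j → Expands S α (apply op (op (suc (length pre)) p) (block (suc j) k)))
    (++-assoc pre (0 ∷ []) _) (trans (length-++ pre) (+-comm (length pre) 1))
    (apply-block mv k (pre ++ 0 ∷ []) f β _
      (subst (λ α → Expands S α (op (suc (length pre)) p)) (sym (++-assoc pre (0 ∷ []) _))
        (mv pre f (replicate k 0 ++ β) p ex))))

filterB-++ : ∀ {A : Set} (p : A → Bool) xs ys → filterB p (xs ++ ys) ≡ filterB p xs ++ filterB p ys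
filterB-++ p []       ys = refl
filterB-++ p (x ∷ xs) ys with p x
... | true  = cong (x ∷_) (filterB-++ p xs ys)
... | false = filterB-++ p xs ys

filterB-cong : ∀ {A : Set} {P : A → Set} {p q : A → Bool} {xs} → All P xs → (∀ x → P x → p x ≡ q x) → filterB p xs ≡ filterB q xs
filterB-cong                  []                  e = refl
filterB-cong {p = p} {q} (_∷_ {x} px pxs) e with p x | q x | e x px
... | true  | true  | _ = cong (x ∷_) (filterB-cong pxs e)
... | false | false | _ = filterB-cong pxs e

zeros : List ℕ → ℕ
zeros α = length (filterB isZero α)

filterB-isZero : ∀ α → filterB isZero α ≡ replicate (zeros α) 0
filterB-isZero []          = refl
filterB-isZero (zero  ∷ α) = cong (0 ∷_) (filterB-isZero α)
filterB-isZero (suc a ∷ α) = filterB-isZero α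

length-flatS-zeros : ∀ α → length (flatS α) + zeros α ≡ length α
length-flatS-zeros []          = refl
length-flatS-zeros (zero  ∷ α) = trans (+-suc (length (flatS α)) (zeros α)) (cong suc (length-flatS-zeros α))
length-flatS-zeros (suc a ∷ α) = cong suc (length-flatS-zeros α)

get-++ : ∀ α x p → p ≤ length α → get (α ++ x ∷ []) p ≡ get α p
get-++ []      x zero          le = refl
get-++ (a ∷ α) x zero          le = refl
get-++ (a ∷ α) x (suc zero)    le = refl
get-++ (a ∷ α) x (suc (suc p)) (s≤s le) = get-++ α x (suc p) le

get-last : ∀ α x → get (α ++ x ∷ []) (suc (length α)) ≡ x
get-last []      x = refl
get-last (a ∷ α) x = get-last α x

length-∷ʳ : ∀ (α : List ℕ) x → length (α ++ x ∷ []) ≡ suc (length α)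
length-∷ʳ α x = trans (length-++ α) (+-comm (length α) 1)

map-suc-upTo-∷ʳ : ∀ n → map suc (upTo (suc n)) ≡ map suc (upTo n) ++ suc n ∷ []
map-suc-upTo-∷ʳ n = trans (cong (map suc) (sym (upTo-∷ʳ n))) (map-++ suc (upTo n) (n ∷ []))

nzPositions-∷ʳ : ∀ α x → nzPositions (α ++ x ∷ []) ≡ nzPositions α ++ (if nz x then suc (length α) ∷ [] else [])
nzPositions-∷ʳ α x = begin
  filterB q (map suc (upTo (length (α ++ x ∷ []))))
    ≡⟨ cong (λ n → filterB q (map suc (upTo n))) (length-∷ʳ α x) ⟩
  filterB q (map suc (upTo (suc (length α))))
    ≡⟨ cong (filterB q) (map-suc-upTo-∷ʳ (length α)) ⟩
  filterB q (map suc (upTo (length α)) ++ suc (length α) ∷ [])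
    ≡⟨ filterB-++ q (map suc (upTo (length α))) _ ⟩
  filterB q (map suc (upTo (length α))) ++ filterB q (suc (length α) ∷ [])
    ≡⟨ cong₂ _++_ (filterB-cong (All.map⁺ (All.all-upTo (length α))) (λ p le → cong nz (get-++ α x p le)))
                  (cong (λ y → if nz y then suc (length α) ∷ [] else []) (get-last α x)) ⟩
  nzPositions α ++ (if nz x then suc (length α) ∷ [] else []) ∎
  where
  open ≡-Reasoning
  q = λ p → nz (get (α ++ x ∷ []) p)

length-nzPositions : ∀ {α} → Reverse α → length (nzPositions α) ≡ length (flatS α)
length-nzPositions []             = refl
length-nzPositions (α ∶ r ∶ʳ zero) =
  trans (cong length (trans (nzPositions-∷ʳ α 0) (++-identityʳ _)))
    (trans (length-nzPositions r) (cong length (sym (trans (filterB-++ nz α (0 ∷ [])) (++-identityʳ _)))))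
length-nzPositions (α ∶ r ∶ʳ suc x) =
  trans (cong length (nzPositions-∷ʳ α (suc x))) (trans (length-∷ʳ (nzPositions α) _)
    (trans (cong suc (length-nzPositions r))
      (sym (trans (cong length (filterB-++ nz α (suc x ∷ []))) (length-∷ʳ (flatS α) (suc x))))))

zip-∷ʳ : ∀ (xs ys : List ℕ) a b → length xs ≡ length ys → zip (xs ++ a ∷ []) (ys ++ b ∷ []) ≡ zip xs ys ++ (a , b) ∷ []
zip-∷ʳ []       []       a b l = refl
zip-∷ʳ (x ∷ xs) (y ∷ ys) a b l = cong ((x , y) ∷_) (zip-∷ʳ xs ys a b (suc-injective l))

moveBlock : ℕ × ℕ → List ℕ
moveBlock (j , p) = block j (p ∸ j)

wordOf : List ℕ → List ℕ
wordOf ps = concatMap moveBlock (reverse (zip (map suc (upTo (length ps))) ps))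

-- The pattern-matching lambda inside `wordInv` agrees with `moveBlock` only on pairs in constructor
-- form, so the comparison is made pointwise.
wordInv-wordOf : ∀ α → wordInv α ≡ wordOf (nzPositions α)
wordInv-wordOf α = concatMap-cong (λ { (j , p) → refl }) (reverse (zip (map suc (upTo (length (nzPositions α)))) (nzPositions α)))

wordOf-∷ʳ : ∀ ps p → wordOf (ps ++ p ∷ []) ≡ moveBlock (suc (length ps) , p) ++ wordOf ps
wordOf-∷ʳ ps p = cong (concatMap moveBlock) (begin
  reverse (zip (map suc (upTo (length (ps ++ p ∷ [])))) (ps ++ p ∷ []))
    ≡⟨ cong (λ l → reverse (zip l (ps ++ p ∷ []))) (trans (cong (λ n → map suc (upTo n)) (length-∷ʳ ps p)) (map-suc-upTo-∷ʳ (length ps))) ⟩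
  reverse (zip (map suc (upTo (length ps)) ++ suc (length ps) ∷ []) (ps ++ p ∷ []))
    ≡⟨ cong reverse (zip-∷ʳ (map suc (upTo (length ps))) ps _ p (trans (length-map suc (upTo (length ps))) (length-upTo (length ps)))) ⟩
  reverse (zip (map suc (upTo (length ps))) ps ++ (suc (length ps) , p) ∷ [])
    ≡⟨ reverse-++ (zip (map suc (upTo (length ps))) ps) _ ⟩
  (suc (length ps) , p) ∷ reverse (zip (map suc (upTo (length ps))) ps) ∎)
  where open ≡-Reasoning

wordInv-∷ʳ-zero : ∀ α → wordInv (α ++ 0 ∷ []) ≡ wordInv α
wordInv-∷ʳ-zero α = trans (wordInv-wordOf (α ++ 0 ∷ []))
  (trans (cong wordOf (trans (nzPositions-∷ʳ α 0) (++-identityʳ _))) (sym (wordInv-wordOf α)))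

-- The last part is the first to be moved: it starts right after the other nonzero parts and has to
-- pass every zero of α.
wordInv-∷ʳ-suc : ∀ α x → wordInv (α ++ suc x ∷ []) ≡ block (suc (length (flatS α))) (zeros α) ++ wordInv α
wordInv-∷ʳ-suc α x = begin
  wordInv (α ++ suc x ∷ [])
    ≡⟨ trans (wordInv-wordOf (α ++ suc x ∷ [])) (cong wordOf (nzPositions-∷ʳ α (suc x))) ⟩
  wordOf (nzPositions α ++ suc (length α) ∷ [])
    ≡⟨ wordOf-∷ʳ (nzPositions α) (suc (length α)) ⟩
  block (suc (length (nzPositions α))) (length α ∸ length (nzPositions α)) ++ wordOf (nzPositions α)
    ≡⟨ cong₂ _++_ (cong₂ (λ l k → block (suc l) k) l≡ (trans (cong₂ _∸_ (sym (length-flatS-zeros α)) l≡) (m+n∸m≡n (length (flatS α)) (zeros α))))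
                  (sym (wordInv-wordOf α)) ⟩
  block (suc (length (flatS α))) (zeros α) ++ wordInv α ∎
  where
  open ≡-Reasoning
  l≡ = length-nzPositions (reverseView α)

-- That order of moves makes this an induction on α from the right; β holds the entries that have
-- already reached their final positions.
apply-wordInv : ∀ {op S} → Moves op S → ∀ {α} → Reverse α → ∀ β p →
  Expands S (flatW α ++ β) p → Expands S (α ++ β) (apply op p (wordInv α))
apply-wordInv            mv []              β p ex = ex
apply-wordInv {op} {S} mv (α ∶ r ∶ʳ zero) β p ex
  rewrite wordInv-∷ʳ-zero α | ++-assoc α (0 ∷ []) β =
  apply-wordInv mv r (0 ∷ β) p (subst (λ γ → Expands S γ p) flat ex)
  where
  flat : flatW (α ++ 0 ∷ []) ++ β ≡ flatW α ++ 0 ∷ β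
  flat rewrite filterB-++ nz α (0 ∷ []) | filterB-++ isZero α (0 ∷ []) | ++-identityʳ (filterB nz α)
    | sym (++-assoc (filterB nz α) (filterB isZero α) (0 ∷ [])) = ++-assoc (flatW α) (0 ∷ []) β
apply-wordInv {op} {S} mv (α ∶ r ∶ʳ suc x) β p ex
  rewrite wordInv-∷ʳ-suc α x | ++-assoc α (suc x ∷ []) β
    | foldl-++ (λ p i → op i p) p (block (suc (length (flatS α))) (zeros α)) (wordInv α) =
  apply-wordInv mv r (suc x ∷ β) _
    (subst (λ γ → Expands S γ _) to (apply-block mv (zeros α) (flatS α) x β p (subst (λ γ → Expands S γ p) from ex)))
  where
  from : flatW (α ++ suc x ∷ []) ++ β ≡ flatS α ++ suc x ∷ replicate (zeros α) 0 ++ β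
  from rewrite filterB-++ nz α (suc x ∷ []) | filterB-++ isZero α (suc x ∷ []) | ++-identityʳ (filterB isZero α)
    | ++-assoc (filterB nz α) (suc x ∷ []) (filterB isZero α) =
    trans (++-assoc (flatS α) _ β) (cong (λ z → flatS α ++ suc x ∷ z ++ β) (filterB-isZero α))
  to : flatS α ++ replicate (zeros α) 0 ++ suc x ∷ β ≡ flatW α ++ suc x ∷ β
  to = trans (cong (λ z → flatS α ++ z ++ suc x ∷ β) (sym (filterB-isZero α)))
    (sym (++-assoc (flatS α) (filterB isZero α) (suc x ∷ β)))

first-replicate : ∀ k → first (replicate k 0) ≡ 0
first-replicate zero    = refl
first-replicate (suc k) = first-replicate k

dec-replicate : ∀ c k → dec c (replicate k 0) ≡ replicate k 0
dec-replicate c zero    = refl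
dec-replicate c (suc k) = cong (0 ∷_) (dec-replicate c k)

≡ᵇ-sym : ∀ m n → (m ≡ᵇ n) ≡ (n ≡ᵇ m)
≡ᵇ-sym zero    zero    = refl
≡ᵇ-sym zero    (suc n) = refl
≡ᵇ-sym (suc m) zero    = refl
≡ᵇ-sym (suc m) (suc n) = ≡ᵇ-sym m n

≤ᵇ-zero : ∀ c → (c ≤ᵇ 0) ≡ (0 ≡ᵇ c)
≤ᵇ-zero zero    = refl
≤ᵇ-zero (suc c) = refl

slideB-zeros : ∀ k m → slideB (replicate k 0) m ≡ eqL (replicate k 0) m
slideB-zeros zero    []      = refl
slideB-zeros zero    (c ∷ m) = refl
slideB-zeros (suc k) []      = refl
slideB-zeros (suc k) (c ∷ m) rewrite first-replicate k | dec-replicate c k = cong₂ _∧_ (≤ᵇ-zero c) (slideB-zeros k m)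

atomB-zeros : ∀ k m → atomB (replicate k 0) m ≡ eqL (replicate k 0) m
atomB-zeros zero    []      = refl
atomB-zeros zero    (c ∷ m) = refl
atomB-zeros (suc k) []      = refl
atomB-zeros (suc k) (c ∷ m) rewrite first-replicate k | dec-replicate c k = cong₂ _∧_ (≤ᵇ-zero c) (atomB-zeros k m)

-- Letters only move to zero positions on their left, and here no zero precedes a nonzero part.
slideB-flat : ∀ α k m → slideB (flatS α ++ replicate k 0) m ≡ eqL (flatS α ++ replicate k 0) m
slideB-flat []          k m       = slideB-zeros k m
slideB-flat (zero  ∷ α) k m       = slideB-flat α k m
slideB-flat (suc a ∷ α) k []      = refl
slideB-flat (suc a ∷ α) k (c ∷ m) = cong₂ _∧_ (≡ᵇ-sym c (suc a)) (slideB-flat α k m)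

atomB-flat : ∀ α k m → atomB (flatS α ++ replicate k 0) m ≡ eqL (flatS α ++ replicate k 0) m
atomB-flat []          k m       = atomB-zeros k m
atomB-flat (zero  ∷ α) k m       = atomB-flat α k m
atomB-flat (suc a ∷ α) k []      = refl
atomB-flat (suc a ∷ α) k (c ∷ m) = cong₂ _∧_ (≡ᵇ-sym c (suc a)) (atomB-flat α k m)

coeff-mono : ∀ e m → coeff (mono e) m ≡ ⟦ eqL e m ⟧
coeff-mono e m with eqL e m
... | true  = refl
... | false = refl

expands-word : ∀ {op S} → Moves op S → (∀ α k m → S (flatS α ++ replicate k 0) m ≡ eqL (flatS α ++ replicate k 0) m) →
  ∀ α → Expands S α (apply op (mono (flatW α)) (wordInv α))
expands-word {op} {S} mv init α = subst (λ γ → Expands S γ (apply op (mono (flatW α)) (wordInv α))) (++-identityʳ α)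
  (apply-wordInv mv (reverseView α) [] (mono (flatW α))
    (subst (λ γ → Expands S γ (mono (flatW α))) (sym (++-identityʳ (flatW α)))
      (expands (refl ∷ []) (λ m _ → trans (coeff-mono (flatW α) m) (cong ⟦_⟧ (sym start))))))
  where
  start : ∀ {m} → S (flatW α) m ≡ eqL (flatW α) m
  start {m} = subst (λ z → S (flatS α ++ z) m ≡ eqL (flatS α ++ z) m) (sym (filterB-isZero α)) (init α (zeros α) m)

expands-slide : ∀ α → Expands slideB α (slide α)
expands-slide = expands-word moves-slide slideB-flat

expands-atom : ∀ α → Expands atomB α (atom α)
expands-atom = expands-word moves-atom atomB-flat

-- Slides and atoms via refinement and dominance

domGo-shift : ∀ c x y γ δ → domGo (c + x) (c + y) γ δ ≡ domGo x y γ δ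
domGo-shift c x y []      []      = refl
domGo-shift c x y (g ∷ γ) []      = cong₂ _∧_ (≤ᵇ-cong
    (λ le → +-cancelˡ-≤ c _ _ (subst (_≤ c + y) (+-assoc c x g) le))
    (λ le → subst (_≤ c + y) (sym (+-assoc c x g)) (+-monoʳ-≤ c le)))
  (trans (cong (λ z → domGo z (c + y) γ []) (+-assoc c x g)) (domGo-shift c (x + g) y γ []))
domGo-shift c x y []      (d ∷ δ) = cong₂ _∧_ (≤ᵇ-cong
    (λ le → +-cancelˡ-≤ c _ _ (subst (c + x ≤_) (+-assoc c y d) le))
    (λ le → subst (c + x ≤_) (sym (+-assoc c y d)) (+-monoʳ-≤ c le)))
  (trans (cong (λ z → domGo (c + x) z [] δ) (+-assoc c y d)) (domGo-shift c x (y + d) [] δ))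
domGo-shift c x y (g ∷ γ) (d ∷ δ) = cong₂ _∧_ (≤ᵇ-cong
    (λ le → +-cancelˡ-≤ c _ _ (subst₂ _≤_ (+-assoc c x g) (+-assoc c y d) le))
    (λ le → subst₂ _≤_ (sym (+-assoc c x g)) (sym (+-assoc c y d)) (+-monoʳ-≤ c le)))
  (trans (cong₂ (λ z w → domGo z w γ δ) (+-assoc c x g) (+-assoc c y d)) (domGo-shift c (x + g) (y + d) γ δ))

-- Up to the first nonzero part of α the left partial sums are 0 and impose nothing; from that part
-- on, c can be subtracted from both sides.
domGo-dec : ∀ c d α γ → c ≤ first α → length α ≡ length γ → domGo 0 (c + d) α γ ≡ domGo 0 d (dec c α) γ
domGo-dec zero    d []          []      le l = refl
domGo-dec c       d (zero  ∷ α) (g ∷ γ) le l =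
  trans (cong (λ z → domGo 0 z α γ) (+-assoc c d g)) (domGo-dec c (d + g) α γ le (suc-injective l))
domGo-dec c       d (suc a ∷ α) (g ∷ γ) le l = cong₂ _∧_ (≤ᵇ-cong
    (λ p → subst (suc a ∸ c ≤_) (m+n∸m≡n c (d + g)) (∸-monoˡ-≤ c (subst (suc a ≤_) (+-assoc c d g) p)))
    (λ p → subst₂ _≤_ (m+[n∸m]≡n le) (sym (+-assoc c d g)) (+-monoʳ-≤ c p)))
  (trans (cong₂ (λ z w → domGo z w α γ) (sym (m+[n∸m]≡n le)) (+-assoc c d g)) (domGo-shift c (suc a ∸ c) (d + g) α γ))

⊴-∷-equal : ∀ a α γ → ((a ∷ α) ⊴ (a ∷ γ)) ≡ (α ⊴ γ)
⊴-∷-equal a α γ rewrite ≤ᵇ-true (≤-refl {a}) =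
  subst (λ z → domGo z z α γ ≡ (α ⊴ γ)) (+-identityʳ a) (domGo-shift a 0 0 α γ)

-- This brings refinement into the recursive form of `slideB`. When the first part is used up, `dec`
-- leaves a 0 there, which `flatS` discards.
≽-∷ : ∀ c μ α → (suc c ∷ μ) ≽ flatS α ≡ (suc c ≤ᵇ first α) ∧ (μ ≽ flatS (dec (suc c) α))
≽-∷ c μ []          = refl
≽-∷ c μ (zero  ∷ α) = ≽-∷ c μ α
≽-∷ c μ (suc a ∷ α) with <-cmp c a
... | tri≈ _ refl _ rewrite ≡ᵇ-refl a | <ᵇ-true (n<1+n a) | n∸n≡0 a = refl
... | tri> _ ne gt rewrite ≡ᵇ-false ne | <ᵇ-false {c} {a} (<⇒≤ gt) | <ᵇ-false {c} {suc a} gt = refl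
... | tri< lt ne _ rewrite ≡ᵇ-false ne | <ᵇ-true lt | <ᵇ-true (m<n⇒m<1+n lt) with a ∸ c in eq
...   | zero  = ⊥-elim (<⇒≱ lt (m∸n≡0⇒m≤n eq))
...   | suc w = refl

-- At a nonzero position refinement bounds the entry of γ from above and dominance from below, so it
-- is determined. At a zero position dominance asks nothing yet, and by refinement the entry is cut
-- from the next part.
slideB-correct : ∀ α γ → length α ≡ length γ → (flatS γ ≽ flatS α) ∧ (α ⊴ γ) ≡ slideB α γ
slideB-correct []          []          l = refl
slideB-correct (suc a ∷ α) (zero  ∷ γ) l = ∧-zeroʳ (flatS γ ≽ flatS (suc a ∷ α))
slideB-correct (suc a ∷ α) (suc c ∷ γ) l with <-cmp c a
... | tri≈ _ refl _ rewrite ≡ᵇ-refl a | ⊴-∷-equal (suc a) α γ = slideB-correct α γ (suc-injective l)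
... | tri> _ ne gt  rewrite ≡ᵇ-false ne | <ᵇ-false {c} {a} (<⇒≤ gt) = refl
... | tri< lt ne _  rewrite ≡ᵇ-false ne | <ᵇ-true lt | <ᵇ-false {a} {suc c} lt = ∧-zeroʳ _
slideB-correct (zero ∷ α) (zero ∷ γ) l =
  trans (slideB-correct α γ (suc-injective l)) (cong (λ β → slideB β γ) (sym (dec-0 α)))
slideB-correct (zero ∷ α) (suc c ∷ γ) l = begin
  ((suc c ∷ flatS γ) ≽ flatS α) ∧ domGo 0 (suc c) α γ
    ≡⟨ cong (_∧ domGo 0 (suc c) α γ) (≽-∷ c (flatS γ) α) ⟩
  ((suc c ≤ᵇ first α) ∧ (flatS γ ≽ flatS (dec (suc c) α))) ∧ domGo 0 (suc c) α γ
    ≡⟨ ∧-assoc (suc c ≤ᵇ first α) _ _ ⟩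
  (suc c ≤ᵇ first α) ∧ (flatS γ ≽ flatS (dec (suc c) α)) ∧ domGo 0 (suc c) α γ
    ≡⟨ ∧-cong-under (suc c ≤ᵇ first α) (λ e → trans
         (cong ((flatS γ ≽ flatS (dec (suc c) α)) ∧_)
           (trans (cong (λ z → domGo 0 z α γ) (sym (+-identityʳ (suc c)))) (domGo-dec (suc c) 0 α γ (≤ᵇ-sound e) (suc-injective l))))
         (slideB-correct (dec (suc c) α) γ (trans (length-dec (suc c) α) (suc-injective l)))) ⟩
  (suc c ≤ᵇ first α) ∧ slideB (dec (suc c) α) γ ∎
  where open ≡-Reasoning

-- The fundamental shift and two-sided dominance

-- qshift by recursion; the flag records whether the previous position is in S
-- (position 1 behaves as if it were preceded by an element of S).
qshiftFrom : Bool → List ℕ → List ℕ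
qshiftFrom s     []          = []
qshiftFrom true  (zero  ∷ β) = first β ∸ 1 ∷ qshiftFrom false β
qshiftFrom true  (suc b ∷ β) = suc b ∷ qshiftFrom true β
qshiftFrom false (zero  ∷ β) = 0 ∷ qshiftFrom false β
qshiftFrom false (suc b ∷ β) = 1 ∷ qshiftFrom true β

scan : List ℕ → ℕ → ℕ → Maybe ℕ
scan v zero    p = nothing
scan v (suc k) p = if nz (get v p) then just p else scan v k (suc p)

scan-unique : ∀ v (F : ℕ → ℕ → Maybe ℕ) → (∀ p → F 0 p ≡ nothing) →
  (∀ k p → F (suc k) p ≡ (if nz (get v p) then just p else F k (suc p))) → ∀ k p → F k p ≡ scan v k p
scan-unique v F z s zero    p = z p
scan-unique v F z s (suc k) p = trans (s k p) (cong (if nz (get v p) then just p else_) (scan-unique v F z s k (suc p)))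

-- The local function of nextNZ has no name outside Defs: it is the solution of
-- the underscore in the type of go-scan, found by unification in nextNZ-scan.
IsScan : List ℕ → (ℕ → ℕ → Maybe ℕ) → Set
IsScan v F = ∀ k p → F k p ≡ scan v k p

mutual
  go-scan : ∀ v (j : ℕ) → IsScan v _
  go-scan v j = scan-unique v _ (λ _ → refl) (λ _ _ → refl)

  nextNZ-scan : ∀ v j → nextNZ v j ≡ scan v (length v ∸ j) (suc j)
  nextNZ-scan v j with length v ∸ j | suc j
  ... | k | p = go-scan v j k p

-- A copy of the local conversion inside `qshiftEntry`: once `nextNZ` is abstracted, both reduce to
-- the same value in each case.
entryAt : List ℕ → Maybe ℕ → ℕ
entryAt v nothing  = 0
entryAt v (just p) = get v p ∸ 1

scan-∷ : ∀ x v k p → entryAt (x ∷ v) (scan (x ∷ v) k (2 + p)) ≡ entryAt v (scan v k (suc p))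
scan-∷ x v zero    p = refl
scan-∷ x v (suc k) p with nz (get v (suc p))
... | true  = refl
... | false = scan-∷ x v k (suc p)

scan-first : ∀ v → entryAt v (scan v (length v) 1) ≡ first v ∸ 1
scan-first []          = refl
scan-first (zero  ∷ v) = trans (scan-∷ 0 v (length v) 0) (scan-first v)
scan-first (suc x ∷ v) = refl

nextNZ-∷ : ∀ x v i → entryAt (x ∷ v) (nextNZ (x ∷ v) (suc i)) ≡ entryAt v (nextNZ v i)
nextNZ-∷ x v i rewrite nextNZ-scan (x ∷ v) (suc i) | nextNZ-scan v i = scan-∷ x v (length v ∸ i) i

nextNZ-first : ∀ v → entryAt v (nextNZ v 0) ≡ first v ∸ 1
nextNZ-first v rewrite nextNZ-scan v 0 = scan-first v

qshiftEntry-first : ∀ x v → qshiftEntry (x ∷ v) 1 ∷ qshiftFrom (nz x) v ≡ qshiftFrom true (x ∷ v)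
qshiftEntry-first (suc x) v = refl
qshiftEntry-first zero    v with nextNZ (0 ∷ v) 0 | nextNZ-first (0 ∷ v)
... | nothing | e = cong (_∷ qshiftFrom false v) e
... | just p  | e = cong (_∷ qshiftFrom false v) e

qshiftEntry-second : ∀ x y v → qshiftEntry (x ∷ y ∷ v) 2 ∷ qshiftFrom (nz y) v ≡ qshiftFrom (nz x) (y ∷ v)
qshiftEntry-second zero    zero    v = refl
qshiftEntry-second zero    (suc y) v = refl
qshiftEntry-second (suc x) (suc y) v = refl
qshiftEntry-second (suc x) zero    v
  with nextNZ (suc x ∷ 0 ∷ v) 1 | trans (nextNZ-∷ (suc x) (0 ∷ v) 0) (nextNZ-first (0 ∷ v))
... | nothing | e = cong (_∷ qshiftFrom false v) e
... | just p  | e = cong (_∷ qshiftFrom false v) e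

-- The offset 3 is the least for which neither the entry nor its left neighbour is the prepended x,
-- and for which the shortened vector is not read at its special position 1.
qshiftEntry-∷ : ∀ x v i → qshiftEntry (x ∷ v) (3 + i) ≡ qshiftEntry v (2 + i)
qshiftEntry-∷ x v i with inS v (2 + i) | inS v (suc i)
... | true  | _     = refl
... | false | false = refl
... | false | true with nextNZ (x ∷ v) (2 + i) | nextNZ v (suc i) | nextNZ-∷ x v (suc i)
...   | nothing | nothing | e = e
...   | nothing | just _  | e = e
...   | just _  | nothing | e = e
...   | just _  | just _  | e = e

map-upTo-suc : ∀ (f : ℕ → ℕ) n → map f (upTo (suc n)) ≡ f 0 ∷ map (f ∘ suc) (upTo n)
map-upTo-suc f n = cong (f 0 ∷_) (trans (cong (map f) (sym (map-upTo suc n))) (sym (map-∘ (upTo n))))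

qshift-tail : ∀ x v → map (λ i → qshiftEntry (x ∷ v) (2 + i)) (upTo (length v)) ≡ qshiftFrom (nz x) v
qshift-tail x []      = refl
qshift-tail x (y ∷ v) = trans (map-upTo-suc _ (length v))
  (trans (cong (qshiftEntry (x ∷ y ∷ v) 2 ∷_)
      (trans (map-cong (λ i → qshiftEntry-∷ x (y ∷ v) i) (upTo (length v))) (qshift-tail y v)))
    (qshiftEntry-second x y v))

qshift-qshiftFrom : ∀ v → qshift v ≡ qshiftFrom true v
qshift-qshiftFrom []      = refl
qshift-qshiftFrom (x ∷ v) = trans (map-upTo-suc _ (length v))
  (trans (cong (qshiftEntry (x ∷ v) 1 ∷_) (qshift-tail x v)) (qshiftEntry-first x v))

first-dec : ∀ t β → t ≤ first β ∸ 1 → first (dec t β) ≡ first β ∸ t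
first-dec t    []          le = sym (0∸n≡0 t)
first-dec t    (zero  ∷ β) le = first-dec t β le
first-dec t    (suc b ∷ β) le rewrite +-∸-assoc 1 le = refl

dec-dec : ∀ t c β → t ≤ first β ∸ 1 → dec c (dec t β) ≡ dec (t + c) β
dec-dec t c []          le = refl
dec-dec t c (zero  ∷ β) le = cong (0 ∷_) (dec-dec t c β le)
dec-dec t c (suc b ∷ β) le = trans (cong (λ z → dec c (z ∷ β)) (+-∸-assoc 1 le))
  (cong (_∷ β) (trans (cong (_∸ c) (sym (+-∸-assoc 1 le))) (∸-+-assoc (suc b) t c)))

sandwich : ∀ {s c X Y Z} → (c ≡ s → X ∧ Y ≡ Z) → ((s ≤ᵇ c) ∧ X) ∧ ((c ≤ᵇ s) ∧ Y) ≡ (c ≡ᵇ s) ∧ Z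
sandwich {s} {c} h with <-cmp c s
... | tri≈ _ refl _ rewrite ≡ᵇ-refl c | ≤ᵇ-true (≤-refl {c}) = h refl
... | tri< lt ne _  rewrite ≡ᵇ-false ne | ≤ᵇ-false lt = refl
... | tri> _ ne gt  rewrite ≡ᵇ-false ne | ≤ᵇ-false gt = ∧-zeroʳ _

mutual
  -- At the start and after each nonzero position, β and its shift have equal partial sums. The two
  -- dominance conditions then force δ to have the same sum s, which can be subtracted throughout.
  atomB-boundary : ∀ β δ s → length β ≡ length δ → domGo s s β δ ∧ domGo s s δ (qshiftFrom true β) ≡ atomB β δ
  atomB-boundary β δ s l = trans
    (cong₂ _∧_ (shift β δ) (shift δ (qshiftFrom true β)))
    (boundary β δ l)
    where
    shift : ∀ γ γ' → domGo s s γ γ' ≡ domGo 0 0 γ γ'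
    shift γ γ' = subst (λ z → domGo z z γ γ' ≡ domGo 0 0 γ γ') (+-identityʳ s) (domGo-shift s 0 0 γ γ')

  boundary : ∀ β δ → length β ≡ length δ → domGo 0 0 β δ ∧ domGo 0 0 δ (qshiftFrom true β) ≡ atomB β δ
  boundary []          []      l = refl
  boundary (zero  ∷ β) (c ∷ δ) l = trans (∧-swap (domGo 0 c β δ) (c ≤ᵇ first β ∸ 1) _)
    (∧-cong-under (c ≤ᵇ first β ∸ 1) (λ e → atomB-inside c β δ (≤ᵇ-sound e) (suc-injective l)))
  boundary (suc b ∷ β) (c ∷ δ) l = sandwich {suc b} {c} λ { refl → atomB-boundary β δ (suc b) (suc-injective l) }

  -- Within a gap of zeros the lower bound stands still, while the upper one has risen by
  -- `first β ∸ 1` at the first zero; t is what δ has taken since then. The entry 1 of the shift at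
  -- the end of the gap makes both bounds meet again.
  atomB-inside : ∀ t β δ → t ≤ first β ∸ 1 → length β ≡ length δ →
    domGo 0 t β δ ∧ domGo t (first β ∸ 1) δ (qshiftFrom false β) ≡ atomB (dec t β) δ
  atomB-inside t []          []      le l = refl
  atomB-inside t (zero  ∷ β) (c ∷ δ) le l = begin
    domGo 0 (t + c) β δ ∧ (t + c ≤ᵇ first β ∸ 1 + 0) ∧ domGo (t + c) (first β ∸ 1 + 0) δ (qshiftFrom false β)
      ≡⟨ cong (λ z → domGo 0 (t + c) β δ ∧ (t + c ≤ᵇ z) ∧ domGo (t + c) z δ (qshiftFrom false β)) (+-identityʳ (first β ∸ 1)) ⟩
    domGo 0 (t + c) β δ ∧ (t + c ≤ᵇ first β ∸ 1) ∧ domGo (t + c) (first β ∸ 1) δ (qshiftFrom false β)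
      ≡⟨ ∧-swap (domGo 0 (t + c) β δ) (t + c ≤ᵇ first β ∸ 1) _ ⟩
    (t + c ≤ᵇ first β ∸ 1) ∧ domGo 0 (t + c) β δ ∧ domGo (t + c) (first β ∸ 1) δ (qshiftFrom false β)
      ≡⟨ ∧-cong-under (t + c ≤ᵇ first β ∸ 1) (λ e → atomB-inside (t + c) β δ (≤ᵇ-sound e) (suc-injective l)) ⟩
    (t + c ≤ᵇ first β ∸ 1) ∧ atomB (dec (t + c) β) δ
      ≡⟨ cong₂ _∧_ (≤ᵇ-cong
           (λ p → subst (_≤ first β ∸ 1 ∸ t) (m+n∸m≡n t c) (∸-monoˡ-≤ t p))
           (λ p → subst (t + c ≤_) (m+[n∸m]≡n le) (+-monoʳ-≤ t p)))
         (cong (λ γ → atomB γ δ) (sym (dec-dec t c β le))) ⟩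
    (c ≤ᵇ first β ∸ 1 ∸ t) ∧ atomB (dec c (dec t β)) δ
      ≡⟨ cong (λ z → (c ≤ᵇ z) ∧ atomB (dec c (dec t β)) δ) (trans (∸-+-assoc (first β) 1 t)
           (trans (cong (first β ∸_) (+-comm 1 t)) (trans (sym (∸-+-assoc (first β) t 1)) (cong (_∸ 1) (sym (first-dec t β le)))))) ⟩
    (c ≤ᵇ first (dec t β) ∸ 1) ∧ atomB (dec c (dec t β)) δ ∎
    where open ≡-Reasoning
  atomB-inside t (suc b ∷ β) (c ∷ δ) le l = begin
    ((suc b ≤ᵇ t + c) ∧ domGo (suc b) (t + c) β δ) ∧ (t + c ≤ᵇ b + 1) ∧ domGo (t + c) (b + 1) δ (qshiftFrom true β)
      ≡⟨ cong (λ z → ((suc b ≤ᵇ t + c) ∧ domGo (suc b) (t + c) β δ) ∧ (t + c ≤ᵇ z) ∧ domGo (t + c) z δ (qshiftFrom true β)) (+-comm b 1) ⟩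
    ((suc b ≤ᵇ t + c) ∧ domGo (suc b) (t + c) β δ) ∧ (t + c ≤ᵇ suc b) ∧ domGo (t + c) (suc b) δ (qshiftFrom true β)
      ≡⟨ sandwich {suc b} {t + c} (λ e → trans
           (cong (λ z → domGo (suc b) z β δ ∧ domGo z (suc b) δ (qshiftFrom true β)) e)
           (atomB-boundary β δ (suc b) (suc-injective l))) ⟩
    (t + c ≡ᵇ suc b) ∧ atomB β δ
      ≡⟨ cong (_∧ atomB β δ) (bool-ext
           (λ e → ≡ᵇ-true (trans (sym (m+n∸m≡n t c)) (trans (cong (_∸ t) (≡ᵇ-sound {t + c} e)) (+-∸-assoc 1 le))))
           (λ e → ≡ᵇ-true (trans (cong (t +_) (≡ᵇ-sound {c} e)) (trans (+-suc t (b ∸ t)) (cong suc (m+[n∸m]≡n le)))))) ⟩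
    (c ≡ᵇ suc (b ∸ t)) ∧ atomB β δ
      ≡⟨ cong (λ z → atomB (z ∷ β) (c ∷ δ)) (+-∸-assoc 1 le) ⟨
    atomB (suc b ∸ t ∷ β) (c ∷ δ) ∎
    where open ≡-Reasoning

atomB-correct : ∀ β δ → length β ≡ length δ → (δ ⊴ qshift β) ∧ (β ⊴ δ) ≡ atomB β δ
atomB-correct β δ l = trans (cong (λ q → (δ ⊴ q) ∧ (β ⊴ δ)) (qshift-qshiftFrom β))
  (trans (∧-comm (δ ⊴ qshiftFrom true β) (β ⊴ δ)) (boundary β δ l))

-- Words cut into blocks

elem : ℕ → List ℕ → Bool
elem x []      = false
elem x (y ∷ w) = (x ≡ᵇ y) ∨ elem x w

-- Letters 2r+1 and 2r+2 belong to the position followed by r others and must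
-- not be placed further right; the last copy of an even letter, i.e. one that
-- does not occur in the remaining word w, must be placed there exactly.
allowed : ℕ → List ℕ → ℕ → Bool
allowed x w r = if isOdd x ∨ elem x w then ⌈ x /2⌉ ≤ᵇ suc r else ⌈ x /2⌉ ≡ᵇ suc r

_≤?ᵇ_ : Maybe ℕ → ℕ → Bool
nothing ≤?ᵇ x = true
just l  ≤?ᵇ x = l ≤ᵇ x

-- fits m ℓ w: cutting w into blocks of sizes m gives weakly increasing blocks of
-- allowed letters, where the first block continues one whose last letter is ℓ.
fits : List ℕ → Maybe ℕ → List ℕ → Bool
fits []          ℓ []      = true
fits []          ℓ (x ∷ w) = false
fits (zero ∷ m)  ℓ w       = fits m nothing w
fits (suc j ∷ m) ℓ []      = false
fits (suc j ∷ m) ℓ (x ∷ w) = (ℓ ≤?ᵇ x) ∧ allowed x w (length m) ∧ fits (j ∷ m) (just x) w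

allowed⇒≤ : ∀ x w r → allowed x w r ≡ true → ⌈ x /2⌉ ≤ suc r
allowed⇒≤ x w r e with isOdd x ∨ elem x w
... | true  = ≤ᵇ-sound e
... | false = ≤-reflexive (≡ᵇ-sound e)

allowed-equal : ∀ x w r → ⌈ x /2⌉ ≡ suc r → allowed x w r ≡ true
allowed-equal x w r e with isOdd x ∨ elem x w
... | true  = ≤ᵇ-true (≤-reflexive e)
... | false = ≡ᵇ-true e

allowed-odd : ∀ x w r → isOdd x ≡ true → allowed x w r ≡ (⌈ x /2⌉ ≤ᵇ suc r)
allowed-odd x w r e rewrite e = refl

allowed-early : ∀ x w r → isOdd x ≡ false → ⌈ x /2⌉ < suc r → allowed x w r ≡ elem x w
allowed-early x w r e lt rewrite e with elem x w
... | true  = ≤ᵇ-true (<⇒≤ lt)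
... | false = ≡ᵇ-false (<⇒≢ lt)

-- The number of remaining positions only decreases, so a head letter that is already too far right
-- stays so, however many empty blocks are skipped.
fits-late : ∀ m ℓ x w → length m < ⌈ x /2⌉ → fits m ℓ (x ∷ w) ≡ false
fits-late []          ℓ x w lt = refl
fits-late (zero ∷ m)  ℓ x w lt = fits-late m nothing x w (<⇒≤ lt)
fits-late (suc j ∷ m) ℓ x w lt with allowed x w (length m) in e
... | true  = ⊥-elim (<⇒≱ lt (allowed⇒≤ x w (length m) e))
... | false = ∧-zeroʳ (ℓ ≤?ᵇ x)

-- Starting a block amounts to continuing one that ends in x itself; this lets an induction over the
-- copies of x treat its first step like the others.
fits-just-head : ∀ m x w → fits m (just x) (x ∷ w) ≡ fits m nothing (x ∷ w)
fits-just-head []          x w = refl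
fits-just-head (zero ∷ m)  x w = refl
fits-just-head (suc j ∷ m) x w rewrite ≤ᵇ-true (≤-refl {x}) = refl

<ᵇ-suc : ∀ c k → (c <ᵇ suc k) ≡ (c ≤ᵇ k)
<ᵇ-suc zero    k = refl
<ᵇ-suc (suc c) k = refl

-- The letters of v are smaller than x, so a block continuing after x can take nothing but further
-- copies of x.
fits-take : ∀ c γ x k v → (∀ w → allowed x w (length γ) ≡ true) → All (_< x) v →
  fits (c ∷ γ) (just x) (replicate k x ++ v) ≡ (c ≤ᵇ k) ∧ fits γ nothing (replicate (k ∸ c) x ++ v)
fits-take zero    γ x k       v       ok lt = refl
fits-take (suc c) γ x zero    []      ok lt = refl
fits-take (suc c) γ x zero    (y ∷ v) ok (y<x ∷ _) rewrite ≤ᵇ-false y<x = refl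
fits-take (suc c) γ x (suc k) v       ok lt
  rewrite ≤ᵇ-true (≤-refl {x}) | ok (replicate k x ++ v) | <ᵇ-suc c k = fits-take c γ x k v ok lt

elem-small : ∀ x v → All (_< x) v → elem x v ≡ false
elem-small x []      []         = refl
elem-small x (y ∷ v) (lt ∷ lts) rewrite ≡ᵇ-false {x} {y} (λ e → <⇒≢ lt (sym e)) = elem-small x v lts

-- Left of its own position the last copy of an even letter is not allowed, whence `k ∸ 1`. For k =
-- 0 the truncated subtraction gives the correct bound 0.
fits-take-early : ∀ c γ x k v → isOdd x ≡ false → ⌈ x /2⌉ < suc (length γ) → All (_< x) v →
  fits (c ∷ γ) (just x) (replicate k x ++ v) ≡ (c ≤ᵇ k ∸ 1) ∧ fits γ nothing (replicate (k ∸ c) x ++ v)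
fits-take-early zero    γ x k       v       ev le lt = refl
fits-take-early (suc c) γ x zero    []      ev le lt = refl
fits-take-early (suc c) γ x zero    (y ∷ v) ev le (y<x ∷ _) rewrite ≤ᵇ-false y<x = refl
fits-take-early (suc c) γ x (suc zero) v    ev le lt
  rewrite ≤ᵇ-true (≤-refl {x}) | allowed-early x v (length γ) ev le | elem-small x v lt = refl
fits-take-early (suc c) γ x (suc (suc k)) v ev le lt
  rewrite ≤ᵇ-true (≤-refl {x}) | allowed-early x (x ∷ replicate k x ++ v) (length γ) ev le | ≡ᵇ-refl x | <ᵇ-suc c k =
  fits-take-early c γ x (suc k) v ev le lt

-- Slides and atoms as cuts of the words A and B

-- letters 1 α and letters 2 β are the words A and B.
letters : ℕ → List ℕ → List ℕ
letters e []      = []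
letters e (a ∷ α) = replicate a (2 * length α + e) ++ letters e α

top : ℕ → List ℕ → ℕ
top e []          = 0
top e (zero  ∷ α) = top e α
top e (suc a ∷ α) = 2 * length α + e

rest : ℕ → List ℕ → List ℕ
rest e []          = []
rest e (zero  ∷ α) = rest e α
rest e (suc a ∷ α) = letters e α

letters-bound : ∀ e α → All (_< 2 * length α + e) (letters e α)
letters-bound e []      = []
letters-bound e (a ∷ α) = All.++⁺ (All.replicate⁺ a below) (All.map (λ lt → <-trans lt below) (letters-bound e α))
  where
  below : 2 * length α + e < 2 * suc (length α) + e
  below = +-monoˡ-< e (*-monoʳ-< 2 (n<1+n (length α)))

rest-bound : ∀ e α → 1 ≤ first α → All (_< top e α) (rest e α)
rest-bound e (zero  ∷ α) p = rest-bound e α p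
rest-bound e (suc a ∷ α) p = letters-bound e α

letters-dec : ∀ e c α → letters e (dec c α) ≡ replicate (first α ∸ c) (top e α) ++ rest e α
letters-dec e c []          rewrite 0∸n≡0 c = refl
letters-dec e c (zero  ∷ α) = letters-dec e c α
letters-dec e c (suc a ∷ α) = refl

⌈2k+e/2⌉ : ∀ k e → ⌈ 2 * k + e /2⌉ ≡ k + ⌈ e /2⌉
⌈2k+e/2⌉ zero    e = refl
⌈2k+e/2⌉ (suc k) e rewrite +-suc k (k + 0) = cong suc (⌈2k+e/2⌉ k e)

isOdd-2k+e : ∀ k e → isOdd (2 * k + e) ≡ isOdd e
isOdd-2k+e zero    e = refl
isOdd-2k+e (suc k) e rewrite +-suc k (k + 0) = isOdd-2k+e k e

⌈top/2⌉ : ∀ e α → ⌈ e /2⌉ ≡ 1 → ⌈ top e α /2⌉ ≤ length α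
⌈top/2⌉ e []          h = z≤n
⌈top/2⌉ e (zero  ∷ α) h = m≤n⇒m≤1+n (⌈top/2⌉ e α h)
⌈top/2⌉ e (suc a ∷ α) h = ≤-reflexive (trans (⌈2k+e/2⌉ (length α) e) (trans (cong (length α +_) h) (+-comm (length α) 1)))

isOdd-top : ∀ e α → 1 ≤ first α → isOdd (top e α) ≡ isOdd e
isOdd-top e (zero  ∷ α) p = isOdd-top e α p
isOdd-top e (suc a ∷ α) p = isOdd-2k+e (length α) e

letters-split : ∀ e α → letters e α ≡ replicate (first α) (top e α) ++ rest e α
letters-split e α = trans (cong (letters e) (sym (dec-0 α))) (letters-dec e 0 α)

-- Both e = 1 and e = 2 have `⌈ e /2⌉` equal to 1, so x belongs to exactly this position: every copy
-- is allowed here, and a copy left over would be too late for γ.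
fits-letters-suc : ∀ e → ⌈ e /2⌉ ≡ 1 → ∀ a α c γ → length α ≡ length γ →
  fits (c ∷ γ) nothing (letters e (suc a ∷ α)) ≡ (c ≡ᵇ suc a) ∧ fits γ nothing (letters e α)
fits-letters-suc e h a α c γ l = trans (sym (fits-just-head (c ∷ γ) x _))
    (trans (fits-take c γ x (suc a) (letters e α) (λ w → allowed-equal x w (length γ) ⌈x/2⌉) (letters-bound e α))
           (exact (<-cmp c (suc a))))
  where
  x = 2 * length α + e
  ⌈x/2⌉ : ⌈ x /2⌉ ≡ suc (length γ)
  ⌈x/2⌉ = trans (⌈2k+e/2⌉ (length α) e) (trans (cong₂ _+_ l h) (+-comm (length γ) 1))
  exact : Tri (c < suc a) (c ≡ suc a) (suc a < c) →
    (c ≤ᵇ suc a) ∧ fits γ nothing (replicate (suc a ∸ c) x ++ letters e α) ≡ (c ≡ᵇ suc a) ∧ fits γ nothing (letters e α)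
  exact (tri≈ _ refl _) rewrite n∸n≡0 a | ≡ᵇ-refl a | <ᵇ-true (n<1+n a) = refl
  exact (tri> _ ne gt) rewrite ≡ᵇ-false ne | ≤ᵇ-false gt = refl
  exact (tri< lt ne _) rewrite ≡ᵇ-false ne with suc a ∸ c in eq
  ... | zero  = ⊥-elim (<⇒≱ lt (m∸n≡0⇒m≤n eq))
  ... | suc w = trans (cong ((c ≤ᵇ suc a) ∧_) (fits-late γ nothing x _ (≤-reflexive (sym ⌈x/2⌉)))) (∧-zeroʳ _)

fits-[]-block : ∀ c γ → fits (c ∷ γ) nothing [] ≡ (c ≤ᵇ 0) ∧ fits γ nothing []
fits-[]-block zero    γ = refl
fits-[]-block (suc c) γ = refl

letters-none : ∀ e α → first α ≡ 0 → letters e α ≡ []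
letters-none e []         p = refl
letters-none e (zero ∷ α) p = letters-none e α p

none-dec : ∀ c α → first α ≡ 0 → dec c α ≡ α
none-dec c []         p = refl
none-dec c (zero ∷ α) p = cong (0 ∷_) (none-dec c α p)

fits-slide-zero : ∀ α c γ → length α ≡ length γ →
  fits (c ∷ γ) nothing (letters 1 α) ≡ (c ≤ᵇ first α) ∧ fits γ nothing (letters 1 (dec c α))
fits-slide-zero α c γ l with first α in eq | letters-split 1 α | letters-dec 1 c α | rest-bound 1 α | isOdd-top 1 α
... | zero  | _ | _ | _ | _ rewrite none-dec c α eq | letters-none 1 α eq = fits-[]-block c γ
... | suc k | s | d | b | o = trans (cong (fits (c ∷ γ) nothing) s)
  (trans (sym (fits-just-head (c ∷ γ) x _))
    (trans (fits-take c γ x (suc k) (rest 1 α)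
      (λ w → trans (allowed-odd x w (length γ) (o (s≤s z≤n)))
        (≤ᵇ-true (≤-trans (⌈top/2⌉ 1 α refl) (≤-trans (≤-reflexive l) (n≤1+n _))))) (b (s≤s z≤n)))
      (cong (λ w → (c ≤ᵇ suc k) ∧ fits γ nothing w) (sym d))))
  where x = top 1 α

fits-atom-zero : ∀ β c γ → length β ≡ length γ →
  fits (c ∷ γ) nothing (letters 2 β) ≡ (c ≤ᵇ first β ∸ 1) ∧ fits γ nothing (letters 2 (dec c β))
fits-atom-zero β c γ l with first β in eq | letters-split 2 β | letters-dec 2 c β | rest-bound 2 β | isOdd-top 2 β
... | zero  | _ | _ | _ | _ rewrite none-dec c β eq | letters-none 2 β eq = fits-[]-block c γ
... | suc k | s | d | b | o = trans (cong (fits (c ∷ γ) nothing) s)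
  (trans (sym (fits-just-head (c ∷ γ) x _))
    (trans (fits-take-early c γ x (suc k) (rest 2 β) (o (s≤s z≤n))
        (s≤s (≤-trans (⌈top/2⌉ 2 β refl) (≤-reflexive l))) (b (s≤s z≤n)))
      (cong (λ w → (c ≤ᵇ k) ∧ fits γ nothing w) (sym d))))
  where x = top 2 β

slideB-fits : ∀ α γ → length α ≡ length γ → slideB α γ ≡ fits γ nothing (letters 1 α)
slideB-fits []          []      l = refl
slideB-fits (zero  ∷ α) (c ∷ γ) l = trans
  (cong ((c ≤ᵇ first α) ∧_) (slideB-fits (dec c α) γ (trans (length-dec c α) (suc-injective l))))
  (sym (fits-slide-zero α c γ (suc-injective l)))
slideB-fits (suc a ∷ α) (c ∷ γ) l = trans (cong ((c ≡ᵇ suc a) ∧_) (slideB-fits α γ (suc-injective l)))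
  (sym (fits-letters-suc 1 refl a α c γ (suc-injective l)))

atomB-fits : ∀ β δ → length β ≡ length δ → atomB β δ ≡ fits δ nothing (letters 2 β)
atomB-fits []          []      l = refl
atomB-fits (zero  ∷ β) (c ∷ δ) l = trans
  (cong ((c ≤ᵇ first β ∸ 1) ∧_) (atomB-fits (dec c β) δ (trans (length-dec c β) (suc-injective l))))
  (sym (fits-atom-zero β c δ (suc-injective l)))
atomB-fits (suc b ∷ β) (c ∷ δ) l = trans (cong ((c ≡ᵇ suc b) ∧_) (atomB-fits β δ (suc-injective l)))
  (sym (fits-letters-suc 2 refl b β c δ (suc-injective l)))

-- Shuffles and convolution

shuf : List ℕ → List ℕ → List (List ℕ)
shuf []       ys       = ys ∷ []
shuf (x ∷ xs) []       = (x ∷ xs) ∷ []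
shuf (x ∷ xs) (y ∷ ys) = map (x ∷_) (shuf xs (y ∷ ys)) ++ map (y ∷_) (shuf (x ∷ xs) ys)

shuffle-just : ∀ xs ys → shuffle (map just xs) (map just ys) ≡ map (map just) (shuf xs ys)
shuffle-just []       ys       = refl
shuffle-just (x ∷ xs) []       = refl
shuffle-just (x ∷ xs) (y ∷ ys) = begin
  map (just x ∷_) (shuffle (map just xs) (map just (y ∷ ys))) ++ map (just y ∷_) (shuffle (map just (x ∷ xs)) (map just ys))
    ≡⟨ cong₂ (λ p q → map (just x ∷_) p ++ map (just y ∷_) q) (shuffle-just xs (y ∷ ys)) (shuffle-just (x ∷ xs) ys) ⟩
  map (just x ∷_) (map (map just) (shuf xs (y ∷ ys))) ++ map (just y ∷_) (map (map just) (shuf (x ∷ xs) ys))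
    ≡⟨ cong₂ _++_ (trans (sym (map-∘ (shuf xs (y ∷ ys)))) (map-∘ (shuf xs (y ∷ ys))))
                  (trans (sym (map-∘ (shuf (x ∷ xs) ys))) (map-∘ (shuf (x ∷ xs) ys))) ⟩
  map (map just) (map (x ∷_) (shuf xs (y ∷ ys))) ++ map (map just) (map (y ∷_) (shuf (x ∷ xs) ys))
    ≡⟨ map-++ (map just) (map (x ∷_) (shuf xs (y ∷ ys))) _ ⟨
  map (map just) (shuf (x ∷ xs) (y ∷ ys)) ∎
  where open ≡-Reasoning

∨-swap : ∀ a b c → a ∨ b ∨ c ≡ b ∨ a ∨ c
∨-swap true  true  c = refl
∨-swap true  false c = refl
∨-swap false b     c = refl

elem-shuf : ∀ z xs ys → All (λ w → elem z w ≡ elem z xs ∨ elem z ys) (shuf xs ys)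
elem-shuf z []       ys       = refl ∷ []
elem-shuf z (x ∷ xs) []       = sym (∨-identityʳ (elem z (x ∷ xs))) ∷ []
elem-shuf z (x ∷ xs) (y ∷ ys) = All.++⁺
  (All.map⁺ (All.map (λ e → trans (cong ((z ≡ᵇ x) ∨_) e) (sym (∨-assoc (z ≡ᵇ x) _ _))) (elem-shuf z xs (y ∷ ys))))
  (All.map⁺ (All.map (λ e → trans (cong ((z ≡ᵇ y) ∨_) e) (∨-swap (z ≡ᵇ y) (elem z (x ∷ xs)) _)) (elem-shuf z (x ∷ xs) ys)))

filterB-all : ∀ {A : Set} (p : A → Bool) {xs} → All (λ x → p x ≡ true) xs → filterB p xs ≡ xs
filterB-all p []                 = refl
filterB-all p (_∷_ {x} px pxs) rewrite px = cong (x ∷_) (filterB-all p pxs)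

filterB-none : ∀ {A : Set} (p : A → Bool) {xs} → All (λ x → p x ≡ false) xs → filterB p xs ≡ []
filterB-none p []         = refl
filterB-none p (px ∷ pxs) rewrite px = filterB-none p pxs

filterB-shuf : ∀ p {xs ys} → All (λ x → p x ≡ true) xs → All (λ y → p y ≡ false) ys → All (λ w → filterB p w ≡ xs) (shuf xs ys)
filterB-shuf p []         qs         = filterB-none p qs ∷ []
filterB-shuf p (px ∷ pxs) []         = filterB-all p (px ∷ pxs) ∷ []
filterB-shuf p {x ∷ xs} {y ∷ ys} (px ∷ pxs) (qy ∷ qys) = All.++⁺
  (All.map⁺ (All.map (λ {w} → keep {w}) (filterB-shuf p pxs (qy ∷ qys))))
  (All.map⁺ (All.map (λ {w} → drop {w}) (filterB-shuf p (px ∷ pxs) qys)))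
  where
  keep : ∀ {w} → filterB p w ≡ xs → filterB p (x ∷ w) ≡ x ∷ xs
  keep e rewrite px = cong (x ∷_) e
  drop : ∀ {w} → filterB p w ≡ x ∷ xs → filterB p (y ∷ w) ≡ x ∷ xs
  drop e rewrite qy = e

filterB-shufʳ : ∀ p {xs ys} → All (λ x → p x ≡ false) xs → All (λ y → p y ≡ true) ys → All (λ w → filterB p w ≡ ys) (shuf xs ys)
filterB-shufʳ p []         qs         = filterB-all p qs ∷ []
filterB-shufʳ p (px ∷ pxs) []         = filterB-none p (px ∷ pxs) ∷ []
filterB-shufʳ p {x ∷ xs} {y ∷ ys} (px ∷ pxs) (qy ∷ qys) = All.++⁺
  (All.map⁺ (All.map (λ {w} → drop {w}) (filterB-shufʳ p pxs (qy ∷ qys))))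
  (All.map⁺ (All.map (λ {w} → keep {w}) (filterB-shufʳ p (px ∷ pxs) qys)))
  where
  keep : ∀ {w} → filterB p w ≡ ys → filterB p (y ∷ w) ≡ y ∷ ys
  keep e rewrite qy = cong (y ∷_) e
  drop : ∀ {w} → filterB p w ≡ y ∷ ys → filterB p (x ∷ w) ≡ y ∷ ys
  drop e rewrite px = e

Odd Even : ℕ → Set
Odd x  = isOdd x ≡ true
Even x = isOdd x ≡ false

odd≢even : ∀ {x y} → Odd x → Even y → ¬ x ≡ y
odd≢even ox ey refl with trans (sym ox) ey
... | ()

elem-even-odds : ∀ {z} {A} → Even z → All Odd A → elem z A ≡ false
elem-even-odds             ez []       = refl
elem-even-odds {z} (ez) (_∷_ {x} o os) rewrite ≡ᵇ-false {z} {x} (λ e → odd≢even o ez (sym e)) = elem-even-odds ez os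

-- Merging two cut words into a cut shuffle

conv₁-vanish : ∀ j {F} → (∀ i k → F i k ≡ 0ℤ) → conv₁ j F ≡ 0ℤ
conv₁-vanish j e = trans (conv₁-cong j e) (conv₁-zero j)

conv₁-only-0 : ∀ j {F} → (∀ i k → F (suc i) k ≡ 0ℤ) → conv₁ j F ≡ F 0 j
conv₁-only-0 zero    e = refl
conv₁-only-0 (suc j) {F} e = trans (cong (F 0 (suc j) +ℤ_) (conv₁-vanish j e)) (+-idʳ _)

conv-vanish : ∀ m {F} → (∀ c d → F c d ≡ 0ℤ) → conv m F ≡ 0ℤ
conv-vanish m e = trans (conv-cong m (λ c d _ _ → e c d)) (conv-zero m)

conv-sym : ∀ m {f g : List ℕ → ℤ} → conv m (λ c d → f c *ℤ g d) ≡ conv m (λ c d → g c *ℤ f d)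
conv-sym m {f} {g} = trans (conv-flip m) (conv-cong m (λ c d _ _ → *ℤ-comm (f d) (g c)))

conv-[]ˡ : ∀ m ℓ {H : List ℕ → ℤ} → conv m (λ c d → ⟦ fits c ℓ [] ⟧ *ℤ H d) ≡ H m
conv-[]ˡ []          ℓ     = *-idˡ _
conv-[]ˡ (zero ∷ m)  ℓ {H} = conv-[]ˡ m nothing {H ∘ (0 ∷_)}
conv-[]ˡ (suc j ∷ m) ℓ {H} = trans
  (conv₁-only-0 (suc j) {λ i k → conv m (λ c d → ⟦ fits (i ∷ c) ℓ [] ⟧ *ℤ H (k ∷ d))}
    (λ i k → conv-vanish m (λ c d → *-0ˡ (H (k ∷ d)))))
  (conv-[]ˡ m nothing {H ∘ (suc j ∷_)})

step : Maybe ℕ → ℕ → List ℕ → ℕ → ℤ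
step ℓ x w r = ⟦ ℓ ≤?ᵇ x ⟧ *ℤ ⟦ allowed x w r ⟧

⟦fits-∷⟧ : ∀ j m ℓ x w → ⟦ fits (suc j ∷ m) ℓ (x ∷ w) ⟧ ≡ step ℓ x w (length m) *ℤ ⟦ fits (j ∷ m) (just x) w ⟧
⟦fits-∷⟧ j m ℓ x w = trans (⟦∧⟧ (ℓ ≤?ᵇ x) _) (trans (cong (⟦ ℓ ≤?ᵇ x ⟧ *ℤ_) (⟦∧⟧ (allowed x w (length m)) _)) (sym (*ℤ-assoc ⟦ ℓ ≤?ᵇ x ⟧ _ _)))

≤?ᵇ-trans : ∀ ℓ {x y} → (ℓ ≤?ᵇ x) ≡ true → x ≤ y → (ℓ ≤?ᵇ y) ≡ true
≤?ᵇ-trans nothing  e le = refl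
≤?ᵇ-trans (just l) e le = ≤ᵇ-true (≤-trans (≤ᵇ-sound {l} e) le)

fits-raise : ∀ m ℓ {x y} w → (ℓ ≤?ᵇ x) ≡ true → x ≤ y → fits m ℓ (y ∷ w) ≡ fits m (just x) (y ∷ w)
fits-raise []          ℓ w e le = refl
fits-raise (zero ∷ m)  ℓ w e le = refl
fits-raise (suc j ∷ m) ℓ w e le rewrite ≤?ᵇ-trans ℓ e le | ≤ᵇ-true le = refl

-- If the first block takes a letter from x ∷ A, then x comes first in the sorted merge, and after
-- it the bounds ℓ and x are equivalent for y. If it takes none, y comes first; the bound y then
-- keeps x out of the rest of this block, so only i = 0 contributes on the right as well.
conv-merge : ∀ {x y} → x < y → ∀ j m ℓ A B →
  conv (suc j ∷ m) (λ c d → ⟦ fits c ℓ (x ∷ A) ⟧ *ℤ ⟦ fits d ℓ (y ∷ B) ⟧) ≡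
  step ℓ x A (length m) *ℤ conv (j ∷ m) (λ c d → ⟦ fits c (just x) A ⟧ *ℤ ⟦ fits d (just x) (y ∷ B) ⟧) +ℤ
  step ℓ y B (length m) *ℤ conv (j ∷ m) (λ c d → ⟦ fits c (just y) (x ∷ A) ⟧ *ℤ ⟦ fits d (just y) B ⟧)
conv-merge {x} {y} x<y j m ℓ A B = begin
  conv₁ (suc j) F
    ≡⟨ +ℤ-comm (F 0 (suc j)) _ ⟩
  conv₁ j (λ i k → F (suc i) k) +ℤ F 0 (suc j)
    ≡⟨ cong₂ _+ℤ_ small large ⟩
  step ℓ x A (length m) *ℤ conv (j ∷ m) (λ c d → ⟦ fits c (just x) A ⟧ *ℤ ⟦ fits d (just x) (y ∷ B) ⟧) +ℤ
  step ℓ y B (length m) *ℤ conv (j ∷ m) (λ c d → ⟦ fits c (just y) (x ∷ A) ⟧ *ℤ ⟦ fits d (just y) B ⟧) ∎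
  where
  open ≡-Reasoning
  F : ℕ → ℕ → ℤ
  F i k = conv m (λ c d → ⟦ fits (i ∷ c) ℓ (x ∷ A) ⟧ *ℤ ⟦ fits (k ∷ d) ℓ (y ∷ B) ⟧)

  pointwise : ∀ i k c d → length c ≡ length m →
    ⟦ fits (suc i ∷ c) ℓ (x ∷ A) ⟧ *ℤ ⟦ fits (k ∷ d) ℓ (y ∷ B) ⟧ ≡
    step ℓ x A (length m) *ℤ (⟦ fits (i ∷ c) (just x) A ⟧ *ℤ ⟦ fits (k ∷ d) (just x) (y ∷ B) ⟧)
  pointwise i k c d lc with ℓ ≤?ᵇ x in e
  ... | false = trans (*-0ˡ _) (sym (trans (cong (_*ℤ _) (*-0ˡ _)) (*-0ˡ _)))
  ... | true  = trans
    (cong₂ _*ℤ_ (trans (⟦∧⟧ (allowed x A (length c)) _) (cong (λ r → ⟦ allowed x A r ⟧ *ℤ _) lc))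
                (cong ⟦_⟧ (fits-raise (k ∷ d) ℓ B e (<⇒≤ x<y))))
    (trans (*ℤ-assoc ⟦ allowed x A (length m) ⟧ _ _) (cong (_*ℤ _) (sym (*-idˡ ⟦ allowed x A (length m) ⟧))))

  small : conv₁ j (λ i k → F (suc i) k) ≡
    step ℓ x A (length m) *ℤ conv (j ∷ m) (λ c d → ⟦ fits c (just x) A ⟧ *ℤ ⟦ fits d (just x) (y ∷ B) ⟧)
  small = trans
    (conv₁-cong j (λ i k → conv-cong m (λ c d lc ld → pointwise i k c d lc)))
    (conv-*ˡ (j ∷ m) (step ℓ x A (length m)) {λ c d → ⟦ fits c (just x) A ⟧ *ℤ ⟦ fits d (just x) (y ∷ B) ⟧})

  large : F 0 (suc j) ≡
    step ℓ y B (length m) *ℤ conv (j ∷ m) (λ c d → ⟦ fits c (just y) (x ∷ A) ⟧ *ℤ ⟦ fits d (just y) B ⟧)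
  large = trans
    (conv-cong m (λ c d lc ld → trans
      (cong (⟦ fits c nothing (x ∷ A) ⟧ *ℤ_) (trans (⟦fits-∷⟧ j d ℓ y B) (cong (λ r → step ℓ y B r *ℤ ⟦ fits (j ∷ d) (just y) B ⟧) ld)))
      (trans (sym (*ℤ-assoc ⟦ fits c nothing (x ∷ A) ⟧ _ _)) (trans (cong (_*ℤ ⟦ fits (j ∷ d) (just y) B ⟧) (*ℤ-comm ⟦ fits c nothing (x ∷ A) ⟧ _))
        (*ℤ-assoc (step ℓ y B (length m)) _ _)))))
    (trans (conv-*ˡ m (step ℓ y B (length m)))
      (cong (step ℓ y B (length m) *ℤ_)
        (sym (conv₁-only-0 j {λ i k → conv m (λ c d → ⟦ fits (i ∷ c) (just y) (x ∷ A) ⟧ *ℤ ⟦ fits (k ∷ d) (just y) B ⟧)}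
          (λ i k → conv-vanish m (λ c d → trans (cong (λ b → ⟦ b ∧ allowed x A (length c) ∧ fits (i ∷ c) (just x) A ⟧ *ℤ ⟦ fits (k ∷ d) (just y) B ⟧) (≤ᵇ-false x<y)) (*-0ˡ _)))))))

conv-merge′ : ∀ {x y} → ¬ x ≡ y → ∀ j m ℓ A B →
  conv (suc j ∷ m) (λ c d → ⟦ fits c ℓ (x ∷ A) ⟧ *ℤ ⟦ fits d ℓ (y ∷ B) ⟧) ≡
  step ℓ x A (length m) *ℤ conv (j ∷ m) (λ c d → ⟦ fits c (just x) A ⟧ *ℤ ⟦ fits d (just x) (y ∷ B) ⟧) +ℤ
  step ℓ y B (length m) *ℤ conv (j ∷ m) (λ c d → ⟦ fits c (just y) (x ∷ A) ⟧ *ℤ ⟦ fits d (just y) B ⟧)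
conv-merge′ {x} {y} ne j m ℓ A B with <-cmp x y
... | tri< lt _ _ = conv-merge lt j m ℓ A B
... | tri≈ _ e _  = ⊥-elim (ne e)
... | tri> _ _ gt = trans (conv-sym (suc j ∷ m) {λ c → ⟦ fits c ℓ (x ∷ A) ⟧} {λ d → ⟦ fits d ℓ (y ∷ B) ⟧})
  (trans (conv-merge gt j m ℓ B A)
  (trans (+ℤ-comm (step ℓ y B (length m) *ℤ _) _)
  (cong₂ _+ℤ_ (cong (step ℓ x A (length m) *ℤ_) (conv-sym (j ∷ m) {λ c → ⟦ fits c (just x) (y ∷ B) ⟧} {λ d → ⟦ fits d (just x) A ⟧}))
              (cong (step ℓ y B (length m) *ℤ_) (conv-sym (j ∷ m) {λ c → ⟦ fits c (just y) B ⟧} {λ d → ⟦ fits d (just y) (x ∷ A) ⟧})))))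

allowed-elem : ∀ x {w w'} r → elem x w ≡ elem x w' → allowed x w r ≡ allowed x w' r
allowed-elem x r e rewrite e = refl

-- A shuffle starts with the head of A or of B, matching the two summands of `conv-merge′`. The test
-- `allowed` is the same for the shuffle as for A or B alone: odd letters ignore what follows, and
-- an even letter recurs in the shuffle exactly if it recurs in B.
∑-shuf-fits : ∀ m ℓ {A B} → All Odd A → All Even B →
  ∑ (shuf A B) (λ w → ⟦ fits m ℓ w ⟧) ≡ conv m (λ c d → ⟦ fits c ℓ A ⟧ *ℤ ⟦ fits d ℓ B ⟧)
∑-shuf-fits m ℓ {[]}    {B}  oA eB = trans (+-idʳ _) (sym (conv-[]ˡ m ℓ {λ d → ⟦ fits d ℓ B ⟧}))
∑-shuf-fits m ℓ {x ∷ A} {[]} oA eB = trans (+-idʳ _)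
  (sym (trans (conv-sym m {λ c → ⟦ fits c ℓ (x ∷ A) ⟧} {λ d → ⟦ fits d ℓ [] ⟧}) (conv-[]ˡ m ℓ {λ d → ⟦ fits d ℓ (x ∷ A) ⟧})))
∑-shuf-fits [] ℓ {x ∷ A} {y ∷ B} oA eB = trans (∑-++ (map (x ∷_) (shuf A (y ∷ B))) _)
  (trans (cong₂ _+ℤ_ (trans (∑-map (x ∷_) (shuf A (y ∷ B))) (∑-zero (shuf A (y ∷ B))))
                     (trans (∑-map (y ∷_) (shuf (x ∷ A) B)) (∑-zero (shuf (x ∷ A) B))))
    (trans (+-idˡ 0ℤ) (sym (*-0ˡ 0ℤ))))
∑-shuf-fits (zero ∷ m)  ℓ {x ∷ A} {y ∷ B} oA eB = ∑-shuf-fits m nothing oA eB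
∑-shuf-fits (suc j ∷ m) ℓ {x ∷ A} {y ∷ B} (ox ∷ oA) (ey ∷ eB) = begin
  ∑ (map (x ∷_) (shuf A (y ∷ B)) ++ map (y ∷_) (shuf (x ∷ A) B)) (λ w → ⟦ fits (suc j ∷ m) ℓ w ⟧)
    ≡⟨ trans (∑-++ (map (x ∷_) (shuf A (y ∷ B))) _) (cong₂ _+ℤ_ (∑-map (x ∷_) (shuf A (y ∷ B))) (∑-map (y ∷_) (shuf (x ∷ A) B))) ⟩
  ∑ (shuf A (y ∷ B)) (λ w → ⟦ fits (suc j ∷ m) ℓ (x ∷ w) ⟧) +ℤ ∑ (shuf (x ∷ A) B) (λ w → ⟦ fits (suc j ∷ m) ℓ (y ∷ w) ⟧)
    ≡⟨ cong₂ _+ℤ_ (peel x A (shuf A (y ∷ B)) (All.universal (λ w → trans (allowed-odd x w r ox) (sym (allowed-odd x A r ox))) _))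
                  (peel y B (shuf (x ∷ A) B) (All.map (λ {w} e → allowed-elem y {w} {B} r
                     (trans e (cong (_∨ elem y B) (elem-even-odds ey (ox ∷ oA))))) (elem-shuf y (x ∷ A) B))) ⟩
  step ℓ x A r *ℤ ∑ (shuf A (y ∷ B)) (λ w → ⟦ fits (j ∷ m) (just x) w ⟧) +ℤ
  step ℓ y B r *ℤ ∑ (shuf (x ∷ A) B) (λ w → ⟦ fits (j ∷ m) (just y) w ⟧)
    ≡⟨ cong₂ (λ a b → step ℓ x A r *ℤ a +ℤ step ℓ y B r *ℤ b)
         (∑-shuf-fits (j ∷ m) (just x) oA (ey ∷ eB)) (∑-shuf-fits (j ∷ m) (just y) (ox ∷ oA) eB) ⟩
  _
    ≡⟨ conv-merge′ (odd≢even ox ey) j m ℓ A B ⟨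
  conv (suc j ∷ m) (λ c d → ⟦ fits c ℓ (x ∷ A) ⟧ *ℤ ⟦ fits d ℓ (y ∷ B) ⟧) ∎
  where
  open ≡-Reasoning
  r = length m
  peel : ∀ z v ws → All (λ w → allowed z w r ≡ allowed z v r) ws →
    ∑ ws (λ w → ⟦ fits (suc j ∷ m) ℓ (z ∷ w) ⟧) ≡ step ℓ z v r *ℤ ∑ ws (λ w → ⟦ fits (j ∷ m) (just z) w ⟧)
  peel z v ws same = trans
    (∑-cong-All same (λ w e → trans (⟦fits-∷⟧ j m ℓ z w) (cong (λ b → ⟦ ℓ ≤?ᵇ z ⟧ *ℤ ⟦ b ⟧ *ℤ ⟦ fits (j ∷ m) (just z) w ⟧) e)))
    (∑-*ˡ (step ℓ z v r) ws)

-- Runs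

erase : Word → List ℕ
erase []            = []
erase (nothing ∷ d) = erase d
erase (just x ∷ d)  = x ∷ erase d

Sorted : Maybe ℕ → List ℕ → Set
Sorted ℓ []      = ⊤
Sorted ℓ (x ∷ r) = (ℓ ≤?ᵇ x) ≡ true × Sorted (just x) r

attach-shape : ∀ y d rs → ∃ λ r → ∃ λ rs' → attach y d rs ≡ (y ∷ r) ∷ rs'
attach-shape y []             rs       = [] , rs , refl
attach-shape y (nothing ∷ d)  rs       = [] , rs , refl
attach-shape y (just z ∷ d)   []       = [] , [] , refl
attach-shape y (just z ∷ d)   (r ∷ rs) with y ≤ᵇ z
... | true  = r , rs , refl
... | false = [] , r ∷ rs , refl

concat-runs : ∀ d → concat (runs d) ≡ erase d
concat-runs []                      = refl
concat-runs (nothing ∷ d)           = concat-runs d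
concat-runs (just x ∷ [])           = refl
concat-runs (just x ∷ nothing ∷ d)  = cong (x ∷_) (concat-runs (nothing ∷ d))
concat-runs (just x ∷ just y ∷ d) with attach y d (runs d) | attach-shape y d (runs d) | concat-runs (just y ∷ d)
... | _ | r , rs , refl | e with x ≤ᵇ y
...   | true  = cong (x ∷_) e
...   | false = cong (x ∷_) e

runs-Sorted : ∀ d → All (Sorted nothing) (runs d)
runs-Sorted []                     = []
runs-Sorted (nothing ∷ d)          = _ ∷ runs-Sorted d
runs-Sorted (just x ∷ [])          = (refl , _) ∷ []
runs-Sorted (just x ∷ nothing ∷ d) = (refl , _) ∷ runs-Sorted (nothing ∷ d)
runs-Sorted (just x ∷ just y ∷ d) with attach y d (runs d) | attach-shape y d (runs d) | runs-Sorted (just y ∷ d)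
... | _ | r , rs , refl | s ∷ ss with x ≤ᵇ y in e
...   | true  = (refl , e , proj₂ s) ∷ ss
...   | false = (refl , _) ∷ s ∷ ss

allowedAll : List ℕ → List ℕ → ℕ → Bool
allowedAll []      v q = true
allowedAll (x ∷ r) v q = allowed x (r ++ v) q ∧ allowedAll r v q

fits-block : ∀ r ℓ v m → Sorted ℓ r → fits (length r ∷ m) ℓ (r ++ v) ≡ allowedAll r v (length m) ∧ fits m nothing v
fits-block []      ℓ v m s = refl
fits-block (x ∷ r) ℓ v m (e , s) rewrite e =
  trans (cong (allowed x (r ++ v) (length m) ∧_) (fits-block r (just x) v m s)) (sym (∧-assoc (allowed x (r ++ v) (length m)) _ _))

Sorted-weaken : ∀ ℓ {x} r → (ℓ ≤?ᵇ x) ≡ true → Sorted (just x) r → Sorted ℓ r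
Sorted-weaken ℓ []      e s        = _
Sorted-weaken ℓ (y ∷ r) e (e' , s) = ≤?ᵇ-trans ℓ e (≤ᵇ-sound e') , s

Sorted-filterB : ∀ p ℓ r → Sorted ℓ r → Sorted ℓ (filterB p r)
Sorted-filterB p ℓ []      s = _
Sorted-filterB p ℓ (x ∷ r) (e , s) with p x
... | true  = e , Sorted-filterB p (just x) r s
... | false = Sorted-weaken ℓ (filterB p r) e (Sorted-filterB p (just x) r s)

evenᵇ : ℕ → Bool
evenᵇ k = not (isOdd k)

odds evens : List ℕ → List ℕ
odds  = filterB isOdd
evens = filterB evenᵇ

elem-evens : ∀ x w → Even x → elem x (evens w) ≡ elem x w
elem-evens x []      ex = refl
elem-evens x (y ∷ w) ex with isOdd y in oy
... | false = cong ((x ≡ᵇ y) ∨_) (elem-evens x w ex)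
... | true rewrite ≡ᵇ-false {x} {y} (λ e → odd≢even oy ex (sym e)) = elem-evens x w ex

filterB-accept : ∀ {A : Set} (p : A → Bool) x xs → p x ≡ true → filterB p (x ∷ xs) ≡ x ∷ filterB p xs
filterB-accept p x xs e rewrite e = refl

filterB-reject : ∀ {A : Set} (p : A → Bool) x xs → p x ≡ false → filterB p (x ∷ xs) ≡ filterB p xs
filterB-reject p x xs e rewrite e = refl

-- Deleting the letters of the other parity changes no test: for odd letters the remaining word is
-- irrelevant, for even ones only equal, hence even, letters matter.
allowedAll-parity : ∀ r v q → allowedAll (odds r) (odds v) q ∧ allowedAll (evens r) (evens v) q ≡ allowedAll r v q
allowedAll-parity []      v q = refl
allowedAll-parity (x ∷ r) v q = by-parity (isOdd x) refl
  where
  by-parity : ∀ b → isOdd x ≡ b →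
    allowedAll (odds (x ∷ r)) (odds v) q ∧ allowedAll (evens (x ∷ r)) (evens v) q ≡ allowedAll (x ∷ r) v q
  by-parity true ox = trans
    (cong₂ (λ a c → allowedAll a (odds v) q ∧ allowedAll c (evens v) q) (filterB-accept isOdd x r ox) (filterB-reject evenᵇ x r (cong not ox)))
    (trans (∧-assoc (allowed x (odds r ++ odds v) q) _ _)
      (cong₂ _∧_ (trans (allowed-odd x (odds r ++ odds v) q ox) (sym (allowed-odd x (r ++ v) q ox))) (allowedAll-parity r v q)))
  by-parity false ex = trans
    (cong₂ (λ a c → allowedAll a (odds v) q ∧ allowedAll c (evens v) q) (filterB-reject isOdd x r ex) (filterB-accept evenᵇ x r (cong not ex)))
    (trans (∧-swap (allowedAll (odds r) (odds v) q) (allowed x (evens r ++ evens v) q) _)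
      (cong₂ _∧_ (allowed-elem x {evens r ++ evens v} {r ++ v} q (trans (cong (elem x) (sym (filterB-++ evenᵇ r v))) (elem-evens x (r ++ v) ex)))
        (allowedAll-parity r v q)))

∧-interchange : ∀ a b c d → (a ∧ b) ∧ (c ∧ d) ≡ (a ∧ c) ∧ (b ∧ d)
∧-interchange true  b c d = ∧-swap b c d
∧-interchange false b c d = refl

fits-filter-block : ∀ p r ℓ v m → Sorted ℓ r →
  fits (count p r ∷ m) ℓ (filterB p (r ++ v)) ≡ allowedAll (filterB p r) (filterB p v) (length m) ∧ fits m nothing (filterB p v)
fits-filter-block p r ℓ v m s = trans (cong (fits (count p r ∷ m) ℓ) (filterB-++ p r v))
  (fits-block (filterB p r) ℓ (filterB p v) m (Sorted-filterB p ℓ r s))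

-- Runs and their subwords are sorted, so for blocks that are runs the order conditions hold
-- automatically and only the tests of single letters have to be distributed.
fits-parity : ∀ {rs} → All (Sorted nothing) rs →
  fits (map (count isOdd) rs) nothing (odds (concat rs)) ∧ fits (map (count evenᵇ) rs) nothing (evens (concat rs)) ≡
  fits (map length rs) nothing (concat rs)
fits-parity []               = refl
fits-parity (_∷_ {r} {rs} s ss) = begin
  fits (count isOdd r ∷ map (count isOdd) rs) nothing (odds (r ++ v)) ∧ fits (count evenᵇ r ∷ map (count evenᵇ) rs) nothing (evens (r ++ v))
    ≡⟨ cong₂ _∧_ (fits-filter-block isOdd r nothing v (map (count isOdd) rs) s) (fits-filter-block evenᵇ r nothing v (map (count evenᵇ) rs) s) ⟩
  (allowedAll (odds r) (odds v) (length (map (count isOdd) rs)) ∧ fits (map (count isOdd) rs) nothing (odds v)) ∧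
  (allowedAll (evens r) (evens v) (length (map (count evenᵇ) rs)) ∧ fits (map (count evenᵇ) rs) nothing (evens v))
    ≡⟨ cong₂ (λ a b → (allowedAll (odds r) (odds v) a ∧ fits (map (count isOdd) rs) nothing (odds v)) ∧ (allowedAll (evens r) (evens v) b ∧ fits (map (count evenᵇ) rs) nothing (evens v)))
         (length-map (count isOdd) rs) (length-map (count evenᵇ) rs) ⟩
  (allowedAll (odds r) (odds v) q ∧ fits (map (count isOdd) rs) nothing (odds v)) ∧
  (allowedAll (evens r) (evens v) q ∧ fits (map (count evenᵇ) rs) nothing (evens v))
    ≡⟨ ∧-interchange (allowedAll (odds r) (odds v) q) _ (allowedAll (evens r) (evens v) q) _ ⟩
  (allowedAll (odds r) (odds v) q ∧ allowedAll (evens r) (evens v) q) ∧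
  (fits (map (count isOdd) rs) nothing (odds v) ∧ fits (map (count evenᵇ) rs) nothing (evens v))
    ≡⟨ cong₂ _∧_ (allowedAll-parity r v q) (fits-parity ss) ⟩
  allowedAll r v q ∧ fits (map length rs) nothing v
    ≡⟨ cong (λ a → allowedAll r v a ∧ fits (map length rs) nothing v) (length-map length rs) ⟨
  allowedAll r v (length (map length rs)) ∧ fits (map length rs) nothing v
    ≡⟨ fits-block r nothing v (map length rs) s ⟨
  fits (length r ∷ map length rs) nothing (r ++ v) ∎
  where
  open ≡-Reasoning
  v = concat rs
  q = length rs

fits-Des : ∀ d → fits (DesA d) nothing (odds (erase d)) ∧ fits (DesB d) nothing (evens (erase d)) ≡ fits (Des d) nothing (erase d)
fits-Des d = subst
  (λ w → fits (DesA d) nothing (odds w) ∧ fits (DesB d) nothing (evens w) ≡ fits (Des d) nothing w)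
  (concat-runs d) (fits-parity (runs-Sorted d))

-- Placing the runs of a word

incFirst : List ℕ → List ℕ
incFirst []          = []
incFirst (zero  ∷ d) = 0 ∷ incFirst d
incFirst (suc a ∷ d) = 2 + a ∷ d

-- place w n lists the ways to put the runs of w, in order, into n positions;
-- startRun x w n those for x ∷ w and n + 1 in which the first run comes first.
mutual
  place : List ℕ → ℕ → List (List ℕ)
  place []      n       = replicate n 0 ∷ []
  place (x ∷ w) zero    = []
  place (x ∷ w) (suc n) = map (0 ∷_) (place (x ∷ w) n) ++ startRun x w n

  startRun : ℕ → List ℕ → ℕ → List (List ℕ)
  startRun x []      n = (1 ∷ replicate n 0) ∷ []
  startRun x (y ∷ w) n = if x ≤ᵇ y then map incFirst (startRun y w n) else map (1 ∷_) (place (y ∷ w) n)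

stars : ℕ → Word
stars k = replicate k nothing

∑starred : List ℕ → ℕ → (Word → ℤ) → ℤ
∑starred w K h = ∑ (upTo (suc K)) (λ k → ∑ (shuffle (map just w) (stars k)) h)

∑starred-cong : ∀ w K {g h} → (∀ d → g d ≡ h d) → ∑starred w K g ≡ ∑starred w K h
∑starred-cong w K e = ∑-cong (upTo (suc K)) (λ k → ∑-cong (shuffle (map just w) (stars k)) e)

∑starred-vanish : ∀ w K {h} → (∀ d → h d ≡ 0ℤ) → ∑starred w K h ≡ 0ℤ
∑starred-vanish w K e = ∑-vanish (upTo (suc K)) (λ k → ∑-vanish (shuffle (map just w) (stars k)) e)

shuffle-[] : ∀ w → shuffle w [] ≡ w ∷ []
shuffle-[] []      = refl
shuffle-[] (x ∷ w) = refl

∑starred-zero : ∀ x w {h} → ∑starred (x ∷ w) 0 h ≡ ∑starred w 0 (h ∘ (just x ∷_))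
∑starred-zero x w {h} = cong (_+ℤ 0ℤ) (cong (λ l → ∑ l (h ∘ (just x ∷_))) (sym (shuffle-[] (map just w))))

∑starred-suc : ∀ x w K {h} →
  ∑starred (x ∷ w) (suc K) h ≡ ∑starred w (suc K) (h ∘ (just x ∷_)) +ℤ ∑starred (x ∷ w) K (h ∘ (nothing ∷_))
∑starred-suc x w K {h} = begin
  ∑ (upTo (2 + K)) (λ k → ∑ (shuffle (map just (x ∷ w)) (stars k)) h)
    ≡⟨ ∑-upTo-suc (suc K) ⟩
  ∑ (shuffle (map just (x ∷ w)) []) h +ℤ ∑ (upTo (suc K)) (λ k → ∑ (shuffle (map just (x ∷ w)) (stars (suc k))) h)
    ≡⟨ cong₂ _+ℤ_ (cong (λ l → ∑ l (h ∘ (just x ∷_))) (sym (shuffle-[] (map just w))))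
         (trans (∑-cong (upTo (suc K)) (λ k → trans (∑-++ (map (just x ∷_) (shuffle (map just w) (stars (suc k)))) _)
           (cong₂ _+ℤ_ (∑-map (just x ∷_) (shuffle (map just w) (stars (suc k))))
                       (∑-map (nothing ∷_) (shuffle (map just (x ∷ w)) (stars k))))))
           (∑-+ (upTo (suc K)))) ⟩
  ∑ (shuffle (map just w) []) (h ∘ (just x ∷_)) +ℤ
  (∑ (upTo (suc K)) (λ k → ∑ (shuffle (map just w) (stars (suc k))) (h ∘ (just x ∷_))) +ℤ ∑starred (x ∷ w) K (h ∘ (nothing ∷_)))
    ≡⟨ +ℤ-assoc (∑ (shuffle (map just w) []) (h ∘ (just x ∷_))) _ _ ⟨
  ∑ (shuffle (map just w) []) (h ∘ (just x ∷_)) +ℤ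
  ∑ (upTo (suc K)) (λ k → ∑ (shuffle (map just w) (stars (suc k))) (h ∘ (just x ∷_))) +ℤ ∑starred (x ∷ w) K (h ∘ (nothing ∷_))
    ≡⟨ cong (_+ℤ ∑starred (x ∷ w) K (h ∘ (nothing ∷_))) (sym (∑-upTo-suc (suc K))) ⟩
  ∑starred w (suc K) (h ∘ (just x ∷_)) +ℤ ∑starred (x ∷ w) K (h ∘ (nothing ∷_)) ∎
  where open ≡-Reasoning

-- The first letter after the inserted stars is y, whatever their number.
∑starred-cong-afterStars : ∀ x y w K {g h} → (∀ d → afterStars x d ≡ (y <ᵇ x) → g d ≡ h d) →
  ∑starred (y ∷ w) K g ≡ ∑starred (y ∷ w) K h
∑starred-cong-afterStars x y w zero    {g} {h} e = trans (∑starred-zero y w {g})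
  (trans (∑starred-cong w 0 (λ d → e (just y ∷ d) refl)) (sym (∑starred-zero y w {h})))
∑starred-cong-afterStars x y w (suc K) {g} {h} e = trans (∑starred-suc y w K {g})
  (trans (cong₂ _+ℤ_ (∑starred-cong w (suc K) (λ d → e (just y ∷ d) refl))
                     (∑starred-cong-afterStars x y w K (λ d → e (nothing ∷ d))))
    (sym (∑starred-suc y w K {h})))

-- Only these two conditions of `inQSSet` concern the arrangement of stars; the others become a
-- condition on `Des d` and the word without stars, to be absorbed in F.
placed : ℕ → (List ℕ → ℤ) → Word → ℤ
placed n F d = ⟦ (length (runs d) ≡ᵇ n) ∧ starOK d ⟧ *ℤ F (Des d)

placed-zero : ∀ F x d → placed 0 F (just x ∷ d) ≡ 0ℤ
placed-zero F x d with attach x d (runs d) | attach-shape x d (runs d)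
... | _ | r , rs , refl = *-0ˡ (F (map length ((x ∷ r) ∷ rs)))

placed-new-run : ∀ n F x d → afterStars x d ≡ true → placed (suc n) F (just x ∷ d) ≡ placed n (F ∘ (1 ∷_)) d
placed-new-run n F x []            e = refl
placed-new-run n F x (nothing ∷ d) e rewrite e = refl
placed-new-run n F x (just y ∷ d)  e with attach y d (runs d) | attach-shape y d (runs d)
... | _ | r , rs , refl rewrite ≤ᵇ-false {x} {y} (<ᵇ-sound e) = refl

placed-same-run : ∀ n F x y d → x ≤ y → placed (suc n) F (just x ∷ just y ∷ d) ≡ placed (suc n) (F ∘ incFirst) (just y ∷ d)
placed-same-run n F x y d le with attach y d (runs d) | attach-shape y d (runs d)
... | _ | r , rs , refl rewrite ≤ᵇ-true le = refl

placed-bad-star : ∀ n F x d → afterStars x d ≡ false → placed n F (just x ∷ nothing ∷ d) ≡ 0ℤ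
placed-bad-star n F x d e rewrite e =
  trans (cong (λ b → ⟦ b ⟧ *ℤ F (1 ∷ 0 ∷ Des d)) (∧-zeroʳ (suc (suc (length (runs d))) ≡ᵇ n))) (*-0ˡ _)

runs-stars : ∀ k → length (runs (stars k)) ≡ k
runs-stars zero    = refl
runs-stars (suc k) = cong suc (runs-stars k)

Des-stars : ∀ k → Des (stars k) ≡ replicate k 0
Des-stars zero    = refl
Des-stars (suc k) = cong (0 ∷_) (Des-stars k)

starOK-stars : ∀ k → starOK (stars k) ≡ true
starOK-stars zero    = refl
starOK-stars (suc k) = starOK-stars k

mutual
  -- The bound K on the number of stars is kept apart from n: a star lowers both, whereas a nonempty
  -- run uses up one of the n runs but no star.
  ∑-placed : ∀ w n K → n ≤ K → ∀ F → ∑starred w K (placed n F) ≡ ∑ (place w n) F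
  ∑-placed [] n K le F = begin
    ∑ (upTo (suc K)) (λ k → placed n F (stars k) +ℤ 0ℤ)
      ≡⟨ ∑-cong (upTo (suc K)) (λ k → trans (+-idʳ _) (cong₂ _*ℤ_
           (cong ⟦_⟧ (trans (cong₂ (λ l b → (l ≡ᵇ n) ∧ b) (runs-stars k) (starOK-stars k)) (∧-identityʳ (k ≡ᵇ n))))
           (cong F (Des-stars k)))) ⟩
    ∑ (upTo (suc K)) (λ k → ⟦ k ≡ᵇ n ⟧ *ℤ F (replicate k 0))
      ≡⟨ ∑-upTo-point (suc K) n ⟩
    ⟦ n <ᵇ suc K ⟧ *ℤ F (replicate n 0)
      ≡⟨ cong (λ b → ⟦ b ⟧ *ℤ F (replicate n 0)) (<ᵇ-true (s≤s le)) ⟩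
    1ℤ *ℤ F (replicate n 0)
      ≡⟨ *-idˡ _ ⟩
    F (replicate n 0)
      ≡⟨ +-idʳ _ ⟨
    F (replicate n 0) +ℤ 0ℤ ∎
    where open ≡-Reasoning
  ∑-placed (x ∷ w) zero zero le F = trans (∑starred-zero x w {placed 0 F}) (∑starred-vanish w 0 (placed-zero F x))
  ∑-placed (x ∷ w) zero (suc K) le F = trans (∑starred-suc x w K {placed 0 F})
    (trans (cong₂ _+ℤ_ (∑starred-vanish w (suc K) (placed-zero F x))
                       (∑starred-vanish (x ∷ w) K (λ d → *-0ˡ (F (Des (nothing ∷ d))))))
           (+-idˡ 0ℤ))
  ∑-placed (x ∷ w) (suc n) (suc K) (s≤s le) F = begin
    ∑starred (x ∷ w) (suc K) (placed (suc n) F)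
      ≡⟨ ∑starred-suc x w K ⟩
    ∑starred w (suc K) (placed (suc n) F ∘ (just x ∷_)) +ℤ ∑starred (x ∷ w) K (placed n (F ∘ (0 ∷_)))
      ≡⟨ cong₂ _+ℤ_ (∑-startRun x w n (suc K) (m≤n⇒m≤1+n le) F) (∑-placed (x ∷ w) n K le (F ∘ (0 ∷_))) ⟩
    ∑ (startRun x w n) F +ℤ ∑ (place (x ∷ w) n) (F ∘ (0 ∷_))
      ≡⟨ +ℤ-comm (∑ (startRun x w n) F) _ ⟩
    ∑ (place (x ∷ w) n) (F ∘ (0 ∷_)) +ℤ ∑ (startRun x w n) F
      ≡⟨ cong (_+ℤ ∑ (startRun x w n) F) (∑-map (0 ∷_) (place (x ∷ w) n)) ⟨
    ∑ (map (0 ∷_) (place (x ∷ w) n)) F +ℤ ∑ (startRun x w n) F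
      ≡⟨ ∑-++ (map (0 ∷_) (place (x ∷ w) n)) _ ⟨
    ∑ (place (x ∷ w) (suc n)) F ∎
    where open ≡-Reasoning

  -- After x, a smaller y starts a new run and any number of stars may intervene. If x ≤ y, a star
  -- between them would violate `starOK`, so y follows at once and joins the run.
  ∑-startRun : ∀ x w n K → n ≤ K → ∀ F → ∑starred w K (placed (suc n) F ∘ (just x ∷_)) ≡ ∑ (startRun x w n) F
  ∑-startRun x [] n K le F = trans
    (∑-cong (upTo (suc K)) (λ k → cong (_+ℤ 0ℤ) (placed-new-run n F x (stars k) (afterStars-stars k))))
    (∑-placed [] n K le (F ∘ (1 ∷_)))
    where
    afterStars-stars : ∀ k → afterStars x (stars k) ≡ true
    afterStars-stars zero    = refl
    afterStars-stars (suc k) = afterStars-stars k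
  ∑-startRun x (y ∷ w) n K le F with x ≤? y
  ... | no  x≰y rewrite ≤ᵇ-false (≰⇒> x≰y) = trans
    (∑starred-cong-afterStars x y w K (λ d e → placed-new-run n F x d (trans e (<ᵇ-true (≰⇒> x≰y)))))
    (trans (∑-placed (y ∷ w) n K le (F ∘ (1 ∷_))) (sym (∑-map (1 ∷_) (place (y ∷ w) n))))
  ... | yes x≤y rewrite ≤ᵇ-true x≤y = trans (same K)
    (trans (∑-startRun y w n K le (F ∘ incFirst)) (sym (∑-map incFirst (startRun y w n))))
    where
    same : ∀ K → ∑starred (y ∷ w) K (placed (suc n) F ∘ (just x ∷_)) ≡ ∑starred w K (placed (suc n) (F ∘ incFirst) ∘ (just y ∷_))
    same zero    = trans (∑starred-zero y w {placed (suc n) F ∘ (just x ∷_)})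
      (∑starred-cong w 0 (λ d → placed-same-run n F x y d x≤y))
    same (suc K) = trans (∑starred-suc y w K {placed (suc n) F ∘ (just x ∷_)})
      (trans (cong₂ _+ℤ_ (∑starred-cong w (suc K) (λ d → placed-same-run n F x y d x≤y))
        (trans (∑starred-cong-afterStars x y w K {h = λ _ → 0ℤ} (λ d e → placed-bad-star (suc n) F x d (trans e (<ᵇ-false x≤y))))
               (∑starred-vanish (y ∷ w) K (λ _ → refl))))
        (+-idʳ _))

-- Atoms of placed runs

Head : ℕ → List ℕ → Set
Head n []          = ⊥
Head n (zero  ∷ d) = ⊥
Head n (suc a ∷ d) = length d ≡ n

Placed : ℕ → List ℕ → Set
Placed n d = 1 ≤ first d × length d ≡ n

Head⇒Placed : ∀ {n} d → Head n d → Placed (suc n) d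
Head⇒Placed (suc a ∷ d) l = s≤s z≤n , cong suc l

Head-incFirst : ∀ {n} d → Head n d → Head n (incFirst d)
Head-incFirst (suc a ∷ d) l = l

startRun-Head : ∀ x w n → All (Head n) (startRun x w n)
place-length : ∀ w n → All (λ d → length d ≡ n) (place w n)
place-Placed : ∀ x w n → All (Placed n) (place (x ∷ w) n)

startRun-Head x []      n = length-replicate n ∷ []
startRun-Head x (y ∷ w) n with x ≤ᵇ y
... | true  = All.map⁺ (All.map (λ {d} → Head-incFirst d) (startRun-Head y w n))
... | false = All.map⁺ (place-length (y ∷ w) n)

place-length []      n = length-replicate n ∷ []
place-length (x ∷ w) n = All.map proj₂ (place-Placed x w n)

place-Placed x w zero    = []
place-Placed x w (suc n) = All.++⁺
  (All.map⁺ (All.map (λ p → proj₁ p , cong suc (proj₂ p)) (place-Placed x w n)))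
  (All.map (λ {d} → Head⇒Placed d) (startRun-Head x w n))

StartsNewRun : ℕ → List ℕ → Set
StartsNewRun x []      = ⊤
StartsNewRun x (y ∷ w) = y < x

startRun-one : ∀ x w n → StartsNewRun x w → All (λ d → first d ≡ 1) (startRun x w n)
startRun-one x []      n s = refl ∷ []
startRun-one x (y ∷ w) n s rewrite ≤ᵇ-false s = All.map⁺ (All.universal (λ d → refl) (place (y ∷ w) n))

place-one : ∀ x w n → StartsNewRun x w → All (λ d → first d ≡ 1) (place (x ∷ w) n)
place-one x w zero    s = []
place-one x w (suc n) s = All.++⁺ (All.map⁺ (place-one x w n s)) (startRun-one x w n s)

-- The letter x belongs to the run of y, so it has no freedom of its own.
place-incFirst : ∀ {x y} w n → x ≤ y → place (x ∷ y ∷ w) n ≡ map incFirst (place (y ∷ w) n)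
place-incFirst         w zero    le = refl
place-incFirst {x} {y} w (suc n) le rewrite ≤ᵇ-true le | place-incFirst w n le = begin
  map (0 ∷_) (map incFirst (place (y ∷ w) n)) ++ map incFirst (startRun y w n)
    ≡⟨ cong (_++ map incFirst (startRun y w n)) (trans (sym (map-∘ (place (y ∷ w) n))) (map-∘ (place (y ∷ w) n))) ⟩
  map incFirst (map (0 ∷_) (place (y ∷ w) n)) ++ map incFirst (startRun y w n)
    ≡⟨ map-++ incFirst (map (0 ∷_) (place (y ∷ w) n)) (startRun y w n) ⟨
  map incFirst (map (0 ∷_) (place (y ∷ w) n) ++ startRun y w n) ∎
  where open ≡-Reasoning

-- This is the argument with which `fits` tests the letters of the first nonempty run; 0 is a
-- default for vectors without one.
posAfter : List ℕ → ℕ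
posAfter []          = 0
posAfter (zero  ∷ d) = posAfter d
posAfter (suc a ∷ d) = length d

posAfter-< : ∀ d → 1 ≤ first d → posAfter d < length d
posAfter-< (zero  ∷ d) p = m<n⇒m<1+n (posAfter-< d p)
posAfter-< (suc a ∷ d) p = n<1+n (length d)

fits-incFirst : ∀ d {x y} w → 1 ≤ first d → x ≤ y →
  fits (incFirst d) nothing (x ∷ y ∷ w) ≡ allowed x (y ∷ w) (posAfter d) ∧ fits d nothing (y ∷ w)
fits-incFirst (zero  ∷ d)         w p le = fits-incFirst d w p le
fits-incFirst (suc a ∷ d) {x} {y} w p le =
  cong (allowed x (y ∷ w) (length d) ∧_) (sym (fits-raise (suc a ∷ d) nothing w refl le))

fits⇒allowed : ∀ d y w → 1 ≤ first d → fits d nothing (y ∷ w) ≡ true → allowed y w (posAfter d) ≡ true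
fits⇒allowed (zero  ∷ d) y w p e = fits⇒allowed d y w p e
fits⇒allowed (suc a ∷ d) y w p e = proj₁ (∧-elim e)

first-incFirst : ∀ d → 1 ≤ first d → first (incFirst d) ≡ suc (first d)
first-incFirst (zero  ∷ d) p = first-incFirst d p
first-incFirst (suc a ∷ d) p = refl

dec-incFirst : ∀ j d → 1 ≤ first d → dec (suc j) (incFirst d) ≡ dec j d
dec-incFirst j (zero  ∷ d) p = cong (0 ∷_) (dec-incFirst j d p)
dec-incFirst j (suc a ∷ d) p = refl

⌈even/2⌉-< : ∀ {x y} → Even x → x < y → ⌈ x /2⌉ < ⌈ y /2⌉
⌈even/2⌉-< {zero}        {suc y}       e lt = s≤s z≤n
⌈even/2⌉-< {suc (suc x)} {suc (suc y)} e (s≤s (s≤s lt)) = s≤s (⌈even/2⌉-< e lt)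

-- If x is the last copy of an even letter then x < y, so that already the position
-- with q others after it, where y may stand, is too far left for x.
allowed-move : ∀ {x y} w w' q r → x ≤ y → q < r → allowed y w' q ≡ true → allowed x (y ∷ w) q ≡ allowed x (y ∷ w) r
allowed-move {x} {y} w w' q r x≤y q<r ok with isOdd x in parity | x ≡ᵇ y in same | elem x w
... | true  | _     | _     = trans (≤ᵇ-true early) (sym (≤ᵇ-true (≤-trans early (s≤s (<⇒≤ q<r)))))
  where early = ≤-trans (⌈n/2⌉-mono x≤y) (allowed⇒≤ y w' q ok)
... | false | true  | _     = trans (≤ᵇ-true early) (sym (≤ᵇ-true (≤-trans early (s≤s (<⇒≤ q<r)))))
  where early = ≤-trans (⌈n/2⌉-mono x≤y) (allowed⇒≤ y w' q ok)
... | false | false | true  = trans (≤ᵇ-true early) (sym (≤ᵇ-true (≤-trans early (s≤s (<⇒≤ q<r)))))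
  where early = ≤-trans (⌈n/2⌉-mono x≤y) (allowed⇒≤ y w' q ok)
... | false | false | false = trans (≡ᵇ-false (<⇒≢ early)) (sym (≡ᵇ-false (<⇒≢ (<-trans early (s≤s q<r)))))
  where
  x≢y : ¬ x ≡ y
  x≢y e with trans (sym same) (≡ᵇ-true e)
  ... | ()
  early = <-≤-trans (⌈even/2⌉-< parity (≤∧≢⇒< x≤y x≢y)) (allowed⇒≤ y w' q ok)

weight : List ℕ → List ℕ → Bool → ℤ
weight w d b = ⟦ fits d nothing w ⟧ *ℤ ⟦ b ⟧

-- Existence and uniqueness of D for a fixed word w: the sum counts the placements d of its runs
-- that satisfy the conditions of `qSSet` and have x^m in their atom.
PlacesAt : List ℕ → Set
PlacesAt m = ∀ w → ∑ (place w (length m)) (λ d → weight w d (atomB d m)) ≡ ⟦ fits m nothing w ⟧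

-- Here d places the word after x, whose first run contains x too, and j more letters go into the
-- current block. The bound is `suc j` because the run, lying further right, must keep its last
-- letter.
takes : ℕ → List ℕ → List ℕ → Bool
takes j m d = (suc j ≤ᵇ first d) ∧ atomB (dec j d) m

-- The placement tests x at the later position of its run, m at the current one with n positions
-- after it. By `allowed-move` the two tests agree whenever y is allowed at the later position,
-- which `fits e` guarantees.
weight-incFirst : ∀ {x y n} w e b → x ≤ y → Placed n e →
  weight (x ∷ y ∷ w) (incFirst e) b ≡ ⟦ allowed x (y ∷ w) n ⟧ *ℤ weight (y ∷ w) e b
weight-incFirst {x} {y} {n} w e b x≤y (p , l) = begin
  ⟦ fits (incFirst e) nothing (x ∷ y ∷ w) ⟧ *ℤ ⟦ b ⟧
    ≡⟨ cong (λ c → ⟦ c ⟧ *ℤ ⟦ b ⟧) (trans (fits-incFirst e w p x≤y) (∧-comm (allowed x (y ∷ w) (posAfter e)) _)) ⟩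
  ⟦ fits e nothing (y ∷ w) ∧ allowed x (y ∷ w) (posAfter e) ⟧ *ℤ ⟦ b ⟧
    ≡⟨ cong (λ c → ⟦ c ⟧ *ℤ ⟦ b ⟧) (trans
         (∧-cong-under (fits e nothing (y ∷ w)) (λ f → allowed-move w w (posAfter e) n x≤y (subst (posAfter e <_) l (posAfter-< e p)) (fits⇒allowed e y w p f)))
         (∧-comm (fits e nothing (y ∷ w)) _)) ⟩
  ⟦ allowed x (y ∷ w) n ∧ fits e nothing (y ∷ w) ⟧ *ℤ ⟦ b ⟧
    ≡⟨ trans (cong (_*ℤ ⟦ b ⟧) (⟦∧⟧ (allowed x (y ∷ w) n) _)) (*ℤ-assoc ⟦ allowed x (y ∷ w) n ⟧ _ _) ⟩
  ⟦ allowed x (y ∷ w) n ⟧ *ℤ weight (y ∷ w) e b ∎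
  where open ≡-Reasoning

weight-incFirst-Head : ∀ {x y n} w e m j → x ≤ y → Head n e →
  weight (x ∷ y ∷ w) (incFirst e) (atomB (incFirst e) (suc j ∷ m)) ≡
  ⟦ allowed x (y ∷ w) n ⟧ *ℤ weight (y ∷ w) e (atomB e (j ∷ m))
weight-incFirst-Head {x} {y} w (suc a ∷ e) m j x≤y refl =
  trans (cong (λ c → ⟦ c ⟧ *ℤ ⟦ atomB (suc a ∷ e) (j ∷ m) ⟧) (fits-incFirst (suc a ∷ e) w (s≤s z≤n) x≤y))
    (trans (cong (_*ℤ ⟦ atomB (suc a ∷ e) (j ∷ m) ⟧) (⟦∧⟧ (allowed x (y ∷ w) (length e)) _)) (*ℤ-assoc ⟦ allowed x (y ∷ w) (length e) ⟧ _ _))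

startRun-zero : ∀ x w n m → ∑ (startRun x w n) (λ d → weight (x ∷ w) d (atomB d (0 ∷ m))) ≡ 0ℤ
startRun-zero x w n m = trans (∑-cong-All (startRun-Head x w n) zero-weight) (∑-zero (startRun x w n))
  where
  zero-weight : ∀ d → Head n d → weight (x ∷ w) d (atomB d (0 ∷ m)) ≡ 0ℤ
  zero-weight (suc a ∷ d) h = *-0ʳ ⟦ fits (suc a ∷ d) nothing (x ∷ w) ⟧

-- The first block of m takes j + 1 letters of x ∷ w; either a later position of
-- the placement receives the run they belong to, or they are that run.
∑-first-block : ∀ m → PlacesAt m → ∀ x w j →
  ∑ (place (x ∷ w) (length m)) (λ d → weight (x ∷ w) d ((suc j ≤ᵇ first d ∸ 1) ∧ atomB (dec (suc j) d) m)) +ℤ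
  ∑ (startRun x w (length m)) (λ d → weight (x ∷ w) d (atomB d (suc j ∷ m))) ≡
  ⟦ allowed x w (length m) ⟧ *ℤ ⟦ fits (j ∷ m) (just x) w ⟧

-- A run consisting of x alone has no letter to spare: placed further right, it must keep its last
-- letter.
∑-first-block-new : ∀ m x w j → StartsNewRun x w →
  ∑ (place (x ∷ w) (length m)) (λ d → weight (x ∷ w) d ((suc j ≤ᵇ first d ∸ 1) ∧ atomB (dec (suc j) d) m)) ≡ 0ℤ
∑-first-block-new m x w j s = trans
  (∑-cong-All (place-one x w (length m) s)
    (λ d e → trans (cong (λ f → weight (x ∷ w) d ((suc j ≤ᵇ f ∸ 1) ∧ atomB (dec (suc j) d) m)) e) (*-0ʳ ⟦ fits d nothing (x ∷ w) ⟧)))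
  (∑-zero (place (x ∷ w) (length m)))

weight-one : ∀ {n} m x w j d → length d ≡ n →
  weight (x ∷ w) (1 ∷ d) (atomB (1 ∷ d) (suc j ∷ m)) ≡ ⟦ allowed x w n ⟧ *ℤ (⟦ j ≡ᵇ 0 ⟧ *ℤ weight w d (atomB d m))
weight-one m x w j d refl = begin
  ⟦ allowed x w n ∧ fits d nothing w ⟧ *ℤ ⟦ (j ≡ᵇ 0) ∧ atomB d m ⟧
    ≡⟨ cong₂ _*ℤ_ (⟦∧⟧ (allowed x w n) _) (⟦∧⟧ (j ≡ᵇ 0) _) ⟩
  ⟦ allowed x w n ⟧ *ℤ ⟦ fits d nothing w ⟧ *ℤ (⟦ j ≡ᵇ 0 ⟧ *ℤ ⟦ atomB d m ⟧)
    ≡⟨ *ℤ-interchange ⟦ allowed x w n ⟧ _ ⟦ j ≡ᵇ 0 ⟧ _ ⟩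
  ⟦ allowed x w n ⟧ *ℤ ⟦ j ≡ᵇ 0 ⟧ *ℤ (⟦ fits d nothing w ⟧ *ℤ ⟦ atomB d m ⟧)
    ≡⟨ *ℤ-assoc ⟦ allowed x w n ⟧ _ _ ⟩
  ⟦ allowed x w n ⟧ *ℤ (⟦ j ≡ᵇ 0 ⟧ *ℤ weight w d (atomB d m)) ∎
  where
  open ≡-Reasoning
  n = length d

fits-new-run : ∀ j m x w → StartsNewRun x w → ⟦ j ≡ᵇ 0 ⟧ *ℤ ⟦ fits m nothing w ⟧ ≡ ⟦ fits (j ∷ m) (just x) w ⟧
fits-new-run zero    m x w       s = *-idˡ _
fits-new-run (suc j) m x []      s = *-0ˡ ⟦ fits m nothing [] ⟧
fits-new-run (suc j) m x (y ∷ w) s rewrite ≤ᵇ-false s = *-0ˡ _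

-- With x as a complete run in the first position, the atom demands exactly one letter there, so j =
-- 0 and the hypothesis for m treats the remaining runs. In `fits` the same restriction comes from
-- the descent after x.
∑-new-run : ∀ m → PlacesAt m → ∀ x w j → StartsNewRun x w →
  ∑ (place w (length m)) (λ d → weight (x ∷ w) (1 ∷ d) (atomB (1 ∷ d) (suc j ∷ m))) ≡
  ⟦ allowed x w (length m) ⟧ *ℤ ⟦ fits (j ∷ m) (just x) w ⟧
∑-new-run m ih x w j s = begin
  ∑ (place w (length m)) (λ d → weight (x ∷ w) (1 ∷ d) (atomB (1 ∷ d) (suc j ∷ m)))
    ≡⟨ ∑-cong-All (place-length w (length m)) (λ d l → weight-one m x w j d l) ⟩
  ∑ (place w (length m)) (λ d → ⟦ allowed x w (length m) ⟧ *ℤ (⟦ j ≡ᵇ 0 ⟧ *ℤ weight w d (atomB d m)))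
    ≡⟨ trans (∑-*ˡ ⟦ allowed x w (length m) ⟧ (place w (length m))) (cong (⟦ allowed x w (length m) ⟧ *ℤ_) (∑-*ˡ ⟦ j ≡ᵇ 0 ⟧ (place w (length m)))) ⟩
  ⟦ allowed x w (length m) ⟧ *ℤ (⟦ j ≡ᵇ 0 ⟧ *ℤ ∑ (place w (length m)) (λ d → weight w d (atomB d m)))
    ≡⟨ cong (λ z → ⟦ allowed x w (length m) ⟧ *ℤ (⟦ j ≡ᵇ 0 ⟧ *ℤ z)) (ih w) ⟩
  ⟦ allowed x w (length m) ⟧ *ℤ (⟦ j ≡ᵇ 0 ⟧ *ℤ ⟦ fits m nothing w ⟧)
    ≡⟨ cong (⟦ allowed x w (length m) ⟧ *ℤ_) (fits-new-run j m x w s) ⟩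
  ⟦ allowed x w (length m) ⟧ *ℤ ⟦ fits (j ∷ m) (just x) w ⟧ ∎
  where open ≡-Reasoning

-- For j = 0 the first block ends inside the run, which therefore lies further right, and the
-- hypothesis for m applies to y ∷ w. For j > 0 the letter y is in the block as well, and the claim
-- is `∑-first-block` one letter later.
∑-same-run : ∀ m → PlacesAt m → ∀ x y w j → x ≤ y →
  ∑ (place (y ∷ w) (length m)) (λ e → weight (y ∷ w) e (takes j m e)) +ℤ
  ∑ (startRun y w (length m)) (λ e → weight (y ∷ w) e (atomB e (j ∷ m))) ≡ ⟦ fits (j ∷ m) (just x) (y ∷ w) ⟧

∑-first-block m ih x []      j = trans (cong₂ _+ℤ_ (∑-first-block-new m x [] j _) (∑-new-run m ih x [] j _)) (+-idˡ _)
∑-first-block m ih x (y ∷ w) j with x ≤? y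
... | no x≰y = trans (cong₂ _+ℤ_ (∑-first-block-new m x (y ∷ w) j (≰⇒> x≰y)) second) (+-idˡ _)
  where
  second : ∑ (startRun x (y ∷ w) (length m)) (λ d → weight (x ∷ y ∷ w) d (atomB d (suc j ∷ m))) ≡
    ⟦ allowed x (y ∷ w) (length m) ⟧ *ℤ ⟦ fits (j ∷ m) (just x) (y ∷ w) ⟧
  second rewrite ≤ᵇ-false {x} {y} (≰⇒> x≰y) = trans (∑-map (1 ∷_) (place (y ∷ w) (length m)))
    (∑-new-run m ih x (y ∷ w) j (≰⇒> x≰y))
... | yes x≤y = begin
  ∑ (place (x ∷ y ∷ w) n) (λ d → weight (x ∷ y ∷ w) d ((suc j ≤ᵇ first d ∸ 1) ∧ atomB (dec (suc j) d) m)) +ℤ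
  ∑ (startRun x (y ∷ w) n) (λ d → weight (x ∷ y ∷ w) d (atomB d (suc j ∷ m)))
    ≡⟨ cong₂ _+ℤ_ in-place in-startRun ⟩
  A *ℤ ∑ (place (y ∷ w) n) (λ e → weight (y ∷ w) e (takes j m e)) +ℤ
  A *ℤ ∑ (startRun y w n) (λ e → weight (y ∷ w) e (atomB e (j ∷ m)))
    ≡⟨ trans (sym (*-distribˡ A _ _)) (cong (A *ℤ_) (∑-same-run m ih x y w j x≤y)) ⟩
  A *ℤ ⟦ fits (j ∷ m) (just x) (y ∷ w) ⟧ ∎
  where
  open ≡-Reasoning
  n = length m
  A = ⟦ allowed x (y ∷ w) n ⟧
  in-place : ∑ (place (x ∷ y ∷ w) n) (λ d → weight (x ∷ y ∷ w) d ((suc j ≤ᵇ first d ∸ 1) ∧ atomB (dec (suc j) d) m)) ≡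
    A *ℤ ∑ (place (y ∷ w) n) (λ e → weight (y ∷ w) e (takes j m e))
  in-place = trans (cong (λ l → ∑ l (λ d → weight (x ∷ y ∷ w) d ((suc j ≤ᵇ first d ∸ 1) ∧ atomB (dec (suc j) d) m))) (place-incFirst w n x≤y))
    (trans (∑-map incFirst (place (y ∷ w) n))
    (trans (∑-cong-All (place-Placed y w n) (λ e p → trans
        (weight-incFirst w e _ x≤y p)
        (cong₂ (λ f γ → A *ℤ weight (y ∷ w) e ((suc j ≤ᵇ f ∸ 1) ∧ atomB γ m)) (first-incFirst e (proj₁ p)) (dec-incFirst j e (proj₁ p)))))
      (∑-*ˡ A (place (y ∷ w) n))))
  in-startRun : ∑ (startRun x (y ∷ w) n) (λ d → weight (x ∷ y ∷ w) d (atomB d (suc j ∷ m))) ≡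
    A *ℤ ∑ (startRun y w n) (λ e → weight (y ∷ w) e (atomB e (j ∷ m)))
  in-startRun rewrite ≤ᵇ-true x≤y = trans (∑-map incFirst (startRun y w n))
    (trans (∑-cong-All (startRun-Head y w n) (λ e h → weight-incFirst-Head w e m j x≤y h)) (∑-*ˡ A (startRun y w n)))

∑-same-run m ih x y w zero    x≤y = trans (cong₂ _+ℤ_
  (trans (∑-cong-All (place-Placed y w (length m)) (λ e p →
      cong₂ (λ b γ → weight (y ∷ w) e (b ∧ atomB γ m)) (≤ᵇ-true (proj₁ p)) (dec-0 e))) (ih (y ∷ w)))
  (startRun-zero y w (length m) m)) (+-idʳ _)
∑-same-run m ih x y w (suc j) x≤y = begin
  ∑ (place (y ∷ w) n) (λ e → weight (y ∷ w) e (takes (suc j) m e)) +ℤ ∑ (startRun y w n) (λ e → weight (y ∷ w) e (atomB e (suc j ∷ m)))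
    ≡⟨ cong (_+ℤ ∑ (startRun y w n) (λ e → weight (y ∷ w) e (atomB e (suc j ∷ m))))
         (∑-cong-All (place-Placed y w n) (λ e p → cong (λ b → weight (y ∷ w) e (b ∧ atomB (dec (suc j) e) m)) (bound (first e) (proj₁ p)))) ⟩
  ∑ (place (y ∷ w) n) (λ d → weight (y ∷ w) d ((suc j ≤ᵇ first d ∸ 1) ∧ atomB (dec (suc j) d) m)) +ℤ
  ∑ (startRun y w n) (λ e → weight (y ∷ w) e (atomB e (suc j ∷ m)))
    ≡⟨ ∑-first-block m ih y w j ⟩
  ⟦ allowed y w n ⟧ *ℤ ⟦ fits (j ∷ m) (just y) w ⟧
    ≡⟨ ⟦∧⟧ (allowed y w n) _ ⟨
  ⟦ fits (suc j ∷ m) nothing (y ∷ w) ⟧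
    ≡⟨ cong ⟦_⟧ (fits-raise (suc j ∷ m) nothing w refl x≤y) ⟩
  ⟦ fits (suc j ∷ m) (just x) (y ∷ w) ⟧ ∎
  where
  open ≡-Reasoning
  n = length m
  bound : ∀ f → 1 ≤ f → (2 + j ≤ᵇ f) ≡ (suc j ≤ᵇ f ∸ 1)
  bound (suc f) p = refl

fits-zeros : ∀ n → fits (replicate n 0) nothing [] ≡ true
fits-zeros zero    = refl
fits-zeros (suc n) = fits-zeros n

eqL-zeros : ∀ m → eqL (replicate (length m) 0) m ≡ fits m nothing []
eqL-zeros []          = refl
eqL-zeros (zero  ∷ m) = eqL-zeros m
eqL-zeros (suc c ∷ m) = refl

placesAt : ∀ m → PlacesAt m
placesAt m [] = trans (+-idʳ _) (trans (cong₂ _*ℤ_ (cong ⟦_⟧ (fits-zeros (length m)))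
  (cong ⟦_⟧ (trans (atomB-zeros (length m) m) (eqL-zeros m)))) (*-idˡ _))
placesAt []      (x ∷ w) = refl
placesAt (c ∷ m) (x ∷ w) = trans (∑-++ (map (0 ∷_) (place (x ∷ w) (length m))) _)
  (trans (cong (_+ℤ ∑ (startRun x w (length m)) (λ d → weight (x ∷ w) d (atomB d (c ∷ m)))) (∑-map (0 ∷_) (place (x ∷ w) (length m)))) (first-position c))
  where
  first-position : ∀ c →
    ∑ (place (x ∷ w) (length m)) (λ d → weight (x ∷ w) d ((c ≤ᵇ first d ∸ 1) ∧ atomB (dec c d) m)) +ℤ
    ∑ (startRun x w (length m)) (λ d → weight (x ∷ w) d (atomB d (c ∷ m))) ≡ ⟦ fits (c ∷ m) nothing (x ∷ w) ⟧
  first-position zero = trans (cong₂ _+ℤ_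
    (trans (∑-cong (place (x ∷ w) (length m)) (λ d → cong (λ γ → weight (x ∷ w) d (atomB γ m)) (dec-0 d))) (placesAt m (x ∷ w)))
    (startRun-zero x w (length m) m)) (+-idʳ _)
  first-position (suc j) = trans (∑-first-block m (placesAt m) x w j) (sym (⟦∧⟧ (allowed x w (length m)) _))

-- The product formula

wordA-letters : ∀ α → wordA α ≡ map just (letters 1 α)
wordA-letters []      = refl
wordA-letters (a ∷ α) = trans (cong₂ _++_ (sym (map-replicate just a _)) (wordA-letters α)) (sym (map-++ just (replicate a _) _))

wordB-letters : ∀ β → wordB β ≡ map just (letters 2 β)
wordB-letters []      = refl
wordB-letters (b ∷ β) = trans (cong₂ _++_ (sym (map-replicate just b _)) (wordB-letters β)) (sym (map-++ just (replicate b _) _))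

letters-parity : ∀ e α → All (λ x → isOdd x ≡ isOdd e) (letters e α)
letters-parity e []      = []
letters-parity e (a ∷ α) = All.++⁺ (All.replicate⁺ a (isOdd-2k+e (length α) e)) (letters-parity e α)

erase-just : ∀ w → erase (map just w) ≡ w
erase-just []      = refl
erase-just (x ∷ w) = cong (x ∷_) (erase-just w)

erase-stars : ∀ k → erase (stars k) ≡ []
erase-stars zero    = refl
erase-stars (suc k) = erase-stars k

erase-shuffle : ∀ w k → All (λ d → erase d ≡ w) (shuffle (map just w) (stars k))
erase-shuffle []      k       = erase-stars k ∷ []
erase-shuffle (x ∷ w) zero    = cong (x ∷_) (erase-just w) ∷ []
erase-shuffle (x ∷ w) (suc k) = All.++⁺
  (All.map⁺ (All.map (cong (x ∷_)) (erase-shuffle w (suc k))))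
  (All.map⁺ (erase-shuffle (x ∷ w) k))

length-addExp : ∀ e f → length e ≡ length f → length (addExp e f) ≡ length e
length-addExp []      []      l = refl
length-addExp (x ∷ e) (y ∷ f) l = cong suc (length-addExp e f (suc-injective l))

coeff-*P-short : ∀ {n} p q m → Homogeneous n p → Homogeneous n q → ¬ length m ≡ n → coeff (p *P q) m ≡ 0ℤ
coeff-*P-short p q m hp hq ne = trans (coeff-eval (p *P q) m) (trans (eval-*P (δ m) p q)
  (trans (eval-cong-Homogeneous hp (λ e le → trans
    (eval-cong-Homogeneous hq (λ f lf → cong ⟦_⟧ (eqL-length (addExp e f) m
      (λ l → ne (trans (sym l) (trans (length-addExp e f (trans le (sym lf))) le))))))
    (∑-vanish q (λ t → *-0ʳ (proj₁ t)))))
    (∑-vanish p (λ t → *-0ʳ (proj₁ t)))))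

coeff-sumP : ∀ {A : Set} (f : A → Poly) xs m → coeff (sumP (map f xs)) m ≡ ∑ xs (λ x → coeff (f x) m)
coeff-sumP f []       m = refl
coeff-sumP f (x ∷ xs) m = trans (coeff-++ (f x) _ m) (cong (coeff (f x) m +ℤ_) (coeff-sumP f xs m))

inQSSet-length : ∀ n α β d → inQSSet n α β d ≡ true → length (runs d) ≡ n
inQSSet-length n α β d e = ≡ᵇ-sound (proj₁ (∧-elim e))

-- The first two conditions describe the monomials of the slide, the last two those of the atom;
-- splitting by parity, in reverse, joins them into one condition on the whole word.
inQSSet-fits : ∀ {n} α β d → length α ≡ n → length β ≡ n → length (runs d) ≡ n →
  odds (erase d) ≡ letters 1 α → evens (erase d) ≡ letters 2 β →
  (flatS (DesA d) ≽ flatS α) ∧ (α ⊴ DesA d) ∧ (DesB d ⊴ qshift β) ∧ (β ⊴ DesB d) ≡ fits (Des d) nothing (erase d)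
inQSSet-fits α β d la lb lr oA eB = begin
  (flatS (DesA d) ≽ flatS α) ∧ (α ⊴ DesA d) ∧ (DesB d ⊴ qshift β) ∧ (β ⊴ DesB d)
    ≡⟨ ∧-assoc (flatS (DesA d) ≽ flatS α) _ _ ⟨
  ((flatS (DesA d) ≽ flatS α) ∧ (α ⊴ DesA d)) ∧ ((DesB d ⊴ qshift β) ∧ (β ⊴ DesB d))
    ≡⟨ cong₂ _∧_ (trans (slideB-correct α (DesA d) lA) (slideB-fits α (DesA d) lA))
                 (trans (atomB-correct β (DesB d) lB) (atomB-fits β (DesB d) lB)) ⟩
  fits (DesA d) nothing (letters 1 α) ∧ fits (DesB d) nothing (letters 2 β)
    ≡⟨ cong₂ (λ v w → fits (DesA d) nothing v ∧ fits (DesB d) nothing w) oA eB ⟨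
  fits (DesA d) nothing (odds (erase d)) ∧ fits (DesB d) nothing (evens (erase d))
    ≡⟨ fits-Des d ⟩
  fits (Des d) nothing (erase d) ∎
  where
  open ≡-Reasoning
  lA = trans la (sym (trans (length-map (count isOdd) (runs d)) lr))
  lB = trans lb (sym (trans (length-map (count evenᵇ) (runs d)) lr))

coeff-atom-Des : ∀ d m → length m ≡ length (runs d) → coeff (atom (Des d)) m ≡ ⟦ atomB (Des d) m ⟧
coeff-atom-Des d m l = Expands.coefficient (expands-atom (Des d)) m (trans l (sym (length-map length (runs d))))

summand : ℕ → List ℕ → List ℕ → List ℕ → Word → ℤ
summand n α β m d = ⟦ inQSSet n α β d ⟧ *ℤ coeff (atom (Des d)) m

summand-placed : ∀ {n} α β m d → length α ≡ n → length β ≡ n → length m ≡ n →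
  odds (erase d) ≡ letters 1 α → evens (erase d) ≡ letters 2 β →
  summand n α β m d ≡ placed n (λ e → weight (erase d) e (atomB e m)) d
summand-placed {n} α β m d la lb lm oA eB with length (runs d) ≡ᵇ n in len
... | false = trans (*-0ˡ _) (sym (*-0ˡ _))
... | true  = begin
  ⟦ starOK d ∧ _ ⟧ *ℤ coeff (atom (Des d)) m
    ≡⟨ cong₂ (λ b c → ⟦ starOK d ∧ b ⟧ *ℤ c) (inQSSet-fits α β d la lb (≡ᵇ-sound len) oA eB)
                                              (coeff-atom-Des d m (trans lm (sym (≡ᵇ-sound len)))) ⟩
  ⟦ starOK d ∧ fits (Des d) nothing (erase d) ⟧ *ℤ ⟦ atomB (Des d) m ⟧
    ≡⟨ trans (cong (_*ℤ ⟦ atomB (Des d) m ⟧) (⟦∧⟧ (starOK d) _)) (*ℤ-assoc ⟦ starOK d ⟧ _ _) ⟩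
  ⟦ starOK d ⟧ *ℤ (⟦ fits (Des d) nothing (erase d) ⟧ *ℤ ⟦ atomB (Des d) m ⟧) ∎
  where open ≡-Reasoning

coeff-product : ∀ {n} α β m → length α ≡ n → length β ≡ n → length m ≡ n →
  coeff (slide α *P atom β) m ≡ ∑ (shuf (letters 1 α) (letters 2 β)) (λ w → ⟦ fits m nothing w ⟧)
coeff-product α β m refl lb lm = begin
  coeff (slide α *P atom β) m
    ≡⟨ coeff-*P (slide α) (atom β) m (Expands.homogeneous (expands-slide α))
         (subst (λ k → Homogeneous k (atom β)) lb (Expands.homogeneous (expands-atom β))) lm ⟩
  conv m (λ c d → coeff (slide α) c *ℤ coeff (atom β) d)
    ≡⟨ conv-cong m (λ c d lc ld → cong₂ _*ℤ_
         (trans (Expands.coefficient (expands-slide α) c (trans lc lm)) (cong ⟦_⟧ (slideB-fits α c (sym (trans lc lm)))))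
         (trans (Expands.coefficient (expands-atom β) d (trans ld (trans lm (sym lb)))) (cong ⟦_⟧ (atomB-fits β d (trans lb (sym (trans ld lm))))))) ⟩
  conv m (λ c d → ⟦ fits c nothing (letters 1 α) ⟧ *ℤ ⟦ fits d nothing (letters 2 β) ⟧)
    ≡⟨ ∑-shuf-fits m nothing (letters-parity 1 α) (letters-parity 2 β) ⟨
  ∑ (shuf (letters 1 α) (letters 2 β)) (λ w → ⟦ fits m nothing w ⟧) ∎
  where open ≡-Reasoning

coeff-qSSet : ∀ n α β m →
  coeff (sumP (map (λ D → atom (Des D)) (qSSet n α β))) m ≡ ∑ (candidates n α β) (summand n α β m)
coeff-qSSet n α β m = trans (coeff-sumP (λ D → atom (Des D)) (qSSet n α β) m)
  (∑-filterB (inQSSet n α β) (candidates n α β))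

∑-candidates : ∀ n α β h → ∑ (candidates n α β) h ≡ ∑ (shuf (letters 1 α) (letters 2 β)) (λ w → ∑starred w n h)
∑-candidates n α β h = begin
  ∑ (candidates n α β) h
    ≡⟨ trans (∑-concatMap (λ k → concatMap (λ v → shuffle v (stars k)) (shuffle (wordA α) (wordB β))) (upTo (suc n)))
             (∑-cong (upTo (suc n)) (λ k → ∑-concatMap (λ v → shuffle v (stars k)) (shuffle (wordA α) (wordB β)))) ⟩
  ∑ (upTo (suc n)) (λ k → ∑ (shuffle (wordA α) (wordB β)) (λ v → ∑ (shuffle v (stars k)) h))
    ≡⟨ ∑-swap (upTo (suc n)) (shuffle (wordA α) (wordB β)) ⟩
  ∑ (shuffle (wordA α) (wordB β)) (λ v → ∑ (upTo (suc n)) (λ k → ∑ (shuffle v (stars k)) h))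
    ≡⟨ cong (λ l → ∑ l (λ v → ∑ (upTo (suc n)) (λ k → ∑ (shuffle v (stars k)) h)))
         (trans (cong₂ shuffle (wordA-letters α) (wordB-letters β)) (shuffle-just (letters 1 α) (letters 2 β))) ⟩
  ∑ (map (map just) (shuf (letters 1 α) (letters 2 β))) (λ v → ∑ (upTo (suc n)) (λ k → ∑ (shuffle v (stars k)) h))
    ≡⟨ ∑-map (map just) (shuf (letters 1 α) (letters 2 β)) ⟩
  ∑ (shuf (letters 1 α) (letters 2 β)) (λ w → ∑starred w n h) ∎
  where open ≡-Reasoning

∑-summand : ∀ n α β m → length α ≡ n → length β ≡ n → length m ≡ n →
  ∑ (candidates n α β) (summand n α β m) ≡ ∑ (shuf (letters 1 α) (letters 2 β)) (λ w → ⟦ fits m nothing w ⟧)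
∑-summand n α β m la lb lm = trans (∑-candidates n α β (summand n α β m))
  (∑-cong-All (All.zip (filterB-shuf isOdd odd (All.map id even) , filterB-shufʳ evenᵇ (All.map (cong not) odd) (All.map (cong not) even)))
    per-word)
  where
  open ≡-Reasoning
  odd  = letters-parity 1 α
  even = letters-parity 2 β
  per-word : ∀ w → odds w ≡ letters 1 α × evens w ≡ letters 2 β → ∑starred w n (summand n α β m) ≡ ⟦ fits m nothing w ⟧
  per-word w (oA , eB) = begin
    ∑starred w n (summand n α β m)
      ≡⟨ ∑-cong (upTo (suc n)) (λ k → ∑-cong-All (erase-shuffle w k) (λ { d refl → summand-placed α β m d la lb lm oA eB })) ⟩
    ∑starred w n (placed n (λ e → weight w e (atomB e m)))
      ≡⟨ ∑-placed w n n ≤-refl (λ e → weight w e (atomB e m)) ⟩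
    ∑ (place w n) (λ e → weight w e (atomB e m))
      ≡⟨ subst (λ k → ∑ (place w k) (λ e → weight w e (atomB e m)) ≡ ⟦ fits m nothing w ⟧) lm (placesAt m w) ⟩
    ⟦ fits m nothing w ⟧ ∎

summand-short : ∀ n α β m d → ¬ length m ≡ n → summand n α β m d ≡ 0ℤ
summand-short n α β m d ne with inQSSet n α β d in e
... | false = *-0ˡ _
... | true  = trans (*-idˡ _) (coeff-Homogeneous m (Expands.homogeneous (expands-atom (Des d)))
  (λ l → ne (trans l (trans (length-map length (runs d)) (inQSSet-length n α β d e)))))

mainTheorem5 : (n : ℕ) (α β : Vec ℕ n) →
    (slide (toList α) *P atom (toList β))
    ≈P sumP (map (λ D → atom (Des D)) (qSSet n (toList α) (toList β)))
-- The relation `≈P` ranges over lists m of every length. Outside length n both sides vanish, and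
-- that case is separate because `coeff-*P` expects m to have the right length.
mainTheorem5 n α β m with length m ≟ n
... | yes lm = trans (coeff-product (toList α) (toList β) m (length-toList α) (length-toList β) lm)
  (sym (trans (coeff-qSSet n (toList α) (toList β) m)
    (∑-summand n (toList α) (toList β) m (length-toList α) (length-toList β) lm)))
... | no ne = trans
  (coeff-*P-short (slide (toList α)) (atom (toList β)) m
    (subst (λ k → Homogeneous k (slide (toList α))) (length-toList α) (Expands.homogeneous (expands-slide (toList α))))
    (subst (λ k → Homogeneous k (atom (toList β))) (length-toList β) (Expands.homogeneous (expands-atom (toList β)))) ne)
  (sym (trans (coeff-qSSet n (toList α) (toList β) m)
    (∑-vanish (candidates n (toList α) (toList β)) (λ d → summand-short n (toList α) (toList β) m d ne))))
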